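{- Let $E$ be an elliptic curve over the finite field $\mathbb F_q$, let $a_q=q+1-\#E(\mathbb F_q)$, and let $\pi:E\to\mathbb P^1$ be the degree $2$ map given by the $x$-coordinate of a Weierstrass equation of $E$. Let $s_q(E)$ and $i_q(E)$ be the numbers of split and inert points of $\mathbb P^1(\mathbb F_q)$, respectively. Then $$a_q=i_q(E)-s_q(E),$$ and for every $n\ge 0$, $$\#\operatorname{Sym}^nE(\mathbb F_q)=\sum_{i+j=n}\Big[(q^i+\cdots+q+1)\sum_{\alpha\in\operatorname{Sym}^j\mathbb P^1(\mathbb F_q)}\chi(\alpha)\Big],$$ where $i,j\ge0$.
   Context: For a closed point $x\in|\mathbb P^1|$ and $y\in\pi^{ -1}(x)$, let $e(y\mid x)$ be the ramification index and $f(y\mid x)=[k(y):k(x)]$. The point $x$ is ramified if $e(y\mid x)>1$ for some $y\in\pi^{ -1}(x)$; split if $e(y\mid x)=f(y\mid x)=1$ for all $y\in\pi^{ -1}(x)$; inert if $\pi^{ -1}(x)$ is a single closed point $y$ with $e(y\mid x)=1$. Set $\chi(x)=0,1,-1$ if $x$ is ramified, split, inert respectively. The set $\operatorname{Sym}^n X(\mathbb F_q)$, for a smooth projective curve $X/\mathbb F_q$, is identified with the set of effective $0$-cycles $\alpha=\sum_{x\in|X|}a_xx$ ($a_x\ge0$, finitely many nonzero) of degree $\sum_x a_x[k(x):\mathbb F_q]=n$. The function $\chi$ is extended to effective $0$-cycles on $\mathbb P^1$ multiplicatively: $\chi(\sum a_xx)=\prod_x\chi(x)^{a_x}$ (with $\chi(x)^0=1$).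 -}

module Defs where

open import Algebra.Bundles using (CommutativeRing)
open import Algebra.Morphism.Structures using (module RingMorphisms)
import Algebra.Definitions.RawMonoid as RawMonoid
import Algebra.Morphism.Construct.Identity as Identity
open import Data.Empty.Polymorphic using (⊥)
open import Data.Fin.Base using (Fin)
open import Data.Integer.Base as ℤ using (ℤ; 0ℤ; 1ℤ; -1ℤ)
import Data.Integer.Properties as ℤ
open import Data.List.Base using (List; []; _∷_; map; foldr)
import Data.Nat.ListAction as List
import Data.List.Relation.Binary.Permutation.Setoid as Permutation
open import Data.List.Relation.Binary.Pointwise using (Pointwise)
open import Data.Nat.Base as ℕ using (ℕ; zero; suc)
open import Data.Product.Base using (∃; ∃-syntax; Σ-syntax; _×_; _,_; proj₁; proj₂)
open import Data.Sum.Base using (_⊎_; inj₁; inj₂)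
open import Data.Sum.Relation.Binary.Pointwise using (_⊎ₛ_)
open import Data.Product.Relation.Binary.Pointwise.NonDependent using (_×ₛ_)
open import Data.Unit.Polymorphic.Base using (⊤)
open import Data.Vec.Functional using (Vector)
open import Function.Base using (_∘_; id)
open import Function.Bundles using (Bijection; module Bijection)
open import Level using (Level; _⊔_) renaming (suc to lsuc)
open import Relation.Binary.Bundles using (Setoid)
import Relation.Binary.Construct.On as On
open import Relation.Binary.PropositionalEquality.Core using (_≡_)
import Relation.Binary.PropositionalEquality.Properties as ≡
import Relation.Binary.Reasoning.Setoid as SetoidReasoning
open import Relation.Nullary using (¬_)
open import Relation.Unary using (Pred; _∈_; _∉_; _≐_)
open import Relation.Unary.Properties using (≐-refl; ≐-sym; ≐-trans)

private variable
  a b ℓ ℓ₁ ℓ₂ : Level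

------------------------------------------------------------------------
-- Finite setoids

Finite : Setoid a ℓ → Set (a ⊔ ℓ)
Finite S = ∃[ n ] Bijection (≡.setoid (Fin n)) S

∣_∣ : {S : Setoid a ℓ} → Finite S → ℕ
∣ fin ∣ = proj₁ fin

-- The value does not depend on the enumeration when f respects the
-- equality of S.
sumOver : {S : Setoid a ℓ} → Finite S → (Setoid.Carrier S → ℤ) → ℤ
sumOver (_ , enum) f = RawMonoid.sum ℤ.+-0-rawMonoid (f ∘ Bijection.to enum)

subsetoid : (S : Setoid a ℓ) → Pred (Setoid.Carrier S) b → Setoid (a ⊔ b) ℓ
subsetoid S P = On.setoid {B = ∃ P} S proj₁

------------------------------------------------------------------------
-- Polynomials

-- A polynomial is the list of its coefficients, constant term first.
-- Trailing zeros are allowed, and equality compares all coefficients.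
module Polynomial (R : CommutativeRing a ℓ) where

  open CommutativeRing R
  open import Algebra.Properties.Ring ring using (-0#≈0#)
  private module R = SetoidReasoning setoid

  Poly : Set a
  Poly = List Carrier

  coeff : Poly → ℕ → Carrier
  coeff []      _       = 0#
  coeff (a ∷ p) zero    = a
  coeff (a ∷ p) (suc n) = coeff p n

  infix  4 _≈ₚ_
  infixl 6 _+ₚ_
  infixl 7 _*ₚ_

  record _≈ₚ_ (p q : Poly) : Set ℓ where
    constructor mk≈ₚ
    field at : ∀ n → coeff p n ≈ coeff q n

  open _≈ₚ_ public

  _+ₚ_ : Poly → Poly → Poly
  []      +ₚ q       = q
  (a ∷ p) +ₚ []      = a ∷ p
  (a ∷ p) +ₚ (b ∷ q) = a + b ∷ p +ₚ q

  -ₚ_ : Poly → Poly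
  -ₚ_ = map (-_)

  scale : Carrier → Poly → Poly
  scale a = map (a *_)

  _*ₚ_ : Poly → Poly → Poly
  []      *ₚ q = []
  (a ∷ p) *ₚ q = scale a q +ₚ (0# ∷ p *ₚ q)

  const : Carrier → Poly
  const a = a ∷ []

  X : Poly
  X = 0# ∷ 1# ∷ []

  coeff-+ : ∀ p q n → coeff (p +ₚ q) n ≈ coeff p n + coeff q n
  coeff-+ []      q       n       = sym (+-identityˡ _)
  coeff-+ (a ∷ p) []      n       = sym (+-identityʳ _)
  coeff-+ (a ∷ p) (b ∷ q) zero    = refl
  coeff-+ (a ∷ p) (b ∷ q) (suc n) = coeff-+ p q n

  coeff-neg : ∀ p n → coeff (-ₚ p) n ≈ - coeff p n
  coeff-neg []      n       = sym -0#≈0#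
  coeff-neg (a ∷ p) zero    = refl
  coeff-neg (a ∷ p) (suc n) = coeff-neg p n

  coeff-scale : ∀ a p n → coeff (scale a p) n ≈ a * coeff p n
  coeff-scale a []      n       = sym (zeroʳ a)
  coeff-scale a (b ∷ p) zero    = refl
  coeff-scale a (b ∷ p) (suc n) = coeff-scale a p n

  reflₚ : ∀ {p} → p ≈ₚ p
  reflₚ = mk≈ₚ λ _ → refl

  symₚ : ∀ {p q} → p ≈ₚ q → q ≈ₚ p
  symₚ p≈q = mk≈ₚ λ n → sym (at p≈q n)

  transₚ : ∀ {p q r} → p ≈ₚ q → q ≈ₚ r → p ≈ₚ r
  transₚ p≈q q≈r = mk≈ₚ λ n → trans (at p≈q n) (at q≈r n)

  setoidₚ : Setoid a ℓ
  setoidₚ = record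
    { _≈_ = _≈ₚ_
    ; isEquivalence = record { refl = reflₚ ; sym = symₚ ; trans = transₚ } }

  private module P = SetoidReasoning setoidₚ

  ∷-cong : ∀ {a b p q} → a ≈ b → p ≈ₚ q → a ∷ p ≈ₚ b ∷ q
  ∷-cong a≈b p≈q = mk≈ₚ λ where
    zero    → a≈b
    (suc n) → at p≈q n

  0∷[]≈[] : 0# ∷ [] ≈ₚ []
  0∷[]≈[] = mk≈ₚ λ where
    zero    → refl
    (suc n) → refl

  +ₚ-cong : ∀ {p p′ q q′} → p ≈ₚ p′ → q ≈ₚ q′ → p +ₚ q ≈ₚ p′ +ₚ q′
  +ₚ-cong {p} {p′} {q} {q′} e f = mk≈ₚ λ n →
    trans (coeff-+ p q n) (trans (+-cong (at e n) (at f n)) (sym (coeff-+ p′ q′ n)))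

  +ₚ-assoc : ∀ p q r → (p +ₚ q) +ₚ r ≈ₚ p +ₚ (q +ₚ r)
  +ₚ-assoc p q r = mk≈ₚ λ n → R.begin
    coeff ((p +ₚ q) +ₚ r) n              R.≈⟨ coeff-+ (p +ₚ q) r n ⟩
    coeff (p +ₚ q) n + coeff r n         R.≈⟨ +-congʳ (coeff-+ p q n) ⟩
    (coeff p n + coeff q n) + coeff r n  R.≈⟨ +-assoc _ _ _ ⟩
    coeff p n + (coeff q n + coeff r n)  R.≈⟨ +-congˡ (coeff-+ q r n) ⟨
    coeff p n + coeff (q +ₚ r) n         R.≈⟨ coeff-+ p (q +ₚ r) n ⟨
    coeff (p +ₚ (q +ₚ r)) n              R.∎

  +ₚ-comm : ∀ p q → p +ₚ q ≈ₚ q +ₚ p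
  +ₚ-comm p q = mk≈ₚ λ n →
    trans (coeff-+ p q n) (trans (+-comm _ _) (sym (coeff-+ q p n)))

  +ₚ-identityʳ : ∀ p → p +ₚ [] ≈ₚ p
  +ₚ-identityʳ p = +ₚ-comm p []

  +ₚ-inverseʳ : ∀ p → p +ₚ (-ₚ p) ≈ₚ []
  +ₚ-inverseʳ p = mk≈ₚ λ n →
    trans (coeff-+ p (-ₚ p) n) (trans (+-congˡ (coeff-neg p n)) (-‿inverseʳ _))

  -ₚ-cong : ∀ {p q} → p ≈ₚ q → -ₚ p ≈ₚ -ₚ q
  -ₚ-cong {p} {q} e = mk≈ₚ λ n →
    trans (coeff-neg p n) (trans (-‿cong (at e n)) (sym (coeff-neg q n)))

  +ₚ-medial : ∀ p q r s → (p +ₚ q) +ₚ (r +ₚ s) ≈ₚ (p +ₚ r) +ₚ (q +ₚ s)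
  +ₚ-medial p q r s = P.begin
    (p +ₚ q) +ₚ (r +ₚ s)  P.≈⟨ +ₚ-assoc p q (r +ₚ s) ⟩
    p +ₚ (q +ₚ (r +ₚ s))  P.≈⟨ +ₚ-cong (reflₚ {p}) (+ₚ-assoc q r s) ⟨
    p +ₚ ((q +ₚ r) +ₚ s)  P.≈⟨ +ₚ-cong (reflₚ {p}) (+ₚ-cong (+ₚ-comm q r) (reflₚ {s})) ⟩
    p +ₚ ((r +ₚ q) +ₚ s)  P.≈⟨ +ₚ-cong (reflₚ {p}) (+ₚ-assoc r q s) ⟩
    p +ₚ (r +ₚ (q +ₚ s))  P.≈⟨ +ₚ-assoc p r (q +ₚ s) ⟨
    (p +ₚ r) +ₚ (q +ₚ s)  P.∎

  0∷-+ : ∀ p q → 0# ∷ (p +ₚ q) ≈ₚ (0# ∷ p) +ₚ (0# ∷ q)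
  0∷-+ p q = ∷-cong (sym (+-identityˡ 0#)) reflₚ

  scale-cong : ∀ {a b p q} → a ≈ b → p ≈ₚ q → scale a p ≈ₚ scale b q
  scale-cong {a} {b} {p} {q} e f = mk≈ₚ λ n →
    trans (coeff-scale a p n) (trans (*-cong e (at f n)) (sym (coeff-scale b q n)))

  scale-+ : ∀ a p q → scale a (p +ₚ q) ≈ₚ scale a p +ₚ scale a q
  scale-+ a p q = mk≈ₚ λ n → R.begin
    coeff (scale a (p +ₚ q)) n                     R.≈⟨ coeff-scale a (p +ₚ q) n ⟩
    a * coeff (p +ₚ q) n                           R.≈⟨ *-congˡ (coeff-+ p q n) ⟩
    a * (coeff p n + coeff q n)                    R.≈⟨ distribˡ _ _ _ ⟩
    a * coeff p n + a * coeff q n                  R.≈⟨ +-cong (coeff-scale a p n) (coeff-scale a q n) ⟨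
    coeff (scale a p) n + coeff (scale a q) n      R.≈⟨ coeff-+ (scale a p) (scale a q) n ⟨
    coeff (scale a p +ₚ scale a q) n               R.∎

  +-scale : ∀ a b p → scale (a + b) p ≈ₚ scale a p +ₚ scale b p
  +-scale a b p = mk≈ₚ λ n → R.begin
    coeff (scale (a + b) p) n                      R.≈⟨ coeff-scale (a + b) p n ⟩
    (a + b) * coeff p n                            R.≈⟨ distribʳ _ _ _ ⟩
    a * coeff p n + b * coeff p n                  R.≈⟨ +-cong (coeff-scale a p n) (coeff-scale b p n) ⟨
    coeff (scale a p) n + coeff (scale b p) n      R.≈⟨ coeff-+ (scale a p) (scale b p) n ⟨
    coeff (scale a p +ₚ scale b p) n               R.∎

  scale-scale : ∀ a b p → scale a (scale b p) ≈ₚ scale (a * b) p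
  scale-scale a b p = mk≈ₚ λ n → R.begin
    coeff (scale a (scale b p)) n  R.≈⟨ coeff-scale a (scale b p) n ⟩
    a * coeff (scale b p) n        R.≈⟨ *-congˡ (coeff-scale b p n) ⟩
    a * (b * coeff p n)            R.≈⟨ *-assoc _ _ _ ⟨
    (a * b) * coeff p n            R.≈⟨ coeff-scale (a * b) p n ⟨
    coeff (scale (a * b) p) n      R.∎

  0-scale : ∀ p → scale 0# p ≈ₚ []
  0-scale p = mk≈ₚ λ n → trans (coeff-scale 0# p n) (zeroˡ _)

  1-scale : ∀ p → scale 1# p ≈ₚ p
  1-scale p = mk≈ₚ λ n → trans (coeff-scale 1# p n) (*-identityˡ _)

  scale-0∷ : ∀ a p → scale a (0# ∷ p) ≈ₚ 0# ∷ scale a p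
  scale-0∷ a p = ∷-cong (zeroʳ a) reflₚ

  *ₚ-zeroʳ : ∀ p → p *ₚ [] ≈ₚ []
  *ₚ-zeroʳ []      = reflₚ
  *ₚ-zeroʳ (a ∷ p) = transₚ (∷-cong refl (*ₚ-zeroʳ p)) 0∷[]≈[]

  *ₚ-congˡ : ∀ p {q r} → q ≈ₚ r → p *ₚ q ≈ₚ p *ₚ r
  *ₚ-congˡ []      e = reflₚ
  *ₚ-congˡ (a ∷ p) e = +ₚ-cong (scale-cong refl e) (∷-cong refl (*ₚ-congˡ p e))

  *ₚ-∷ : ∀ q a p → q *ₚ (a ∷ p) ≈ₚ scale a q +ₚ (0# ∷ q *ₚ p)
  *ₚ-∷ []      a p = symₚ 0∷[]≈[]
  *ₚ-∷ (b ∷ q) a p = ∷-cong (+-congʳ (*-comm b a)) (P.begin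
    scale b p +ₚ q *ₚ (a ∷ p)
      P.≈⟨ +ₚ-cong (reflₚ {scale b p}) (*ₚ-∷ q a p) ⟩
    scale b p +ₚ (scale a q +ₚ (0# ∷ q *ₚ p))
      P.≈⟨ +ₚ-assoc (scale b p) (scale a q) _ ⟨
    (scale b p +ₚ scale a q) +ₚ (0# ∷ q *ₚ p)
      P.≈⟨ +ₚ-cong (+ₚ-comm (scale b p) (scale a q)) (reflₚ {0# ∷ q *ₚ p}) ⟩
    (scale a q +ₚ scale b p) +ₚ (0# ∷ q *ₚ p)
      P.≈⟨ +ₚ-assoc (scale a q) (scale b p) _ ⟩
    scale a q +ₚ (scale b p +ₚ (0# ∷ q *ₚ p)) P.∎)

  *ₚ-comm : ∀ p q → p *ₚ q ≈ₚ q *ₚ p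
  *ₚ-comm []      q = symₚ (*ₚ-zeroʳ q)
  *ₚ-comm (a ∷ p) q = transₚ
    (+ₚ-cong (reflₚ {scale a q}) (∷-cong refl (*ₚ-comm p q)))
    (symₚ (*ₚ-∷ q a p))

  *ₚ-cong : ∀ {p p′ q q′} → p ≈ₚ p′ → q ≈ₚ q′ → p *ₚ q ≈ₚ p′ *ₚ q′
  *ₚ-cong {p} {p′} {q} {q′} e f = P.begin
    p *ₚ q    P.≈⟨ *ₚ-congˡ p f ⟩
    p *ₚ q′   P.≈⟨ *ₚ-comm p q′ ⟩
    q′ *ₚ p   P.≈⟨ *ₚ-congˡ q′ e ⟩
    q′ *ₚ p′  P.≈⟨ *ₚ-comm q′ p′ ⟩
    p′ *ₚ q′  P.∎

  *ₚ-distribˡ : ∀ p q r → p *ₚ (q +ₚ r) ≈ₚ p *ₚ q +ₚ p *ₚ r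
  *ₚ-distribˡ []      q r = reflₚ
  *ₚ-distribˡ (a ∷ p) q r = P.begin
    scale a (q +ₚ r) +ₚ (0# ∷ p *ₚ (q +ₚ r))
      P.≈⟨ +ₚ-cong (scale-+ a q r)
             (transₚ (∷-cong refl (*ₚ-distribˡ p q r)) (0∷-+ (p *ₚ q) (p *ₚ r))) ⟩
    (scale a q +ₚ scale a r) +ₚ ((0# ∷ p *ₚ q) +ₚ (0# ∷ p *ₚ r))
      P.≈⟨ +ₚ-medial (scale a q) (scale a r) _ _ ⟩
    (scale a q +ₚ (0# ∷ p *ₚ q)) +ₚ (scale a r +ₚ (0# ∷ p *ₚ r)) P.∎

  *ₚ-distribʳ : ∀ r p q → (p +ₚ q) *ₚ r ≈ₚ p *ₚ r +ₚ q *ₚ r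
  *ₚ-distribʳ r p q = P.begin
    (p +ₚ q) *ₚ r     P.≈⟨ *ₚ-comm (p +ₚ q) r ⟩
    r *ₚ (p +ₚ q)     P.≈⟨ *ₚ-distribˡ r p q ⟩
    r *ₚ p +ₚ r *ₚ q  P.≈⟨ +ₚ-cong (*ₚ-comm r p) (*ₚ-comm r q) ⟩
    p *ₚ r +ₚ q *ₚ r  P.∎

  0∷-* : ∀ p q → (0# ∷ p) *ₚ q ≈ₚ 0# ∷ p *ₚ q
  0∷-* p q = +ₚ-cong (0-scale q) reflₚ

  scale-* : ∀ a p q → scale a p *ₚ q ≈ₚ scale a (p *ₚ q)
  scale-* a []      q = reflₚ
  scale-* a (b ∷ p) q = P.begin
    scale (a * b) q +ₚ (0# ∷ scale a p *ₚ q)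
      P.≈⟨ +ₚ-cong (symₚ (scale-scale a b q))
             (transₚ (∷-cong refl (scale-* a p q)) (symₚ (scale-0∷ a (p *ₚ q)))) ⟩
    scale a (scale b q) +ₚ scale a (0# ∷ p *ₚ q)
      P.≈⟨ scale-+ a (scale b q) (0# ∷ p *ₚ q) ⟨
    scale a (scale b q +ₚ (0# ∷ p *ₚ q)) P.∎

  *ₚ-assoc : ∀ p q r → (p *ₚ q) *ₚ r ≈ₚ p *ₚ (q *ₚ r)
  *ₚ-assoc []      q r = reflₚ
  *ₚ-assoc (a ∷ p) q r = P.begin
    (scale a q +ₚ (0# ∷ p *ₚ q)) *ₚ r
      P.≈⟨ *ₚ-distribʳ r (scale a q) (0# ∷ p *ₚ q) ⟩
    scale a q *ₚ r +ₚ (0# ∷ p *ₚ q) *ₚ r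
      P.≈⟨ +ₚ-cong (scale-* a q r)
             (transₚ (0∷-* (p *ₚ q) r) (∷-cong refl (*ₚ-assoc p q r))) ⟩
    scale a (q *ₚ r) +ₚ (0# ∷ p *ₚ (q *ₚ r)) P.∎

  *ₚ-identityˡ : ∀ p → const 1# *ₚ p ≈ₚ p
  *ₚ-identityˡ p = P.begin
    scale 1# p +ₚ (0# ∷ [])  P.≈⟨ +ₚ-cong (1-scale p) 0∷[]≈[] ⟩
    p +ₚ []                  P.≈⟨ +ₚ-identityʳ p ⟩
    p                        P.∎

  commutativeRing : CommutativeRing a ℓ
  commutativeRing = record
    { Carrier = Poly
    ; _≈_     = _≈ₚ_
    ; _+_     = _+ₚ_
    ; _*_     = _*ₚ_
    ; -_      = -ₚ_
    ; 0#      = []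
    ; 1#      = const 1#
    ; isCommutativeRing = record
      { isRing = record
        { +-isAbelianGroup = record
          { isGroup = record
            { isMonoid = record
              { isSemigroup = record
                { isMagma = record
                  { isEquivalence = Setoid.isEquivalence setoidₚ
                  ; ∙-cong = +ₚ-cong }
                ; assoc = +ₚ-assoc }
              ; identity = (λ _ → reflₚ) , +ₚ-identityʳ }
            ; inverse = (λ p → transₚ (+ₚ-comm (-ₚ p) p) (+ₚ-inverseʳ p)) , +ₚ-inverseʳ
            ; ⁻¹-cong = -ₚ-cong }
          ; comm = +ₚ-comm }
        ; *-cong = *ₚ-cong
        ; *-assoc = *ₚ-assoc
        ; *-identity = *ₚ-identityˡ ,
            λ p → transₚ (*ₚ-comm p (const 1#)) (*ₚ-identityˡ p)
        ; distrib = *ₚ-distribˡ , *ₚ-distribʳ }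
      ; *-comm = *ₚ-comm } }

  private
    module Const = RingMorphisms rawRing (CommutativeRing.rawRing commutativeRing)

  const-isRingHomomorphism : Const.IsRingHomomorphism const
  const-isRingHomomorphism = record
    { isSemiringHomomorphism = record
      { isNearSemiringHomomorphism = record
        { +-isMonoidHomomorphism = record
          { isMagmaHomomorphism = record
            { isRelHomomorphism = record { cong = λ e → ∷-cong e reflₚ }
            ; homo = λ _ _ → reflₚ }
          ; ε-homo = 0∷[]≈[] }
        ; *-homo = λ _ _ → ∷-cong (sym (+-identityʳ _)) reflₚ }
      ; 1#-homo = reflₚ }
    ; -‿homo = λ _ → reflₚ }

------------------------------------------------------------------------
-- The quotient R/(w)

module PrincipalQuotient (R : CommutativeRing a ℓ) (w : CommutativeRing.Carrier R) where

  open CommutativeRing R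
  open import Algebra.Properties.AbelianGroup +-abelianGroup
    using () renaming (⁻¹-∙-comm to -‿+-comm)
  open import Algebra.Properties.CommutativeSemigroup +-commutativeSemigroup
    using () renaming (interchange to +-medial)
  open import Algebra.Properties.Ring ring using (-‿distribˡ-*)
  private module R = SetoidReasoning setoid

  infix 4 _≈ᵐ_

  _≈ᵐ_ : Carrier → Carrier → Set (a ⊔ ℓ)
  x ≈ᵐ y = ∃[ m ] x ≈ y + m * w

  ≈⇒≈ᵐ : ∀ {x y} → x ≈ y → x ≈ᵐ y
  ≈⇒≈ᵐ {x} {y} e = 0# , trans e (sym (trans (+-congˡ (zeroˡ w)) (+-identityʳ y)))

  symᵐ : ∀ {x y} → x ≈ᵐ y → y ≈ᵐ x
  symᵐ {x} {y} (m , e) = - m , trans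
    (sym (trans (+-assoc y _ _) (trans (+-congˡ cancel) (+-identityʳ y))))
    (+-congʳ (sym e))
    where
    cancel : m * w + - m * w ≈ 0#
    cancel = trans (+-congˡ (sym (-‿distribˡ-* m w))) (-‿inverseʳ (m * w))

  transᵐ : ∀ {x y z} → x ≈ᵐ y → y ≈ᵐ z → x ≈ᵐ z
  transᵐ {x} {y} {z} (m , e) (n , f) = n + m , (R.begin
    x                    R.≈⟨ e ⟩
    y + m * w            R.≈⟨ +-congʳ f ⟩
    (z + n * w) + m * w  R.≈⟨ +-assoc _ _ _ ⟩
    z + (n * w + m * w)  R.≈⟨ +-congˡ (distribʳ w n m) ⟨
    z + (n + m) * w      R.∎)

  +-congᵐ : ∀ {x y u v} → x ≈ᵐ y → u ≈ᵐ v → x + u ≈ᵐ y + v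
  +-congᵐ {x} {y} {u} {v} (m , e) (n , f) = m + n , (R.begin
    x + u                        R.≈⟨ +-cong e f ⟩
    (y + m * w) + (v + n * w)    R.≈⟨ +-medial y (m * w) v (n * w) ⟩
    (y + v) + (m * w + n * w)    R.≈⟨ +-congˡ (distribʳ w m n) ⟨
    (y + v) + (m + n) * w        R.∎)

  *-congʳᵐ : ∀ {x y} u → x ≈ᵐ y → x * u ≈ᵐ y * u
  *-congʳᵐ {x} {y} u (m , e) = u * m , (R.begin
    x * u                  R.≈⟨ *-congʳ e ⟩
    (y + m * w) * u        R.≈⟨ distribʳ u y (m * w) ⟩
    y * u + m * w * u      R.≈⟨ +-congˡ (*-comm (m * w) u) ⟩
    y * u + u * (m * w)    R.≈⟨ +-congˡ (*-assoc u m w) ⟨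
    y * u + u * m * w      R.∎)

  *-congᵐ : ∀ {x y u v} → x ≈ᵐ y → u ≈ᵐ v → x * u ≈ᵐ y * v
  *-congᵐ {x} {y} {u} {v} e f = transᵐ (*-congʳᵐ u e)
    (transᵐ (≈⇒≈ᵐ (*-comm y u)) (transᵐ (*-congʳᵐ y f) (≈⇒≈ᵐ (*-comm v y))))

  -‿congᵐ : ∀ {x y} → x ≈ᵐ y → - x ≈ᵐ - y
  -‿congᵐ {x} {y} (m , e) = - m , (R.begin
    - x                  R.≈⟨ -‿cong e ⟩
    - (y + m * w)        R.≈⟨ -‿+-comm y (m * w) ⟨
    - y + - (m * w)      R.≈⟨ +-congˡ (-‿distribˡ-* m w) ⟩
    - y + - m * w        R.∎)

  commutativeRing : CommutativeRing a (a ⊔ ℓ)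
  commutativeRing = record
    { Carrier = Carrier
    ; _≈_     = _≈ᵐ_
    ; _+_     = _+_
    ; _*_     = _*_
    ; -_      = -_
    ; 0#      = 0#
    ; 1#      = 1#
    ; isCommutativeRing = record
      { isRing = record
        { +-isAbelianGroup = record
          { isGroup = record
            { isMonoid = record
              { isSemigroup = record
                { isMagma = record
                  { isEquivalence = record
                    { refl = ≈⇒≈ᵐ refl ; sym = symᵐ ; trans = transᵐ }
                  ; ∙-cong = +-congᵐ }
                ; assoc = λ x y z → ≈⇒≈ᵐ (+-assoc x y z) }
              ; identity = (λ x → ≈⇒≈ᵐ (+-identityˡ x)) , (λ x → ≈⇒≈ᵐ (+-identityʳ x)) }
            ; inverse = (λ x → ≈⇒≈ᵐ (-‿inverseˡ x)) , (λ x → ≈⇒≈ᵐ (-‿inverseʳ x))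
            ; ⁻¹-cong = -‿congᵐ }
          ; comm = λ x y → ≈⇒≈ᵐ (+-comm x y) }
        ; *-cong = *-congᵐ
        ; *-assoc = λ x y z → ≈⇒≈ᵐ (*-assoc x y z)
        ; *-identity = (λ x → ≈⇒≈ᵐ (*-identityˡ x)) , (λ x → ≈⇒≈ᵐ (*-identityʳ x))
        ; distrib = (λ x y z → ≈⇒≈ᵐ (distribˡ x y z)) , (λ x y z → ≈⇒≈ᵐ (distribʳ x y z)) }
      ; *-comm = λ x y → ≈⇒≈ᵐ (*-comm x y) } }

------------------------------------------------------------------------
-- Ideals and closed points of affine schemes

module Ideals (R : CommutativeRing a ℓ) where

  open CommutativeRing R
  open RawMonoid +-rawMonoid using (sum)

  record IsIdeal (I : Pred Carrier (a ⊔ ℓ)) : Set (a ⊔ ℓ) where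
    field
      resp : ∀ {x y} → x ≈ y → x ∈ I → y ∈ I
      0∈   : 0# ∈ I
      +∈   : ∀ {x y} → x ∈ I → y ∈ I → x + y ∈ I
      *∈   : ∀ r {x} → x ∈ I → r * x ∈ I

  -- Maximality is stated constructively: R/I is a nontrivial ring in which
  -- every element is either zero or invertible.
  record MaximalIdeal : Set (lsuc (a ⊔ ℓ)) where
    field
      ideal   : Pred Carrier (a ⊔ ℓ)
      isIdeal : IsIdeal ideal
      proper  : 1# ∉ ideal
      maximal : ∀ x → x ∈ ideal ⊎ ∃[ y ] 1# - y * x ∈ ideal

    open IsIdeal isIdeal public

  open MaximalIdeal public using (ideal)

  maxSpec : Setoid (lsuc (a ⊔ ℓ)) (a ⊔ ℓ)
  maxSpec = record
    { Carrier = MaximalIdeal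
    ; _≈_     = λ P Q → ideal P ≐ ideal Q
    ; isEquivalence = record { refl = ≐-refl ; sym = ≐-sym ; trans = ≐-trans } }

  infixl 7 _·_
  infixr 8 _^_

  _·_ : ∀ {ℓ₁ ℓ₂} → Pred Carrier ℓ₁ → Pred Carrier ℓ₂ → Pred Carrier (a ⊔ ℓ ⊔ ℓ₁ ⊔ ℓ₂)
  (I · J) x = ∃[ m ] Σ[ u ∈ Vector Carrier m ] Σ[ v ∈ Vector Carrier m ]
    (∀ i → u i ∈ I) × (∀ i → v i ∈ J) × x ≈ sum (λ i → u i * v i)

  _^_ : Pred Carrier (a ⊔ ℓ) → ℕ → Pred Carrier (a ⊔ ℓ)
  I ^ zero  = λ _ → ⊤
  I ^ suc n = I · I ^ n

module _ (A : CommutativeRing a ℓ₁) (B : CommutativeRing b ℓ₂)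
         (φ : CommutativeRing.Carrier A → CommutativeRing.Carrier B)
         (P : Ideals.MaximalIdeal B) where

  private
    module A = CommutativeRing A
    module B = CommutativeRing B
    open Ideals B
    open RawMonoid B.+-rawMonoid using (sum)

  -- The dimension of B/P over A/φ⁻¹P is n: the classes of the elements
  -- basis i form a basis.
  record ResidueDegree (n : ℕ) : Set (a ⊔ b ⊔ ℓ₂) where
    field
      basis       : Vector B.Carrier n
      spanning    : ∀ y → Σ[ c ∈ Vector A.Carrier n ]
                    y B.- sum (λ i → φ (c i) B.* basis i) ∈ ideal P
      independent : ∀ (c : Vector A.Carrier n) →
                    sum (λ i → φ (c i) B.* basis i) ∈ ideal P →
                    ∀ i → φ (c i) ∈ ideal P

  -- The exponent of P in the factorisation of φ(p)B, where p = φ⁻¹P: it is e when φ(p) ⊆ Pᵉ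
  -- and φ(p) ⊈ Pᵉ⁺¹.
  RamificationExponent : ℕ → Set (a ⊔ b ⊔ ℓ₂)
  RamificationExponent e = φp⊆P^ e × ¬ φp⊆P^ (suc e)
    where
    φp⊆P^ : ℕ → Set (a ⊔ b ⊔ ℓ₂)
    φp⊆P^ n = ∀ x → φ x ∈ ideal P → φ x ∈ ideal P ^ n

------------------------------------------------------------------------
-- Finite fields and elliptic curves

record FiniteField c ℓ : Set (lsuc (c ⊔ ℓ)) where
  field
    commutativeRing : CommutativeRing c ℓ

  open CommutativeRing commutativeRing public

  field
    1≉0     : ¬ 1# ≈ 0#
    inverse : ∀ x → ¬ x ≈ 0# → ∃[ y ] x * y ≈ 1#
    finite  : Finite setoid

  order : ℕ
  order = ∣ finite ∣

record EllipticCurve {c ℓ} (k : FiniteField c ℓ) : Set (c ⊔ ℓ) where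
  open FiniteField k
  open RawMonoid +-rawMonoid using () renaming (_×_ to _∙_)

  field
    a₁ a₂ a₃ a₄ a₆ : Carrier

  b₂ : Carrier
  b₂ = a₁ * a₁ + 4 ∙ a₂

  b₄ : Carrier
  b₄ = 2 ∙ a₄ + a₁ * a₃

  b₆ : Carrier
  b₆ = a₃ * a₃ + 4 ∙ a₆

  b₈ : Carrier
  b₈ = a₁ * a₁ * a₆ + 4 ∙ (a₂ * a₆) - a₁ * a₃ * a₄ + a₂ * a₃ * a₃ - a₄ * a₄

  Δ : Carrier
  Δ = 9 ∙ (b₂ * b₄ * b₆) - b₂ * b₂ * b₈ - 8 ∙ (b₄ * b₄ * b₄) - 27 ∙ (b₆ * b₆)

  field
    Δ≉0 : ¬ Δ ≈ 0#

  Solution : Carrier × Carrier → Set ℓ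
  Solution (x , y) =
    y * y + a₁ * x * y + a₃ * y ≈ x * x * x + a₂ * x * x + a₄ * x + a₆

  -- E(k): the affine solutions together with the point at infinity.
  rationalPoints : Setoid (c ⊔ ℓ) (c ⊔ ℓ)
  rationalPoints = subsetoid (setoid ×ₛ setoid) Solution ⊎ₛ ≡.setoid (⊤ {c})

------------------------------------------------------------------------
-- Curves over P¹

module Curves {c ℓ} (k : FiniteField c ℓ) where

  open FiniteField k using (Carrier; 0#; 1#; -_; commutativeRing)

  k[x] : CommutativeRing c ℓ
  k[x] = Polynomial.commutativeRing commutativeRing

  private module k[x] = CommutativeRing k[x]
  open Polynomial commutativeRing using (X; const)

  -- A scheme over the affine line, Spec ring → Spec k[x].
  record AffineCover ℓ₁ : Set (lsuc (c ⊔ ℓ ⊔ ℓ₁)) where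
    field
      ring               : CommutativeRing c ℓ₁
      φ                  : k[x].Carrier → CommutativeRing.Carrier ring
      isRingHomomorphism : RingMorphisms.IsRingHomomorphism
                             k[x].rawRing (CommutativeRing.rawRing ring) φ

    open Ideals ring public

  -- A curve π : X → P¹ is given by the two charts π⁻¹(P¹ ∖ {∞}), on which
  -- the variable of k[x] is the coordinate x, and π⁻¹(P¹ ∖ {0}), on which it
  -- is t = 1/x. The gluing over x ≠ 0, ∞ is not recorded: a closed point of
  -- X is a closed point of the first chart, or one of the second chart at
  -- which t vanishes.
  record Curve ℓ₁ : Set (lsuc (c ⊔ ℓ ⊔ ℓ₁)) where
    field
      affine   : AffineCover ℓ₁
      infinity : AffineCover ℓ₁

    module Aff = AffineCover affine
    module Inf = AffineCover infinity

    points : Setoid (lsuc (c ⊔ ℓ₁)) (lsuc (c ⊔ ℓ₁))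
    points = Aff.maxSpec ⊎ₛ subsetoid Inf.maxSpec (λ P → Inf.φ X ∈ Inf.ideal P)

    Point : Set (lsuc (c ⊔ ℓ₁))
    Point = Setoid.Carrier points

    -- [k(y) : k] = d
    HasDegree : Point → ℕ → Set (c ⊔ ℓ₁)
    HasDegree (inj₁ P)       = ResidueDegree commutativeRing Aff.ring (Aff.φ ∘ const) P
    HasDegree (inj₂ (P , _)) = ResidueDegree commutativeRing Inf.ring (Inf.φ ∘ const) P

    -- e(y | π(y)) = e
    HasRamificationIndex : Point → ℕ → Set (c ⊔ ℓ₁)
    HasRamificationIndex (inj₁ P)       = RamificationExponent k[x] Aff.ring Aff.φ P
    HasRamificationIndex (inj₂ (P , _)) = RamificationExponent k[x] Inf.ring Inf.φ P

    -- f(y | π(y)) = f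
    HasResidueDegree : Point → ℕ → Set (c ⊔ ℓ₁)
    HasResidueDegree (inj₁ P)       = ResidueDegree k[x] Aff.ring Aff.φ P
    HasResidueDegree (inj₂ (P , _)) = ResidueDegree k[x] Inf.ring Inf.φ P

    private module ↭ = Permutation points

    -- Symⁿ X(k): an effective 0-cycle is a finite multiset of closed points,
    -- i.e. a list (with a point x of coefficient aₓ occurring aₓ times) up
    -- to permutation.
    Cycle : ℕ → Set (lsuc (c ⊔ ℓ₁))
    Cycle n = Σ[ α ∈ List Point ] Σ[ ds ∈ List ℕ ] Pointwise HasDegree α ds × List.sum ds ≡ n

    Sym : ℕ → Setoid (lsuc (c ⊔ ℓ₁)) (lsuc (c ⊔ ℓ₁))
    Sym n = On.setoid {B = Cycle n} ↭.↭-setoid proj₁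

  P¹ : Curve ℓ
  P¹ = record { affine = A¹ ; infinity = A¹ }
    where
    A¹ : AffineCover ℓ
    A¹ = record
      { ring = k[x]
      ; φ = id
      ; isRingHomomorphism = Identity.isRingHomomorphism k[x].rawRing k[x].refl }

  module P¹ = Curve P¹

  -- k[x][y]/(y² + hy - g)
  doubleCover : (h g : k[x].Carrier) → AffineCover (c ⊔ ℓ)
  doubleCover h g = record
    { ring = R.commutativeRing
    ; φ = K.const
    ; isRingHomomorphism = record
      { isSemiringHomomorphism = record
        { isNearSemiringHomomorphism = record
          { +-isMonoidHomomorphism = record
            { isMagmaHomomorphism = record
              { isRelHomomorphism = record { cong = λ e → R.≈⇒≈ᵐ (K.⟦⟧-cong e) }
              ; homo = λ p q → R.≈⇒≈ᵐ (K.+-homo p q) }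
            ; ε-homo = R.≈⇒≈ᵐ K.0#-homo }
          ; *-homo = λ p q → R.≈⇒≈ᵐ (K.*-homo p q) }
        ; 1#-homo = R.≈⇒≈ᵐ K.1#-homo }
      ; -‿homo = λ p → R.≈⇒≈ᵐ (K.-‿homo p) } }
    where
    module K where
      open Polynomial k[x] public using (const; commutativeRing)
      open RingMorphisms.IsRingHomomorphism (Polynomial.const-isRingHomomorphism k[x]) public
    module R = PrincipalQuotient K.commutativeRing (k[x].- g ∷ h ∷ k[x].1# ∷ [])

  -- With t = 1/x and v = y/x², dividing the Weierstrass equation by x⁴ gives
  --   v² + (a₁t + a₃t²)v = t + a₂t² + a₄t³ + a₆t⁴.
  -- As E is smooth, k[t][v] modulo this equation is the integral closure of
  -- k[t] in the function field of E, that is, the coordinate ring of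
  -- E ∖ π⁻¹(0).
  ellipticCurve : EllipticCurve k → Curve (c ⊔ ℓ)
  ellipticCurve E = record
    { affine   = doubleCover (a₃ ∷ a₁ ∷ []) (a₆ ∷ a₄ ∷ a₂ ∷ 1# ∷ [])
    ; infinity = doubleCover (0# ∷ a₁ ∷ a₃ ∷ []) (0# ∷ 1# ∷ a₂ ∷ a₄ ∷ a₆ ∷ []) }
    where open EllipticCurve E

  module Splitting {ℓ₁} (C : Curve ℓ₁) where

    open Curve C using (Point; points; HasRamificationIndex; HasResidueDegree; module Aff; module Inf)
    open Setoid points using () renaming (_≈_ to _≈ₓ_)

    _LiesOver_ : Point → P¹.Point → Set (c ⊔ ℓ ⊔ ℓ₁)
    inj₁ P       LiesOver inj₁ p       = P¹.Aff.ideal p ≐ Aff.ideal P ∘ Aff.φ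
    inj₂ (P , _) LiesOver inj₂ (p , _) = P¹.Inf.ideal p ≐ Inf.ideal P ∘ Inf.φ
    _            LiesOver _            = ⊥

    -- The fibre π⁻¹(x) consists of the y with y LiesOver x.
    Ramified Split Inert : Pred P¹.Point (lsuc (c ⊔ ℓ₁) ⊔ ℓ)
    Ramified x = ∃[ y ] y LiesOver x × ∃[ e ] HasRamificationIndex y e × e ℕ.> 1
    Split x = ∀ y → y LiesOver x → HasRamificationIndex y 1 × HasResidueDegree y 1
    Inert x = ∃[ y ] y LiesOver x × (∀ z → z LiesOver x → z ≈ₓ y) × HasRamificationIndex y 1

    -- χ vanishes at ramified points and is 1, -1 at split, inert points. For
    -- an elliptic curve the three cases are exclusive, so χ is unique.
    IsCharacter : (P¹.Point → ℤ) → Set (lsuc (c ⊔ ℓ ⊔ ℓ₁))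
    IsCharacter χ = ∀ x → (Ramified x × χ x ≡ 0ℤ)
                        ⊎ (Split x × χ x ≡ 1ℤ)
                        ⊎ (Inert x × χ x ≡ -1ℤ)

    rationalSplit rationalInert : Setoid (lsuc (c ⊔ ℓ ⊔ ℓ₁)) (lsuc (c ⊔ ℓ))
    rationalSplit = subsetoid P¹.points (λ x → P¹.HasDegree x 1 × Split x)
    rationalInert = subsetoid P¹.points (λ x → P¹.HasDegree x 1 × Inert x)

  -- The multiplicative extension of χ to effective 0-cycles on P¹.
  onCycles : ∀ {n} → (P¹.Point → ℤ) → P¹.Cycle n → ℤ
  onCycles χ (α , _) = foldr ℤ._*_ 1ℤ (map χ α)

{-# OPTIONS --safe #-}

-- Over a closed point x of P¹ of degree d, with irreducible polynomial p, the fibre of E is read off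
-- from the roots of y² + h y - g modulo p: a double root gives one point of degree d, which is
-- ramified as Δ ≠ 0, two roots give two points of degree d, and without roots (p) remains prime, with
-- residue field of degree 2d. Hence the Euler factor of E over x is
-- 1 / (1 - tᵈ)(1 - χ(x) tᵈ), and the product over all x gives
--   Σ_n #Symⁿ E tⁿ = (Σ_n #Symⁿ P¹ tⁿ) (Σ_n Σ_{α ∈ Symⁿ P¹} χ(α) tⁿ),
-- where #Symⁿ P¹ = 1 + q + ⋯ + qⁿ by unique factorisation in k[x]. As E(k) is the set of points of
-- degree one, that is Sym¹ E, the formula for the trace is the coefficient of t.

module Submission where

open import Defs
open import Algebra.Bundles using (CommutativeRing)
import Algebra.Definitions.RawMonoid as RawMonoid
import Algebra.Morphism.Construct.Composition as Composition
open import Algebra.Morphism.Structures using (module RingMorphisms)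
import Algebra.Properties.CommutativeMonoid.Sum as CMSum
import Algebra.Properties.Monoid.Sum as MonoidSum
import Algebra.Properties.Ring as RingProperties
import Algebra.Properties.Semiring.Mult.TCOptimised as Multiples
import Algebra.Properties.Semiring.Sum as SemiringSum
import Algebra.Solver.Ring as Solver
open import Algebra.Solver.Ring.AlmostCommutativeRing using (fromCommutativeRing; _-Raw-AlmostCommutative⟶_)
open import Algebra.Structures using (IsCommutativeRing)
open import Data.Empty using (⊥; ⊥-elim)
import Data.Empty.Polymorphic as Polymorphic
open import Data.Fin.Base using (Fin; zero; suc; toℕ; inject₁; fromℕ; opposite; _↑ˡ_; _↑ʳ_; splitAt; funToFin; finToFun; combine)
import Data.Fin.Permutation as FinPermutation
import Data.Fin.Properties as Fin
open import Data.Fin.Properties using (funToFin-finToFin; finToFun-funToFin; injective⇒≤)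
open import Data.Integer.Base as ℤ using (ℤ; +_; -[1+_]; +[1+_]; 0ℤ; 1ℤ; -1ℤ)
import Data.Integer.Properties as ℤ
open import Data.Integer.Tactic.RingSolver using (solve-∀)
open import Data.List.Base using (List; []; _∷_; _++_; map; concatMap; length; lookup; foldr; filter; cartesianProductWith; tabulate)
open import Data.List.Membership.Propositional.Properties using (∈-lookup)
import Data.List.Membership.Setoid as SetoidMembership
import Data.List.Membership.Setoid.Properties as Membership
import Data.List.Properties as ListProperties
open import Data.List.Relation.Binary.Pointwise as Pointwise using (Pointwise; []; _∷_)
import Data.List.Relation.Binary.Permutation.Setoid as Permutation
import Data.List.Relation.Binary.Permutation.Setoid.Properties as ↭
open import Data.List.Relation.Unary.All as All using (All; []; _∷_)
import Data.List.Relation.Unary.All.Properties as All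
open import Data.List.Relation.Unary.AllPairs using ([]; _∷_)
open import Data.List.Relation.Unary.Any as Any using (Any; here; there)
import Data.List.Relation.Unary.Any.Properties as Any
open import Data.List.Relation.Unary.Unique.Setoid using (Unique)
import Data.List.Relation.Unary.Unique.Setoid.Properties as Unique
open import Data.Maybe.Base using (Maybe; just; nothing)
open import Data.Nat.Base as ℕ using (ℕ; zero; suc; z≤n; s≤s; _∸_)
import Data.Nat.ListAction as List
import Data.Nat.ListAction.Properties as List
import Data.Nat.Properties as ℕ
open import Data.Product.Base using (∃; ∃-syntax; Σ-syntax; _×_; _,_; proj₁; proj₂)
import Data.Sum.Base as Sum
open import Data.Sum.Base using (_⊎_; inj₁; inj₂; [_,_]′)
import Data.Sum.Relation.Binary.Pointwise as ⊎
open import Data.Unit.Polymorphic.Base using (tt)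
open import Data.Vec.Functional using (Vector)
open import Function.Base using (_∘_; id)
open import Function.Bundles using (Bijection; module Bijection)
open import Level using (Level; _⊔_) renaming (suc to lsuc)
open import Relation.Binary.Bundles using (Setoid)
import Relation.Binary.Construct.On as On
open import Relation.Binary.Definitions using (Decidable; tri<; tri≈; tri>; _Respects_)
open import Relation.Binary.PropositionalEquality as ≡ using (_≡_; _≗_; cong; cong₂; module ≡-Reasoning)
import Relation.Binary.Reasoning.Setoid as SetoidReasoning
open import Relation.Nullary using (¬_; Dec; yes; no; contradiction)
open import Relation.Nullary.Decidable using (map′)
open import Relation.Unary using (Pred; _∈_; _∉_; _⊆_; _≐_)
open import Relation.Unary.Properties using (≐-sym; ≐-trans)

-- Closed points are maximal ideals and no excluded middle is available, so the cases have to be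
-- decided by computation. Finiteness of k makes this possible: there are finitely many monic
-- polynomials of each degree, so irreducibility and the existence of a root modulo p are settled by
-- search. That a maximal ideal of the cover lies over some (p) needs a nonzero element of it in
-- k[x]: this is x itself or the norm of 1 - b x, where b inverts x. Ramification indices are
-- defined by powers of ideals, so each type of fibre needs its own control of P². With F = y² + h y
-- - g, a double root r has F(r) not divisible by p², which is the form in which Δ ≠ 0 is used, and
-- P² = pB. A simple root is first lifted modulo p², so that evaluation at r sends P² into (p²).
-- Without roots, P = pB. The Euler product over all points is infinite, but the coefficient of tⁿ
-- involves only points of degree at most n, so finite lists of points suffice. Division by 1 - c tᵈ
-- is a recurrence for coefficients, which avoids inverting series. At infinity the only prime is t,
-- with the double root 0.

-- The ring solver with integer coefficients.

module IntegerCoefficients {a ℓ} (R : CommutativeRing a ℓ) where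

  open CommutativeRing R hiding (zero)
  open RingProperties ring using (-0#≈0#; -‿involutive; -‿+-comm; -‿distribˡ-*)
  open Multiples semiring renaming (_×_ to _×ᴿ_)
  private module R = SetoidReasoning setoid

  -- The optimised multiple reduces `1 ×ᴿ 1#` to `1#`, so that `con (+ 1)` in a solved equation is
  -- `1#` itself and `1-homo` holds by `refl`.
  fromℤ : ℤ → Carrier
  fromℤ (+ n)    = n ×ᴿ 1#
  fromℤ -[1+ n ] = - (suc n ×ᴿ 1#)

  fromℤ-neg : ∀ i → fromℤ (ℤ.- i) ≈ - fromℤ i
  fromℤ-neg (+ zero)  = sym -0#≈0#
  fromℤ-neg +[1+ n ]  = refl
  fromℤ-neg -[1+ n ]  = sym (-‿involutive _)

  fromℤ-⊖ : ∀ m n → fromℤ (m ℤ.⊖ n) ≈ m ×ᴿ 1# - n ×ᴿ 1#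
  fromℤ-⊖ m zero = sym (trans (+-congˡ -0#≈0#) (+-identityʳ _))
  fromℤ-⊖ zero (suc n) = sym (+-identityˡ _)
  fromℤ-⊖ (suc m) (suc n) = R.begin
    fromℤ (suc m ℤ.⊖ suc n)                R.≡⟨ ≡.cong fromℤ (ℤ.[1+m]⊖[1+n]≡m⊖n m n) ⟩
    fromℤ (m ℤ.⊖ n)                        R.≈⟨ fromℤ-⊖ m n ⟩
    m ×ᴿ 1# - n ×ᴿ 1#                        R.≈⟨ +-congʳ (+-identityˡ _) ⟨
    (0# + m ×ᴿ 1#) - n ×ᴿ 1#                 R.≈⟨ +-congʳ (+-congʳ (-‿inverseʳ 1#)) ⟨
    ((1# + - 1#) + m ×ᴿ 1#) - n ×ᴿ 1#        R.≈⟨ +-congʳ (trans (+-congʳ (+-comm _ _)) (+-assoc _ _ _)) ⟩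
    (- 1# + (1# + m ×ᴿ 1#)) - n ×ᴿ 1#        R.≈⟨ +-congʳ (+-comm _ _) ⟩
    ((1# + m ×ᴿ 1#) - 1#) - n ×ᴿ 1#          R.≈⟨ +-assoc _ _ _ ⟩
    (1# + m ×ᴿ 1#) + (- 1# + - (n ×ᴿ 1#))    R.≈⟨ +-cong (sym (1+× m 1#)) (trans (-‿+-comm _ _) (-‿cong (sym (1+× n 1#)))) ⟩
    suc m ×ᴿ 1# - suc n ×ᴿ 1# R.∎

  fromℤ-+ : ∀ i j → fromℤ (i ℤ.+ j) ≈ fromℤ i + fromℤ j
  fromℤ-+ (+ m)    (+ n)    = ×-homo-+ 1# m n
  fromℤ-+ (+ m)    -[1+ n ] = fromℤ-⊖ m (suc n)
  fromℤ-+ -[1+ m ] (+ n)    = trans (fromℤ-⊖ n (suc m)) (+-comm _ _)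
  fromℤ-+ -[1+ m ] -[1+ n ] = R.begin
    - (suc (suc (m ℕ.+ n)) ×ᴿ 1#)           R.≈⟨ -‿cong (1+× (suc (m ℕ.+ n)) 1#) ⟩
    - (1# + (suc m ℕ.+ n) ×ᴿ 1#)            R.≈⟨ -‿cong (+-congˡ (×-homo-+ 1# (suc m) n)) ⟩
    - (1# + (suc m ×ᴿ 1# + n ×ᴿ 1#))         R.≈⟨ -‿cong (trans (sym (+-assoc _ _ _)) (trans (+-congʳ (+-comm _ _)) (+-assoc _ _ _))) ⟩
    - (suc m ×ᴿ 1# + (1# + n ×ᴿ 1#))         R.≈⟨ -‿cong (+-congˡ (sym (1+× n 1#))) ⟩
    - (suc m ×ᴿ 1# + suc n ×ᴿ 1#)            R.≈⟨ -‿+-comm _ _ ⟨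
    - (suc m ×ᴿ 1#) + - (suc n ×ᴿ 1#)        R.∎

  fromℤ-*ℕ : ∀ m j → fromℤ (+ m ℤ.* j) ≈ m ×ᴿ 1# * fromℤ j
  fromℤ-*ℕ zero j = sym (zeroˡ _)
  fromℤ-*ℕ (suc m) j = R.begin
    fromℤ (+ suc m ℤ.* j)          R.≡⟨ ≡.cong fromℤ (ℤ.suc-* (+ m) j) ⟩
    fromℤ (j ℤ.+ + m ℤ.* j)        R.≈⟨ fromℤ-+ j (+ m ℤ.* j) ⟩
    fromℤ j + fromℤ (+ m ℤ.* j)    R.≈⟨ +-cong (sym (*-identityˡ _)) (fromℤ-*ℕ m j) ⟩
    1# * fromℤ j + m ×ᴿ 1# * fromℤ j R.≈⟨ distribʳ _ _ _ ⟨
    (1# + m ×ᴿ 1#) * fromℤ j        R.≈⟨ *-congʳ (sym (1+× m 1#)) ⟩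
    suc m ×ᴿ 1# * fromℤ j R.∎

  fromℤ-* : ∀ i j → fromℤ (i ℤ.* j) ≈ fromℤ i * fromℤ j
  fromℤ-* (+ m) j = fromℤ-*ℕ m j
  fromℤ-* -[1+ m ] j = R.begin
    fromℤ (-[1+ m ] ℤ.* j)          R.≡⟨ ≡.cong fromℤ (ℤ.neg-distribˡ-* (+ suc m) j) ⟨
    fromℤ (ℤ.- (+ suc m ℤ.* j))     R.≈⟨ fromℤ-neg (+ suc m ℤ.* j) ⟩
    - fromℤ (+ suc m ℤ.* j)         R.≈⟨ -‿cong (fromℤ-*ℕ (suc m) j) ⟩
    - (suc m ×ᴿ 1# * fromℤ j)        R.≈⟨ -‿distribˡ-* _ _ ⟩
    - (suc m ×ᴿ 1#) * fromℤ j R.∎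

  homomorphism : ℤ.+-*-rawRing -Raw-AlmostCommutative⟶ fromCommutativeRing R
  homomorphism = record
    { ⟦_⟧ = fromℤ ; +-homo = fromℤ-+ ; *-homo = fromℤ-* ; -‿homo = fromℤ-neg
    ; 0-homo = refl ; 1-homo = refl }

  -- Only a positive answer is ever certified: in positive characteristic distinct integers may have
  -- equal images. This partial test is enough for comparing normal forms.
  fromℤ-≟ : ∀ i j → Maybe (fromℤ i ≈ fromℤ j)
  fromℤ-≟ i j with i ℤ.≟ j
  ... | yes ≡.refl = just refl
  ... | no _       = nothing

  open Solver ℤ.+-*-rawRing (fromCommutativeRing R) homomorphism fromℤ-≟ public
    using (Polynomial; solve; con; _:+_; _:*_; _:-_; :-_; _:×_; _:=_)

-- The discriminant vanishes when the Weierstrass equation is singular.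

module Discriminant {a ℓ} (R : CommutativeRing a ℓ) where

  open CommutativeRing R hiding (zero)
  open RawMonoid +-rawMonoid using () renaming (_×_ to _∙_)
  open IntegerCoefficients R
  private module R = SetoidReasoning setoid

  -- The formulas of `EllipticCurve` over an arbitrary commutative ring, since they will be applied
  -- in k[x]/(p), where the coordinates of a singular point live.
  b₂ b₄ b₆ b₈ Δ : (a₁ a₂ a₃ a₄ a₆ : Carrier) → Carrier
  b₂ a₁ a₂ a₃ a₄ a₆ = a₁ * a₁ + 4 ∙ a₂
  b₄ a₁ a₂ a₃ a₄ a₆ = 2 ∙ a₄ + a₁ * a₃
  b₆ a₁ a₂ a₃ a₄ a₆ = a₃ * a₃ + 4 ∙ a₆
  b₈ a₁ a₂ a₃ a₄ a₆ = a₁ * a₁ * a₆ + 4 ∙ (a₂ * a₆) - a₁ * a₃ * a₄ + a₂ * a₃ * a₃ - a₄ * a₄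

  -- The b's are arguments so that simplified forms of them can be substituted before the solver
  -- expands anything.
  discriminant : (b₂ b₄ b₆ b₈ : Carrier) → Carrier
  discriminant b₂ b₄ b₆ b₈ =
    9 ∙ (b₂ * b₄ * b₆) - b₂ * b₂ * b₈ - 8 ∙ (b₄ * b₄ * b₄) - 27 ∙ (b₆ * b₆)

  ∙-cong : ∀ n {x y} → x ≈ y → n ∙ x ≈ n ∙ y
  ∙-cong zero    e = refl
  ∙-cong (suc n) e = +-cong e (∙-cong n e)

  discriminant-cong : ∀ {b₂ b₂′ b₄ b₄′ b₆ b₆′ b₈ b₈′} → b₂ ≈ b₂′ → b₄ ≈ b₄′ → b₆ ≈ b₆′ → b₈ ≈ b₈′ →
    discriminant b₂ b₄ b₆ b₈ ≈ discriminant b₂′ b₄′ b₆′ b₈′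
  discriminant-cong e₂ e₄ e₆ e₈ = +-cong (+-cong (+-cong
    (∙-cong 9 (*-cong (*-cong e₂ e₄) e₆))
    (-‿cong (*-cong (*-cong e₂ e₂) e₈)))
    (-‿cong (∙-cong 8 (*-cong (*-cong e₄ e₄) e₄))))
    (-‿cong (∙-cong 27 (*-cong e₆ e₆)))

  Δ a₁ a₂ a₃ a₄ a₆ =
    discriminant (b₂ a₁ a₂ a₃ a₄ a₆) (b₄ a₁ a₂ a₃ a₄ a₆) (b₆ a₁ a₂ a₃ a₄ a₆) (b₈ a₁ a₂ a₃ a₄ a₆)

  -- The partial derivatives and the equation itself determine a₃, a₄ and a₆ in terms of a₁, a₂
  -- and the singular point; in these terms b₄, b₆, b₈ are polynomials in b₂ and x.
  singular⇒Δ≈0 : ∀ a₁ a₂ a₃ a₄ a₆ x y →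
    y + y + a₁ * x + a₃ ≈ 0# →
    a₁ * y ≈ a₄ + (a₂ + a₂) * x + (x * x + x * x + x * x) →
    y * y + (a₃ + x * a₁) * y ≈ a₆ + x * (a₄ + x * (a₂ + x)) →
    Δ a₁ a₂ a₃ a₄ a₆ ≈ 0#
  singular⇒Δ≈0 a₁ a₂ a₃ a₄ a₆ x y Fy Fx F = R.begin
    Δ a₁ a₂ a₃ a₄ a₆ R.≈⟨ discriminant-cong refl b₄-eq b₆-eq b₈-eq ⟩
    -- At a singular point, 4x³ + b₂x² + 2b₄x + b₆ has a double root. Its derivative gives b₄ after
    -- division by 2, then its value gives b₆, and 4b₈ = b₂b₆ - b₄² gives b₈ after division by 4.
    -- The elimination of a₃, a₄, a₆ below proves these formulas without dividing, hence in every
    -- characteristic.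
    discriminant b (- (6 ∙ (x * x)) - b * x) (8 ∙ (x * x * x) + b * x * x) (- (9 ∙ (x * x * x * x)) - b * x * x * x)
      R.≈⟨ solve 2 (λ b x →
         let b4 = :- (6 :× (x :* x)) :- b :* x
             b6 = 8 :× (x :* x :* x) :+ b :* x :* x
             b8 = :- (9 :× (x :* x :* x :* x)) :- b :* x :* x :* x in
         9 :× (b :* b4 :* b6) :- b :* b :* b8 :- 8 :× (b4 :* b4 :* b4) :- 27 :× (b6 :* b6) := con (+ 0)) refl b x ⟩
    0# R.∎
    where
    b = b₂ a₁ a₂ a₃ a₄ a₆
    a₃-eq : a₃ ≈ - (y + y + a₁ * x)
    a₃-eq = R.begin
      a₃ R.≈⟨ solve 4 (λ a₁ a₃ x y → a₃ := (y :+ y :+ a₁ :* x :+ a₃) :- (y :+ y :+ a₁ :* x)) refl a₁ a₃ x y ⟩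
      (y + y + a₁ * x + a₃) - (y + y + a₁ * x) R.≈⟨ +-congʳ Fy ⟩
      0# - (y + y + a₁ * x) R.≈⟨ +-identityˡ _ ⟩
      - (y + y + a₁ * x) R.∎
    a₄-eq : a₄ ≈ a₁ * y - ((a₂ + a₂) * x + (x * x + x * x + x * x))
    a₄-eq = R.begin
      a₄ R.≈⟨ solve 3 (λ a₂ a₄ x → a₄ := (a₄ :+ (a₂ :+ a₂) :* x :+ (x :* x :+ x :* x :+ x :* x)) :- ((a₂ :+ a₂) :* x :+ (x :* x :+ x :* x :+ x :* x))) refl a₂ a₄ x ⟩
      _ R.≈⟨ +-congʳ (sym Fx) ⟩
      _ R.∎
    a₆-eq : a₆ ≈ - (y * y) - a₁ * x * y + x * x * x + x * x * x + a₂ * x * x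
    a₆-eq = R.begin
      a₆ R.≈⟨ solve 4 (λ a₂ a₄ a₆ x → a₆ := (a₆ :+ x :* (a₄ :+ x :* (a₂ :+ x))) :- x :* (a₄ :+ x :* (a₂ :+ x))) refl a₂ a₄ a₆ x ⟩
      (a₆ + x * (a₄ + x * (a₂ + x))) - x * (a₄ + x * (a₂ + x)) R.≈⟨ +-cong (trans (sym F) (+-congˡ (*-congʳ (+-congʳ a₃-eq)))) (-‿cong (*-congˡ (+-congʳ a₄-eq))) ⟩
      (y * y + (- (y + y + a₁ * x) + x * a₁) * y) - x * ((a₁ * y - ((a₂ + a₂) * x + (x * x + x * x + x * x))) + x * (a₂ + x))
        R.≈⟨ solve 4 (λ a₁ a₂ x y → (y :* y :+ (:- (y :+ y :+ a₁ :* x) :+ x :* a₁) :* y) :- x :* ((a₁ :* y :- ((a₂ :+ a₂) :* x :+ (x :* x :+ x :* x :+ x :* x))) :+ x :* (a₂ :+ x)) := :- (y :* y) :- a₁ :* x :* y :+ x :* x :* x :+ x :* x :* x :+ a₂ :* x :* x) refl a₁ a₂ x y ⟩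
      _ R.∎
    b₄-eq : b₄ a₁ a₂ a₃ a₄ a₆ ≈ - (6 ∙ (x * x)) - b * x
    b₄-eq = R.begin
      2 ∙ a₄ + a₁ * a₃ R.≈⟨ +-cong (∙-cong 2 a₄-eq) (*-congˡ a₃-eq) ⟩
      _ R.≈⟨ solve 4 (λ a₁ a₂ x y → 2 :× (a₁ :* y :- ((a₂ :+ a₂) :* x :+ (x :* x :+ x :* x :+ x :* x))) :+ a₁ :* (:- (y :+ y :+ a₁ :* x)) := :- (6 :× (x :* x)) :- (a₁ :* a₁ :+ 4 :× a₂) :* x) refl a₁ a₂ x y ⟩
      _ R.∎
    b₆-eq : b₆ a₁ a₂ a₃ a₄ a₆ ≈ 8 ∙ (x * x * x) + b * x * x
    b₆-eq = R.begin
      a₃ * a₃ + 4 ∙ a₆ R.≈⟨ +-cong (*-cong a₃-eq a₃-eq) (∙-cong 4 a₆-eq) ⟩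
      _ R.≈⟨ solve 4 (λ a₁ a₂ x y → (:- (y :+ y :+ a₁ :* x)) :* (:- (y :+ y :+ a₁ :* x)) :+ 4 :× (:- (y :* y) :- a₁ :* x :* y :+ x :* x :* x :+ x :* x :* x :+ a₂ :* x :* x) := 8 :× (x :* x :* x) :+ (a₁ :* a₁ :+ 4 :× a₂) :* x :* x) refl a₁ a₂ x y ⟩
      _ R.∎
    b₈-eq : b₈ a₁ a₂ a₃ a₄ a₆ ≈ - (9 ∙ (x * x * x * x)) - b * x * x * x
    b₈-eq = R.begin
      _ R.≈⟨ +-cong (+-cong (+-cong (+-cong (*-congˡ a₆-eq) (∙-cong 4 (*-congˡ a₆-eq))) (-‿cong (*-cong (*-congˡ a₃-eq) a₄-eq))) (*-cong (*-congˡ a₃-eq) a₃-eq)) (-‿cong (*-cong a₄-eq a₄-eq)) ⟩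
      _ R.≈⟨ solve 4 (λ a₁ a₂ x y →
          let a₃ = :- (y :+ y :+ a₁ :* x)
              a₄ = a₁ :* y :- ((a₂ :+ a₂) :* x :+ (x :* x :+ x :* x :+ x :* x))
              a₆ = :- (y :* y) :- a₁ :* x :* y :+ x :* x :* x :+ x :* x :* x :+ a₂ :* x :* x in
          a₁ :* a₁ :* a₆ :+ 4 :× (a₂ :* a₆) :- a₁ :* a₃ :* a₄ :+ a₂ :* a₃ :* a₃ :- a₄ :* a₄ := :- (9 :× (x :* x :* x :* x)) :- (a₁ :* a₁ :+ 4 :× a₂) :* x :* x :* x) refl a₁ a₂ x y ⟩
      _ R.∎

module DiscriminantHomomorphism {a b ℓ₁ ℓ₂} (R : CommutativeRing a ℓ₁) (S : CommutativeRing b ℓ₂)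
  {f : CommutativeRing.Carrier R → CommutativeRing.Carrier S}
  (f-hom : RingMorphisms.IsRingHomomorphism (CommutativeRing.rawRing R) (CommutativeRing.rawRing S) f) where

  private
    module R = CommutativeRing R
    module S = CommutativeRing S
    module f = RingMorphisms.IsRingHomomorphism f-hom
    module ΔR = Discriminant R
    module ΔS = Discriminant S
  open S using (_≈_; _+_; _*_)
  open RawMonoid R.+-rawMonoid using () renaming (_×_ to _∙_)
  open RawMonoid S.+-rawMonoid using () renaming (_×_ to _∙′_)

  private
    infix 4 _↦_
    -- With one combinator for each ring operation, the proof of `Δ-homo` has the shape of the
    -- formula for Δ.
    _↦_ : R.Carrier → S.Carrier → Set ℓ₂
    x ↦ y = f x ≈ y

    _⊞_ : ∀ {x y x′ y′} → x ↦ x′ → y ↦ y′ → x R.+ y ↦ x′ + y′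
    e ⊞ e′ = S.trans (f.+-homo _ _) (S.+-cong e e′)

    _⊟_ : ∀ {x y x′ y′} → x ↦ x′ → y ↦ y′ → x R.- y ↦ x′ S.- y′
    e ⊟ e′ = S.trans (f.+-homo _ _) (S.+-cong e (S.trans (f.-‿homo _) (S.-‿cong e′)))

    _⊠_ : ∀ {x y x′ y′} → x ↦ x′ → y ↦ y′ → x R.* y ↦ x′ * y′
    e ⊠ e′ = S.trans (f.*-homo _ _) (S.*-cong e e′)

    times : ∀ n {x x′} → x ↦ x′ → n ∙ x ↦ n ∙′ x′
    times zero    e = f.0#-homo
    times (suc n) e = e ⊞ times n e

    ι : ∀ {x} → x ↦ f x
    ι = S.refl

    infixl 6 _⊞_ _⊟_
    infixl 7 _⊠_

  Δ-homo : ∀ a₁ a₂ a₃ a₄ a₆ → f (ΔR.Δ a₁ a₂ a₃ a₄ a₆) ≈ ΔS.Δ (f a₁) (f a₂) (f a₃) (f a₄) (f a₆)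
  Δ-homo a₁ a₂ a₃ a₄ a₆ = times 9 (b₂ ⊠ b₄ ⊠ b₆) ⊟ b₂ ⊠ b₂ ⊠ b₈ ⊟ times 8 (b₄ ⊠ b₄ ⊠ b₄) ⊟ times 27 (b₆ ⊠ b₆)
    where
    b₂ = ι {a₁} ⊠ ι {a₁} ⊞ times 4 (ι {a₂})
    b₄ = times 2 (ι {a₄}) ⊞ ι {a₁} ⊠ ι {a₃}
    b₆ = ι {a₃} ⊠ ι {a₃} ⊞ times 4 (ι {a₆})
    b₈ = ι {a₁} ⊠ ι {a₁} ⊠ ι {a₆} ⊞ times 4 (ι {a₂} ⊠ ι {a₆}) ⊟ ι {a₁} ⊠ ι {a₃} ⊠ ι {a₄} ⊞ ι {a₂} ⊠ ι {a₃} ⊠ ι {a₃} ⊟ ι {a₄} ⊠ ι {a₄}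

-- Polynomials over a commutative ring: degree, division, evaluation, derivative.

module PolynomialProperties {a ℓ} (R : CommutativeRing a ℓ) where

  open CommutativeRing R hiding (zero)
  open Polynomial R renaming (commutativeRing to R[x])
  open RingProperties ring using (-0#≈0#; x∙y⁻¹≈ε⇒x≈y; x≈y⇒x∙y⁻¹≈ε)
  private
    module R[x] = CommutativeRing R[x]
    module R[x]ᵖ = RingProperties R[x].ring
    module S = IntegerCoefficients R
    module Sₚ = IntegerCoefficients R[x]
    module R = SetoidReasoning setoid
    module P = SetoidReasoning setoidₚ

  coeff-∷* : ∀ a p q n → coeff ((a ∷ p) *ₚ q) n ≈ a * coeff q n + coeff (0# ∷ p *ₚ q) n
  coeff-∷* a p q n = trans (coeff-+ (scale a q) _ n) (+-congʳ (coeff-scale a q n))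

  -- Coefficient lists may end in zeros, so degrees are bounded by the vanishing of coefficients and
  -- not by the length of the list.
  Below : ℕ → Poly → Set ℓ
  Below n p = ∀ {i} → n ℕ.≤ i → coeff p i ≈ 0#

  -- `c` may be zero; this is why leading terms multiply over every ring, zero divisors included.
  Leading : ℕ → Carrier → Poly → Set ℓ
  Leading d c p = coeff p d ≈ c × Below (suc d) p

  Monic : ℕ → Poly → Set ℓ
  Monic d = Leading d 1#

  Below-resp : ∀ {n p q} → p ≈ₚ q → Below n p → Below n q
  Below-resp e b n≤i = trans (sym (at e _)) (b n≤i)

  Leading-resp : ∀ {d c p q} → p ≈ₚ q → Leading d c p → Leading d c q
  Leading-resp e (l , b) = trans (sym (at e _)) l , Below-resp e b

  Below-0 : ∀ {p} → Below 0 p → p ≈ₚ []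
  Below-0 b = mk≈ₚ λ n → b z≤n

  Below-1 : ∀ {p} → Below 1 p → p ≈ₚ const (coeff p 0)
  Below-1 b = mk≈ₚ λ where
    zero    → refl
    (suc n) → b (s≤s z≤n)

  Below-2 : ∀ {p} → Below 2 p → p ≈ₚ coeff p 0 ∷ coeff p 1 ∷ []
  Below-2 b = mk≈ₚ λ where
    zero          → refl
    (suc zero)    → refl
    (suc (suc n)) → b (s≤s (s≤s z≤n))

  Leading-0 : ∀ {c p} → Leading 0 c p → p ≈ₚ const c
  Leading-0 (l , b) = transₚ (Below-1 b) (∷-cong l reflₚ)

  Leading-* : ∀ {d e c c′} p {q} → Leading d c p → Leading e c′ q →
    Leading (d ℕ.+ e) (c * c′) (p *ₚ q)
  Leading-* {c′ = c′} [] (l , b) (l′ , b′) =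
    trans (sym (zeroˡ c′)) (*-congʳ l) , λ _ → refl
  Leading-* {zero} {e} {c} {c′} (a ∷ p) {q} (l , b) (l′ , b′) =
    trans (coeffs e) (*-cong l l′) , λ e<i → trans (coeffs _) (trans (*-congˡ (b′ e<i)) (zeroʳ a))
    where
    p≈0 : p ≈ₚ []
    p≈0 = mk≈ₚ λ n → b (s≤s z≤n)
    coeffs : ∀ n → coeff ((a ∷ p) *ₚ q) n ≈ a * coeff q n
    coeffs n = trans (coeff-∷* a p q n)
      (trans (+-congˡ (at (transₚ (∷-cong refl (*ₚ-cong p≈0 (reflₚ {q}))) 0∷[]≈[]) n)) (+-identityʳ _))
  Leading-* {suc d} {e} {c} {c′} (a ∷ p) {q} (l , b) (l′ , b′) =
    trans (coeffs (ℕ.m≤n+m e d)) (proj₁ ih) , λ { (s≤s d+e<i) → trans (coeffs (ℕ.≤-trans (ℕ.m≤n+m e (suc d)) d+e<i)) (proj₂ ih d+e<i) }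
    where
    ih = Leading-* {d} p (l , λ d<i → b (s≤s d<i)) (l′ , b′)
    coeffs : ∀ {n} → e ℕ.≤ n → coeff ((a ∷ p) *ₚ q) (suc n) ≈ coeff (p *ₚ q) n
    coeffs e≤n = trans (coeff-∷* a p q _)
      (trans (+-congʳ (trans (*-congˡ (b′ (s≤s e≤n))) (zeroʳ a))) (+-identityˡ _))

  Monic-* : ∀ {d e} p {q} → Monic d p → Monic e q → Monic (d ℕ.+ e) (p *ₚ q)
  Monic-* p m m′ with Leading-* p m m′
  ... | l , b = trans l (*-identityˡ 1#) , b

  -- Horner's scheme: if f = s m + r, then a + x f = (x s) m + (a + x r), and subtracting `c` times
  -- the monic divisor, where `c` is the coefficient of a + x r in degree `d`, restores the bound on
  -- the remainder.
  divide : ∀ {d m} → Monic d m → ∀ f → ∃[ s ] ∃[ r ] f ≈ₚ s *ₚ m +ₚ r × Below d r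
  divide mon [] = [] , [] , reflₚ , λ _ → refl
  divide {d} {m} mon (a ∷ f) with divide mon f
  ... | s , r , e , b = c ∷ s , r′ , eq , below
    where
    c = coeff (a ∷ r) d
    r′ = (a ∷ r) +ₚ -ₚ scale c m
    eq : a ∷ f ≈ₚ (c ∷ s) *ₚ m +ₚ r′
    eq = P.begin
      a ∷ f                              P.≈⟨ ∷-cong (sym (+-identityˡ a)) e ⟩
      (0# ∷ s *ₚ m) +ₚ (a ∷ r)           P.≈⟨ Sₚ.solve 3 (λ x y z → x Sₚ.:+ y Sₚ.:= (z Sₚ.:+ x) Sₚ.:+ (y Sₚ.:- z)) reflₚ (0# ∷ s *ₚ m) (a ∷ r) (scale c m) ⟩
      (c ∷ s) *ₚ m +ₚ r′                 P.∎
    coeffs : ∀ n → coeff r′ n ≈ coeff (a ∷ r) n - c * coeff m n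
    coeffs n = trans (coeff-+ (a ∷ r) (-ₚ scale c m) n) (+-congˡ (trans (coeff-neg (scale c m) n) (-‿cong (coeff-scale c m n))))
    below : Below d r′
    below {i} d≤i with ℕ.m≤n⇒m<n∨m≡n d≤i
    ... | inj₂ ≡.refl = trans (coeffs d) (trans (+-congˡ (-‿cong (trans (*-congˡ (proj₁ mon)) (*-identityʳ c)))) (-‿inverseʳ c))
    below {suc i} _ | inj₁ (s≤s d≤i) = trans (coeffs (suc i))
      (trans (+-cong (b d≤i) (-‿cong (trans (*-congˡ (proj₂ mon (s≤s d≤i))) (zeroʳ c)))) (-‿inverseʳ 0#))

  -- This gives the uniqueness of remainders. The tail of the cofactor vanishes first, by the
  -- coefficients above `d`; what remains is a multiple `a * m`, whose coefficient in degree `d` is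
  -- `a`.
  multiple-Below : ∀ {d m} → Monic d m → ∀ s → Below d (s *ₚ m) → s ≈ₚ []
  multiple-Below mon [] b = reflₚ
  multiple-Below {d} {m} mon (a ∷ s) b = transₚ (∷-cong a≈0 s≈0) 0∷[]≈[]
    where
    s≈0 : s ≈ₚ []
    s≈0 = multiple-Below mon s λ {i} d≤i → R.begin
      coeff (s *ₚ m) i                             R.≈⟨ +-identityˡ _ ⟨
      0# + coeff (s *ₚ m) i                        R.≈⟨ +-congʳ (trans (*-congˡ (proj₂ mon (s≤s d≤i))) (zeroʳ a)) ⟨
      a * coeff m (suc i) + coeff (s *ₚ m) i       R.≈⟨ coeff-∷* a s m (suc i) ⟨
      coeff ((a ∷ s) *ₚ m) (suc i)                 R.≈⟨ b (ℕ.m≤n⇒m≤1+n d≤i) ⟩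
      0# R.∎
    a≈0 : a ≈ 0#
    a≈0 = R.begin
      a                                            R.≈⟨ *-identityʳ a ⟨
      a * 1#                                       R.≈⟨ *-congˡ (proj₁ mon) ⟨
      a * coeff m d                                R.≈⟨ +-identityʳ _ ⟨
      a * coeff m d + 0#                           R.≈⟨ +-congˡ (at (transₚ (∷-cong refl (*ₚ-cong s≈0 (reflₚ {m}))) 0∷[]≈[]) d) ⟨
      a * coeff m d + coeff (0# ∷ s *ₚ m) d        R.≈⟨ coeff-∷* a s m d ⟨
      coeff ((a ∷ s) *ₚ m) d                       R.≈⟨ b ℕ.≤-refl ⟩
      0# R.∎

  *-cancelʳ-monic : ∀ {d m} → Monic d m → ∀ {s t} → s *ₚ m ≈ₚ t *ₚ m → s ≈ₚ t
  *-cancelʳ-monic {d} {m} mon {s} {t} e = R[x]ᵖ.x∙y⁻¹≈ε⇒x≈y s t (multiple-Below mon _ (λ {i} _ → at z i))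
    where
    z : (s +ₚ -ₚ t) *ₚ m ≈ₚ []
    z = transₚ (R[x]ᵖ.[y-z]x≈yx-zx m s t) (R[x]ᵖ.x≈y⇒x∙y⁻¹≈ε e)

  eval : Carrier → Poly → Carrier
  eval r []      = 0#
  eval r (a ∷ p) = a + r * eval r p

  eval-0 : ∀ r {p} → p ≈ₚ [] → eval r p ≈ 0#
  eval-0 r {[]}    e = refl
  eval-0 r {a ∷ p} e = trans (+-cong (at e 0) (trans (*-congˡ (eval-0 r {p} (mk≈ₚ λ n → at e (suc n)))) (zeroʳ r))) (+-identityˡ 0#)

  eval-cong : ∀ r {p q} → p ≈ₚ q → eval r p ≈ eval r q
  eval-cong r {[]}    {q}     e = sym (eval-0 r (symₚ e))
  eval-cong r {a ∷ p} {[]}    e = eval-0 r e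
  eval-cong r {a ∷ p} {b ∷ q} e = +-cong (at e 0) (*-congˡ (eval-cong r {p} {q} (mk≈ₚ λ n → at e (suc n))))

  eval-+ : ∀ r p q → eval r (p +ₚ q) ≈ eval r p + eval r q
  eval-+ r []      q       = sym (+-identityˡ _)
  eval-+ r (a ∷ p) []      = sym (+-identityʳ _)
  eval-+ r (a ∷ p) (b ∷ q) = trans (+-congˡ (*-congˡ (eval-+ r p q)))
    (S.solve 5 (λ a b r x y → (a S.:+ b) S.:+ r S.:* (x S.:+ y) S.:= (a S.:+ r S.:* x) S.:+ (b S.:+ r S.:* y)) refl a b r (eval r p) (eval r q))

  eval-scale : ∀ r a p → eval r (scale a p) ≈ a * eval r p
  eval-scale r a []      = sym (zeroʳ a)
  eval-scale r a (b ∷ p) = trans (+-congˡ (*-congˡ (eval-scale r a p)))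
    (S.solve 4 (λ a b r x → a S.:* b S.:+ r S.:* (a S.:* x) S.:= a S.:* (b S.:+ r S.:* x)) refl a b r (eval r p))

  eval-neg : ∀ r p → eval r (-ₚ p) ≈ - eval r p
  eval-neg r []      = sym -0#≈0#
  eval-neg r (b ∷ p) = trans (+-congˡ (*-congˡ (eval-neg r p)))
    (S.solve 3 (λ b r x → S.:- b S.:+ r S.:* (S.:- x) S.:= S.:- (b S.:+ r S.:* x)) refl b r (eval r p))

  eval-* : ∀ r p q → eval r (p *ₚ q) ≈ eval r p * eval r q
  eval-* r []      q = sym (zeroˡ _)
  eval-* r (a ∷ p) q = R.begin
    eval r (scale a q +ₚ (0# ∷ p *ₚ q))          R.≈⟨ eval-+ r (scale a q) _ ⟩
    eval r (scale a q) + (0# + r * eval r (p *ₚ q)) R.≈⟨ +-cong (eval-scale r a q) (+-congˡ (*-congˡ (eval-* r p q))) ⟩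
    a * eval r q + (0# + r * (eval r p * eval r q)) R.≈⟨ S.solve 4 (λ a r x y → a S.:* y S.:+ (S.con (+ 0) S.:+ r S.:* (x S.:* y)) S.:= (a S.:+ r S.:* x) S.:* y) refl a r (eval r p) (eval r q) ⟩
    (a + r * eval r p) * eval r q R.∎

  eval-const : ∀ r a → eval r (const a) ≈ a
  eval-const r a = trans (+-congˡ (zeroʳ r)) (+-identityʳ a)

  X-_ : Carrier → Poly
  X- r = - r ∷ 1# ∷ []

  eval-X- : ∀ s r → eval s (X- r) ≈ s - r
  eval-X- s r = S.solve 2 (λ s r → S.:- r S.:+ s S.:* (S.con (+ 1) S.:+ s S.:* S.con (+ 0)) S.:= s S.:- r) refl s r

  Monic-X- : ∀ r → Monic 1 (X- r)
  Monic-X- r = refl , λ { (s≤s (s≤s z≤n)) → refl }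

  factor : ∀ r p → ∃[ s ] p ≈ₚ s *ₚ (X- r) +ₚ const (eval r p)
  factor r p with divide (Monic-X- r) p
  ... | s , t , e , b = s , transₚ e (+ₚ-cong (reflₚ {s *ₚ (X- r)}) (transₚ t≈ (∷-cong (sym ev) reflₚ)))
    where
    t≈ = Below-1 {t} b
    ev : eval r p ≈ coeff t 0
    ev = R.begin
      eval r p                                   R.≈⟨ eval-cong r e ⟩
      eval r (s *ₚ (X- r) +ₚ t)                  R.≈⟨ eval-+ r (s *ₚ (X- r)) t ⟩
      eval r (s *ₚ (X- r)) + eval r t            R.≈⟨ +-cong (trans (eval-* r s (X- r)) (*-congˡ (trans (eval-X- r r) (-‿inverseʳ r)))) (trans (eval-cong r t≈) (eval-const r _)) ⟩
      eval r s * 0# + coeff t 0                  R.≈⟨ +-congʳ (zeroʳ _) ⟩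
      0# + coeff t 0                             R.≈⟨ +-identityˡ _ ⟩
      coeff t 0 R.∎

  -- The formal derivative, by (a + x p)′ = p + x p′.
  D : Poly → Poly
  D []      = []
  D (a ∷ p) = p +ₚ (0# ∷ D p)

  D-0 : ∀ {p} → p ≈ₚ [] → D p ≈ₚ []
  D-0 {[]}    e = reflₚ
  D-0 {a ∷ p} e = +ₚ-cong p≈0 (transₚ (∷-cong refl (D-0 p≈0)) 0∷[]≈[])
    where
    p≈0 : p ≈ₚ []
    p≈0 = mk≈ₚ λ n → at e (suc n)

  D-cong : ∀ {p q} → p ≈ₚ q → D p ≈ₚ D q
  D-cong {[]}    {q}     e = symₚ (D-0 (symₚ e))
  D-cong {a ∷ p} {[]}    e = D-0 e
  D-cong {a ∷ p} {b ∷ q} e = +ₚ-cong p≈q (∷-cong refl (D-cong p≈q))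
    where
    p≈q : p ≈ₚ q
    p≈q = mk≈ₚ λ n → at e (suc n)

  D-+ : ∀ p q → D (p +ₚ q) ≈ₚ D p +ₚ D q
  D-+ []      q       = reflₚ
  D-+ (a ∷ p) []      = symₚ (+ₚ-identityʳ _)
  D-+ (a ∷ p) (b ∷ q) = transₚ
    (+ₚ-cong (reflₚ {p +ₚ q}) (transₚ (∷-cong refl (D-+ p q)) (0∷-+ (D p) (D q))))
    (+ₚ-medial p q (0# ∷ D p) (0# ∷ D q))

  D-neg : ∀ p → D (-ₚ p) ≈ₚ -ₚ D p
  D-neg p = R[x]ᵖ.+-inverseʳ-unique (D p) (D (-ₚ p)) (transₚ (symₚ (D-+ p (-ₚ p))) (D-0 (+ₚ-inverseʳ p)))

  D-scale : ∀ a p → D (scale a p) ≈ₚ scale a (D p)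
  D-scale a []      = reflₚ
  D-scale a (b ∷ p) = transₚ (+ₚ-cong (reflₚ {scale a p}) (transₚ (∷-cong refl (D-scale a p)) (symₚ (scale-0∷ a (D p)))))
    (symₚ (scale-+ a p (0# ∷ D p)))

  D-* : ∀ p q → D (p *ₚ q) ≈ₚ D p *ₚ q +ₚ p *ₚ D q
  D-* []      q = reflₚ
  D-* (a ∷ p) q = P.begin
    D (scale a q +ₚ (0# ∷ p *ₚ q))
      P.≈⟨ D-+ (scale a q) (0# ∷ p *ₚ q) ⟩
    D (scale a q) +ₚ (p *ₚ q +ₚ (0# ∷ D (p *ₚ q)))
      P.≈⟨ +ₚ-cong (D-scale a q) (+ₚ-cong (reflₚ {p *ₚ q}) (transₚ (∷-cong refl (D-* p q)) (0∷-+ (D p *ₚ q) (p *ₚ D q)))) ⟩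
    scale a (D q) +ₚ (p *ₚ q +ₚ ((0# ∷ D p *ₚ q) +ₚ (0# ∷ p *ₚ D q)))
      P.≈⟨ Sₚ.solve 4 (λ u v w z → u Sₚ.:+ (v Sₚ.:+ (w Sₚ.:+ z)) Sₚ.:= (v Sₚ.:+ w) Sₚ.:+ (u Sₚ.:+ z)) reflₚ (scale a (D q)) (p *ₚ q) (0# ∷ D p *ₚ q) (0# ∷ p *ₚ D q) ⟩
    (p *ₚ q +ₚ (0# ∷ D p *ₚ q)) +ₚ (a ∷ p) *ₚ D q
      P.≈⟨ +ₚ-cong (transₚ (*ₚ-distribʳ q p (0# ∷ D p)) (+ₚ-cong (reflₚ {p *ₚ q}) (0∷-* (D p) q))) (reflₚ {(a ∷ p) *ₚ D q}) ⟨
    D (a ∷ p) *ₚ q +ₚ (a ∷ p) *ₚ D q P.∎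

-- Finite setoids and the enumeration of effective cycles.

module FiniteSetoids where

  private variable
    a a′ b b′ ℓ ℓ₁ ℓ₂ : Level
    A B : Set a

  module _ {S : Setoid a ℓ} where

    open Setoid S using (Carrier; _≈_) renaming (refl to ≈-refl; sym to ≈-sym; trans to ≈-trans)

    lookup-injective : ∀ {xs} → Unique S xs → ∀ {i j} → lookup xs i ≈ lookup xs j → i ≡ j
    lookup-injective (_ ∷ _)   {zero}  {zero}  e = ≡.refl
    lookup-injective (px ∷ _)  {zero}  {suc j} e = contradiction e (All.lookup px (∈-lookup j))
    lookup-injective (px ∷ _)  {suc i} {zero}  e = contradiction (≈-sym e) (All.lookup px (∈-lookup i))
    lookup-injective (_ ∷ xs!) {suc i} {suc j} e = cong suc (lookup-injective xs! e)

    fromList : ∀ xs → Unique S xs → (∀ x → SetoidMembership._∈_ S x xs) → Finite S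
    fromList xs xs! complete = length xs , record
      { to = lookup xs
      ; cong = λ { ≡.refl → ≈-refl }
      ; bijective = lookup-injective xs! , λ y →
          Any.index (complete y) , λ { ≡.refl → ≈-sym (Any.lookup-index (complete y)) } }

    sum-lookup : ∀ xs (f : Carrier → ℤ) →
      RawMonoid.sum ℤ.+-0-rawMonoid (f ∘ lookup xs) ≡ foldr ℤ._+_ 0ℤ (map f xs)
    sum-lookup []       f = ≡.refl
    sum-lookup (x ∷ xs) f = cong (ℤ._+_ (f x)) (sum-lookup xs f)

    module _ (fin : Finite S) where

      open Bijection (proj₂ fin) using (to; injective; surjective)

      index : Carrier → Fin ∣ fin ∣
      index x = proj₁ (surjective x)

      to-index : ∀ x → to (index x) ≈ x
      to-index x = proj₂ (surjective x) ≡.refl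

      index-cong : ∀ {x y} → x ≈ y → index x ≡ index y
      index-cong e = injective (≈-trans (to-index _) (≈-trans e (≈-sym (to-index _))))

      index-injective : ∀ {x y} → index x ≡ index y → x ≈ y
      index-injective {x} {y} e =
        ≈-trans (≈-sym (to-index x)) (≈-trans (Bijection.cong (proj₂ fin) e) (to-index y))

      finite⇒decidable : Decidable _≈_
      finite⇒decidable x y = map′ index-injective index-cong (index x Fin.≟ index y)

      elements : List Carrier
      elements = tabulate to

      elements-unique : Unique S elements
      elements-unique = Unique.tabulate⁺ S injective

      ∈-elements : ∀ x → SetoidMembership._∈_ S x elements
      ∈-elements x = Any.tabulate⁺ (index x) (≈-sym (to-index x))

  module _ {S : Setoid a ℓ₁} {T : Setoid b ℓ₂} where

    open Setoid S using () renaming (Carrier to C₁; _≈_ to _≈₁_)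
    open Setoid T using () renaming (Carrier to C₂; _≈_ to _≈₂_)

    injection⇒≤ : (F : Finite S) (G : Finite T) (f : C₁ → C₂) → (∀ {x y} → f x ≈₂ f y → x ≈₁ y) →
      ∣ F ∣ ℕ.≤ ∣ G ∣
    injection⇒≤ F G f inj = injective⇒≤ {f = index G ∘ f ∘ Bijection.to (proj₂ F)}
      λ e → Bijection.injective (proj₂ F) (inj (index-injective G e))

    -- The cardinality is that of `T` by definition, so that a count in `T` is a count in `S`
    -- without any rewriting.
    finite-reflect : (f : C₁ → C₂) → (∀ {x y} → x ≈₁ y → f x ≈₂ f y) → (∀ {x y} → f x ≈₂ f y → x ≈₁ y) →
      (∀ y → ∃[ x ] f x ≈₂ y) → Finite T → Finite S
    finite-reflect f f-cong inj surj G = ∣ G ∣ , record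
      { to = g
      ; cong = λ { ≡.refl → Setoid.refl S }
      ; bijective = (λ {i} {j} e → Bijection.injective (proj₂ G)
            (Setoid.trans T (Setoid.sym T (proj₂ (surj _))) (Setoid.trans T (f-cong e) (proj₂ (surj _))))) ,
          λ x → index G (f x) , λ { ≡.refl → inj (Setoid.trans T (proj₂ (surj _)) (to-index G (f x))) } }
      where
      g : Fin ∣ G ∣ → C₁
      g i = proj₁ (surj (Bijection.to (proj₂ G) i))

  module _ {p} (S : Setoid a ℓ) {P : Setoid.Carrier S → Set p} where

    open Setoid S using (Carrier)

    private
      map-toList : ∀ {xs} (ps : All P xs) → map proj₁ (All.toList ps) ≡ xs
      map-toList []       = ≡.refl
      map-toList (_ ∷ ps) = cong (_ ∷_) (map-toList ps)

      toList-∈ : ∀ {x xs} (ps : All P xs) → SetoidMembership._∈_ S x xs → Any (Setoid._≈_ S x ∘ proj₁) (All.toList ps)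
      toList-∈ (_ ∷ ps) (here q)  = here q
      toList-∈ (_ ∷ ps) (there i) = there (toList-∈ ps i)

    module _ {xs : List Carrier} (ps : All P xs) (xs! : Unique S xs) (complete : ∀ {x} → P x → SetoidMembership._∈_ S x xs) where

      fromAll : Finite (subsetoid S P)
      fromAll = fromList {S = subsetoid S P} (All.toList ps)
        (Unique.map⁻ (subsetoid S P) S {proj₁} id (≡.subst (Unique S) (≡.sym (map-toList ps)) xs!))
        (λ { (x , px) → toList-∈ ps (complete px) })

      size-fromAll : ∣ fromAll ∣ ≡ length xs
      size-fromAll = ≡.trans (≡.sym (ListProperties.length-map proj₁ (All.toList ps))) (cong length (map-toList ps))

      sumOver-fromAll : ∀ (f : Carrier → ℤ) → sumOver {S = subsetoid S P} fromAll (f ∘ proj₁) ≡ foldr ℤ._+_ 0ℤ (map f xs)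
      sumOver-fromAll f = ≡.trans (sum-lookup {S = subsetoid S P} (All.toList ps) (f ∘ proj₁))
        (cong (foldr ℤ._+_ 0ℤ) (≡.trans (ListProperties.map-∘ (All.toList ps)) (cong (map f) (map-toList ps))))

  -- Power series, as sequences of coefficients

  -- Multiplication by tᵈ.
  shift : ℕ → (ℕ → ℤ) → ℕ → ℤ
  shift zero    s n       = s n
  shift (suc d) s zero    = 0ℤ
  shift (suc d) s (suc n) = shift d s n

  shift-cong : ∀ d {s s′} n → (∀ m → m ℕ.≤ n → s m ≡ s′ m) → shift d s n ≡ shift d s′ n
  shift-cong zero    n       e = e n ℕ.≤-refl
  shift-cong (suc d) zero    e = ≡.refl
  shift-cong (suc d) (suc n) e = shift-cong d n λ m m≤n → e m (ℕ.m≤n⇒m≤1+n m≤n)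

  infix 4 _≐_/[1-_t^1+_]
  -- The quotient of `s` by 1 - c t¹⁺ᵈ, with the denominator cleared. The exponent is positive by
  -- construction, so the recurrence determines `g`.
  record _≐_/[1-_t^1+_] (g s : ℕ → ℤ) (c : ℤ) (d : ℕ) : Set where
    constructor mk≐
    field recurrence : ∀ n → g n ≡ s n ℤ.+ c ℤ.* shift (suc d) g n

  open _≐_/[1-_t^1+_] public

  module _ {A : Set a} where

    shiftᴸ : ℕ → (ℕ → List A) → ℕ → List A
    shiftᴸ zero    s n       = s n
    shiftᴸ (suc d) s zero    = []
    shiftᴸ (suc d) s (suc n) = shiftᴸ d s n

    shiftᴸ-cong : ∀ d {s s′} n → (∀ m → m ℕ.≤ n → s m ≡ s′ m) → shiftᴸ d s n ≡ shiftᴸ d s′ n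
    shiftᴸ-cong zero    n       e = e n ℕ.≤-refl
    shiftᴸ-cong (suc d) zero    e = ≡.refl
    shiftᴸ-cong (suc d) (suc n) e = shiftᴸ-cong d n λ m m≤n → e m (ℕ.m≤n⇒m≤1+n m≤n)

    shiftᴸ-All : ∀ {p} {P : ℕ → A → Set p} d {s} n → (∀ m → All (P m) (s m)) →
      All (λ x → ∃[ m ] d ℕ.+ m ≡ n × P m x) (shiftᴸ d s n)
    shiftᴸ-All zero    n       ps = All.map (λ px → n , ≡.refl , px) (ps n)
    shiftᴸ-All (suc d) zero    ps = []
    shiftᴸ-All (suc d) (suc n) ps = All.map (λ { (m , e , px) → m , cong suc e , px }) (shiftᴸ-All d n ps)

    shiftᴸ-Any : ∀ {p} {P : A → Set p} d {s} m → Any P (s m) → Any P (shiftᴸ d s (d ℕ.+ m))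
    shiftᴸ-Any zero    m px = px
    shiftᴸ-Any (suc d) m px = shiftᴸ-Any d m px

    sum-shiftᴸ : ∀ (f : A → ℤ) d s n →
      foldr ℤ._+_ 0ℤ (map f (shiftᴸ d s n)) ≡ shift d (λ m → foldr ℤ._+_ 0ℤ (map f (s m))) n
    sum-shiftᴸ f zero    s n       = ≡.refl
    sum-shiftᴸ f (suc d) s zero    = ≡.refl
    sum-shiftᴸ f (suc d) s (suc n) = sum-shiftᴸ f d s n

  shiftᴸ-Unique : (S : Setoid a ℓ) → ∀ d {s} n → (∀ m → Unique S (s m)) → Unique S (shiftᴸ d s n)
  shiftᴸ-Unique S zero    n       us = us n
  shiftᴸ-Unique S (suc d) zero    us = []
  shiftᴸ-Unique S (suc d) (suc n) us = shiftᴸ-Unique S d n us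

  sum-++ : ∀ (f : A → ℤ) xs ys → foldr ℤ._+_ 0ℤ (map f (xs ++ ys)) ≡
    foldr ℤ._+_ 0ℤ (map f xs) ℤ.+ foldr ℤ._+_ 0ℤ (map f ys)
  sum-++ f []       ys = ≡.sym (ℤ.+-identityˡ _)
  sum-++ f (x ∷ xs) ys = ≡.trans (cong (ℤ._+_ (f x)) (sum-++ f xs ys)) (≡.sym (ℤ.+-assoc (f x) _ _))

  sum-* : ∀ c (f : B → ℤ) (g : A → B) (h : A → ℤ) → (∀ x → f (g x) ≡ c ℤ.* h x) →
    ∀ xs → foldr ℤ._+_ 0ℤ (map f (map g xs)) ≡ c ℤ.* foldr ℤ._+_ 0ℤ (map h xs)
  sum-* c f g h e []       = ≡.sym (ℤ.*-zeroʳ c)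
  sum-* c f g h e (x ∷ xs) = ≡.trans (cong₂ ℤ._+_ (e x) (sum-* c f g h e xs)) (≡.sym (ℤ.*-distribˡ-+ c (h x) _))

  -- Effective cycles over a graded set

  -- An entry (x , d) of a list of points stands for a point x of degree 1 + d.
  module Cycles (S : Setoid a ℓ) (HasDegree : Setoid.Carrier S → ℕ → Set b)
    (degree-unique : ∀ {x y d e} → Setoid._≈_ S x y → HasDegree x d → HasDegree y e → d ≡ e) where

    open Setoid S using (Carrier; _≈_) renaming (refl to ≈-refl; sym to ≈-sym)
    open Permutation S
    open Membership using (∈-resp-≈)

    Degrees : ℕ → List Carrier → Set (a ⊔ b)
    Degrees n α = Σ[ ds ∈ List ℕ ] Pointwise HasDegree α ds × List.sum ds ≡ n

    Sym : ℕ → Setoid (a ⊔ b) (a ⊔ ℓ)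
    Sym n = On.setoid {B = Σ[ α ∈ List Carrier ] Degrees n α} ↭-setoid proj₁

    Points : Set a
    Points = List (Carrier × ℕ)

    -- The first argument bounds the recursion. Each copy of the head point lowers the degree by at
    -- least one, so the bound `n` is enough in degree `n`.
    multisetsUpTo : ℕ → Points → ℕ → List (List Carrier)
    multisetsUpTo _       []             zero    = [] ∷ []
    multisetsUpTo _       []             (suc n) = []
    multisetsUpTo zero    (_ ∷ ws)       n       = multisetsUpTo zero ws n
    multisetsUpTo (suc f) ((x , d) ∷ ws) n       =
      multisetsUpTo (suc f) ws n ++ map (x ∷_) (shiftᴸ (suc d) (multisetsUpTo f ((x , d) ∷ ws)) n)

    multisets : Points → ℕ → List (List Carrier)
    multisets ws n = multisetsUpTo n ws n

    multisetsUpTo-≡ : ∀ f f′ ws n → n ℕ.≤ f → n ℕ.≤ f′ → multisetsUpTo f ws n ≡ multisetsUpTo f′ ws n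
    multisetsUpTo-≡ f       f′       []       zero    _ _ = ≡.refl
    multisetsUpTo-≡ f       f′       []       (suc n) _ _ = ≡.refl
    multisetsUpTo-≡ zero    zero     (w ∷ ws) n       _ _ = ≡.refl
    multisetsUpTo-≡ zero    (suc f′) (w ∷ ws) zero    _ _ =
      ≡.trans (multisetsUpTo-≡ zero (suc f′) ws zero z≤n z≤n) (≡.sym (ListProperties.++-identityʳ _))
    multisetsUpTo-≡ (suc f) zero     (w ∷ ws) zero    _ _ =
      ≡.trans (ListProperties.++-identityʳ _) (multisetsUpTo-≡ (suc f) zero ws zero z≤n z≤n)
    multisetsUpTo-≡ (suc f) (suc f′) (w ∷ ws) n n≤f n≤f′ =
      cong₂ _++_ (multisetsUpTo-≡ (suc f) (suc f′) ws n n≤f n≤f′) (cong (map (proj₁ w ∷_)) (rest n n≤f n≤f′))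
      where
      d = proj₂ w
      rest : ∀ n → n ℕ.≤ suc f → n ℕ.≤ suc f′ →
        shiftᴸ (suc d) (multisetsUpTo f (w ∷ ws)) n ≡ shiftᴸ (suc d) (multisetsUpTo f′ (w ∷ ws)) n
      rest zero    _          _           = ≡.refl
      rest (suc n) (s≤s n≤f) (s≤s n≤f′) = shiftᴸ-cong d n λ m m≤n →
        multisetsUpTo-≡ f f′ (w ∷ ws) m (ℕ.≤-trans m≤n n≤f) (ℕ.≤-trans m≤n n≤f′)

    -- Division by 1 - t¹⁺ᵈ on the level of lists: a multiset either avoids `x` or has a copy of `x`
    -- to remove. Summing a multiplicative function turns this into the recurrence of the Euler
    -- factor.
    multisets-∷ : ∀ x d ws n → multisets ((x , d) ∷ ws) n ≡
      multisets ws n ++ map (x ∷_) (shiftᴸ (suc d) (multisets ((x , d) ∷ ws)) n)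
    multisets-∷ x d ws zero    = ≡.sym (ListProperties.++-identityʳ _)
    multisets-∷ x d ws (suc n) = cong (λ l → multisets ws (suc n) ++ map (x ∷_) l)
      (shiftᴸ-cong d n λ m m≤n → multisetsUpTo-≡ n m ((x , d) ∷ ws) m m≤n ℕ.≤-refl)

    Graded : Points → Set (a ⊔ b)
    Graded = All λ w → HasDegree (proj₁ w) (suc (proj₂ w))

    infix 4 _∈ₚ_
    _∈ₚ_ : Carrier → Points → Set (a ⊔ ℓ)
    x ∈ₚ ws = SetoidMembership._∈_ S x (map proj₁ ws)

    multisets-degrees : ∀ f ws n → Graded ws → All (Degrees n) (multisetsUpTo f ws n)
    multisets-degrees f       []             zero    g        = ([] , [] , ≡.refl) ∷ []
    multisets-degrees f       []             (suc n) g        = []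
    multisets-degrees zero    (_ ∷ ws)       n       (_ ∷ g)  = multisets-degrees zero ws n g
    multisets-degrees (suc f) ((x , d) ∷ ws) n       (h ∷ g)  =
      All.++⁺ (multisets-degrees (suc f) ws n g) (All.map⁺ (All.map cons
        (shiftᴸ-All {P = Degrees} (suc d) n λ m → multisets-degrees f ((x , d) ∷ ws) m (h ∷ g))))
      where
      cons : ∀ {α} → ∃[ m ] suc d ℕ.+ m ≡ n × Degrees m α → Degrees n (x ∷ α)
      cons (m , ≡.refl , ds , hs , ≡.refl) = suc d ∷ ds , h ∷ hs , ≡.refl

    multisets-support : ∀ f ws n → All (All (_∈ₚ ws)) (multisetsUpTo f ws n)
    multisets-support f       []             zero    = [] ∷ []
    multisets-support f       []             (suc n) = []
    multisets-support zero    (_ ∷ ws)       n       = All.map (All.map there) (multisets-support zero ws n)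
    multisets-support (suc f) ((x , d) ∷ ws) n       =
      All.++⁺ (All.map (All.map there) (multisets-support (suc f) ws n)) (All.map⁺ (All.map (λ { (_ , _ , s) → here ≈-refl ∷ s })
        (shiftᴸ-All {P = λ _ → All (_∈ₚ ((x , d) ∷ ws))} (suc d) n (multisets-support f ((x , d) ∷ ws)))))

    -- The two halves of the list are disjoint even up to permutation: the cycles of the first are
    -- supported on `ws`, which misses `x`, while those of the second contain `x`.
    multisets-unique : ∀ f ws n → Unique S (map proj₁ ws) → Unique ↭-setoid (multisetsUpTo f ws n)
    multisets-unique f       []             zero    u         = [] ∷ []
    multisets-unique f       []             (suc n) u         = []
    multisets-unique zero    (_ ∷ ws)       n       (_ ∷ u)   = multisets-unique zero ws n u
    multisets-unique (suc f) ((x , d) ∷ ws) n       (x∉ ∷ u) = Unique.++⁺ ↭-setoid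
      (multisets-unique (suc f) ws n u)
      (Unique.map⁺ ↭-setoid ↭-setoid (↭.drop-∷ S)
        (shiftᴸ-Unique ↭-setoid (suc d) n λ m → multisets-unique f ((x , d) ∷ ws) m (x∉ ∷ u)))
      disjoint
      where
      disjoint : ∀ {v} → ¬ (SetoidMembership._∈_ ↭-setoid v (multisetsUpTo (suc f) ws n) ×
        SetoidMembership._∈_ ↭-setoid v (map (x ∷_) (shiftᴸ (suc d) (multisetsUpTo f ((x , d) ∷ ws)) n)))
      disjoint (v∈ , v∈x) with All.lookupAny (multisets-support (suc f) ws n) v∈
                             | Membership.∈-map⁻ ↭-setoid ↭-setoid v∈x
      ... | supp , v↭α | β , _ , v↭xβ with All.lookupAny supp (↭.∈-resp-↭ S (↭-trans (↭-sym v↭xβ) v↭α) (here ≈-refl))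
      ... | y∈ , x≈y = All.All¬⇒¬Any x∉ (∈-resp-≈ S (≈-sym x≈y) y∈)

    private
      -- A copy of `x` is moved to the front. The degree that disappears is `d`, because equal
      -- points have equal degrees.
      extract : ∀ {p} {P : Carrier → Set p} {x d α ds} → HasDegree x d → Any (_≈ x) α → All P α →
        Pointwise HasDegree α ds → ∃[ β ] ∃[ ds′ ] α ↭ x ∷ β × All P β × Pointwise HasDegree β ds′ × List.sum ds ≡ d ℕ.+ List.sum ds′
      extract h (here e) (_ ∷ ps) (h′ ∷ hs) =
        _ , _ , prep e ↭-refl , ps , hs , cong (ℕ._+ _) (≡.sym (degree-unique (≈-sym e) h h′))
      extract {x = x} {d} {y ∷ α} {e ∷ ds} h (there i) (p ∷ ps) (h′ ∷ hs) with extract h i ps hs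
      ... | β , ds′ , α↭ , ps′ , hs′ , eq = y ∷ β , e ∷ ds′ ,
        ↭-trans (↭-prep y α↭) (↭-swap y x ↭-refl) , p ∷ ps′ , h′ ∷ hs′ ,
        ≡.trans (cong (e ℕ.+_) eq) (≡.trans (≡.sym (ℕ.+-assoc e d _)) (≡.trans (cong (ℕ._+ List.sum ds′) (ℕ.+-comm e d)) (ℕ.+-assoc d e _)))

      split : ∀ {x d ws α} → All (_∈ₚ ((x , d) ∷ ws)) α → All (_∈ₚ ws) α ⊎ Any (_≈ x) α
      split []               = inj₁ []
      split (here e ∷ ps)    = inj₂ (here e)
      split {d = d} (there p ∷ ps) with split {d = d} ps
      ... | inj₁ qs = inj₁ (p ∷ qs)
      ... | inj₂ i  = inj₂ (there i)

    multisets-complete : ∀ f ws n → n ℕ.≤ f → Graded ws → ∀ {α} → All (_∈ₚ ws) α → Degrees n α →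
      SetoidMembership._∈_ ↭-setoid α (multisetsUpTo f ws n)
    multisets-complete f [] n n≤f g [] ([] , [] , ≡.refl) = here ↭-refl
    multisets-complete f (w ∷ ws) n n≤f (h ∷ g) ps (ds , hs , eq) with split {d = proj₂ w} ps
    multisets-complete zero    (w ∷ ws) n n≤f (h ∷ g) ps deg | inj₁ ps′ = multisets-complete zero ws n n≤f g ps′ deg
    multisets-complete (suc f) (w ∷ ws) n n≤f (h ∷ g) ps deg | inj₁ ps′ = Any.++⁺ˡ (multisets-complete (suc f) ws n n≤f g ps′ deg)
    multisets-complete f ((x , d) ∷ ws) n n≤f (h ∷ g) ps (ds , hs , ≡.refl) | inj₂ i with extract h i ps hs
    multisets-complete zero ((x , d) ∷ ws) n n≤f (h ∷ g) ps (ds , hs , ≡.refl) | inj₂ i | β , ds′ , α↭ , ps′ , hs′ , eq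
      with () ← ≡.subst (ℕ._≤ 0) eq n≤f
    multisets-complete (suc f) ((x , d) ∷ ws) n n≤f (h ∷ g) ps (ds , hs , ≡.refl) | inj₂ i | β , ds′ , α↭ , ps′ , hs′ , eq =
      ≡.subst (λ n → SetoidMembership._∈_ ↭-setoid _ (multisetsUpTo (suc f) ((x , d) ∷ ws) n)) (≡.sym eq)
        (Any.++⁺ʳ (multisetsUpTo (suc f) ws _) (Any.map⁺ (Any.map (λ β↭ → ↭-trans α↭ (↭-prep x β↭))
          (shiftᴸ-Any (suc d) {multisetsUpTo f ((x , d) ∷ ws)} (List.sum ds′)
            (multisets-complete f ((x , d) ∷ ws) (List.sum ds′) m≤f (h ∷ g) ps′ (ds′ , hs′ , ≡.refl))))))
      where
      m≤f : List.sum ds′ ℕ.≤ f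
      m≤f = ℕ.≤-trans (ℕ.m≤n+m _ d) (ℕ.≤-pred (≡.subst (ℕ._≤ suc f) eq n≤f))

    -- ∏ 1 / (1 - f(x) t^deg(x))
    eulerProduct : (Carrier → ℤ) → Points → ℕ → ℤ
    eulerProduct f ws n = foldr ℤ._+_ 0ℤ (map (λ α → foldr ℤ._*_ 1ℤ (map f α)) (multisets ws n))

    eulerProduct-∷ : ∀ f x d ws → eulerProduct f ((x , d) ∷ ws) ≐ eulerProduct f ws /[1- f x t^1+ d ]
    eulerProduct-∷ f x d ws = mk≐ λ n → let rest = shiftᴸ (suc d) (multisets ((x , d) ∷ ws)) n in begin
      ∑ (multisets ((x , d) ∷ ws) n)                                ≡⟨ cong ∑ (multisets-∷ x d ws n) ⟩
      ∑ (multisets ws n ++ map (x ∷_) rest)                         ≡⟨ sum-++ ∏ (multisets ws n) _ ⟩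
      ∑ (multisets ws n) ℤ.+ ∑ (map (x ∷_) rest)                    ≡⟨ cong (λ s → ∑ (multisets ws n) ℤ.+ s) (sum-* (f x) ∏ (x ∷_) ∏ (λ _ → ≡.refl) rest) ⟩
      ∑ (multisets ws n) ℤ.+ f x ℤ.* ∑ rest                         ≡⟨ cong (λ s → ∑ (multisets ws n) ℤ.+ f x ℤ.* s) (sum-shiftᴸ ∏ (suc d) (multisets ((x , d) ∷ ws)) n) ⟩
      eulerProduct f ws n ℤ.+ f x ℤ.* shift (suc d) (eulerProduct f ((x , d) ∷ ws)) n ∎
      where
      open ≡-Reasoning
      ∏ : List Carrier → ℤ
      ∏ α = foldr ℤ._*_ 1ℤ (map f α)
      ∑ : List (List Carrier) → ℤ
      ∑ αs = foldr ℤ._+_ 0ℤ (map ∏ αs)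

    -- Cycles of degree at most `N` involve only points of degree at most `N`, so a finite Euler
    -- product is exact up to tᴺ. Points of larger degree may occur in the list; they do not affect
    -- these coefficients.
    record Enumeration (N : ℕ) : Set (a ⊔ b ⊔ ℓ) where
      field
        list     : Points
        graded   : Graded list
        unique   : Unique S (map proj₁ list)
        complete : ∀ {x d} → HasDegree x d → d ℕ.≤ N → x ∈ₚ list

    module _ {N} (E : Enumeration N) {n} (n≤N : n ℕ.≤ N) where

      open Enumeration E

      private
        support : ∀ {α ds} → Pointwise HasDegree α ds → List.sum ds ℕ.≤ N → All (_∈ₚ list) α
        support [] _ = []
        support (_∷_ {y = d} h hs) s = complete h (ℕ.≤-trans (ℕ.m≤m+n d _) s) ∷ support hs (ℕ.≤-trans (ℕ.m≤n+m _ d) s)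

        degrees : All (Degrees n) (multisets list n)
        degrees = multisets-degrees n list n graded

        degrees-complete : ∀ {α} → Degrees n α → SetoidMembership._∈_ ↭-setoid α (multisets list n)
        degrees-complete (ds , hs , eq) = multisets-complete n list n ℕ.≤-refl graded
          (support hs (≡.subst (ℕ._≤ N) (≡.sym eq) n≤N)) (ds , hs , eq)

        list-unique : Unique ↭-setoid (multisets list n)
        list-unique = multisets-unique n list n unique

      finiteSym : Finite (Sym n)
      finiteSym = fromAll ↭-setoid degrees list-unique degrees-complete

      sumOver-finiteSym : ∀ f → sumOver {S = Sym n} finiteSym (λ { (α , _) → foldr ℤ._*_ 1ℤ (map f α) }) ≡ eulerProduct f list n
      sumOver-finiteSym f = sumOver-fromAll ↭-setoid degrees list-unique degrees-complete (λ α → foldr ℤ._*_ 1ℤ (map f α))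

      size-finiteSym : + ∣ finiteSym ∣ ≡ eulerProduct (λ _ → 1ℤ) list n
      size-finiteSym = ≡.trans (cong +_ (size-fromAll ↭-setoid degrees list-unique degrees-complete)) (ones (multisets list n))
        where
        one : ∀ α → 1ℤ ≡ foldr ℤ._*_ 1ℤ (map {A = Carrier} (λ _ → 1ℤ) α)
        one []      = ≡.refl
        one (x ∷ α) = ≡.trans (one α) (≡.sym (ℤ.*-identityˡ _))
        ones : ∀ xs → + length xs ≡ foldr ℤ._+_ 0ℤ (map (λ α → foldr ℤ._*_ 1ℤ (map (λ _ → 1ℤ) α)) xs)
        ones []       = ≡.refl
        ones (x ∷ xs) = ≡.trans (ℤ.pos-+ 1 (length xs)) (cong₂ ℤ._+_ (one x) (ones xs))

open FiniteSetoids

-- Convolution and the factorisation of Euler products.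

module PowerSeries where

  private variable
    a a′ b b′ ℓ ℓ₁ ℓ₂ : Level
    A B : Set a

  open CMSum ℤ.+-0-commutativeMonoid using (sum; sum⁺-syntax; sum-cong-≗; ∑-distrib-+; sum-permute)
  open SemiringSum ℤ.+-*-semiring using (*-distribˡ-sum)

  infixl 7 _⊛_
  _⊛_ : (s t : ℕ → ℤ) → ℕ → ℤ
  (s ⊛ t) n = ∑[ i ≤ n ] (s (toℕ i) ℤ.* t (n ∸ toℕ i))

  ⊛-congˡ : ∀ {s s′} t → s ≗ s′ → s ⊛ t ≗ s′ ⊛ t
  ⊛-congˡ t e n = sum-cong-≗ {suc n} λ i → cong (ℤ._* t (n ∸ toℕ i)) (e (toℕ i))

  ⊛-comm : ∀ s t → s ⊛ t ≗ t ⊛ s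
  ⊛-comm s t n = ≡.trans (sum-permute {suc n} {suc n} (λ i → s (toℕ i) ℤ.* t (n ∸ toℕ i)) FinPermutation.reverse)
    (sum-cong-≗ {suc n} λ i → ≡.trans (cong₂ ℤ._*_ (cong s (Fin.opposite-prop i)) (cong t (flip i))) (ℤ.*-comm (s (n ∸ toℕ i)) (t (toℕ i))))
    where
    flip : ∀ (i : Fin (suc n)) → n ∸ toℕ (opposite i) ≡ toℕ i
    flip i = ≡.trans (cong (n ∸_) (Fin.opposite-prop i)) (ℕ.m∸[m∸n]≡n (ℕ.≤-pred (Fin.toℕ<n i)))

  ⊛-shift : ∀ d s t → shift d s ⊛ t ≗ shift d (s ⊛ t)
  ⊛-shift zero    s t n       = ≡.refl
  ⊛-shift (suc d) s t zero    = ≡.refl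
  ⊛-shift (suc d) s t (suc n) = ≡.trans (ℤ.+-identityˡ _) (⊛-shift d s t n)

  ⊛-expandˡ : ∀ {g s c d} t → g ≐ s /[1- c t^1+ d ] → g ⊛ t ≐ s ⊛ t /[1- c t^1+ d ]
  ⊛-expandˡ {g} {s} {c} {d} t e = mk≐ λ n → let u = λ (i : Fin (suc n)) → t (n ∸ toℕ i) in begin
    ∑[ i ≤ n ] (g (toℕ i) ℤ.* u i)
      ≡⟨ sum-cong-≗ {suc n} (λ i → ≡.trans (cong (ℤ._* u i) (recurrence e (toℕ i))) (rearrange (s (toℕ i)) c (shift (suc d) g (toℕ i)) (u i))) ⟩
    ∑[ i ≤ n ] (s (toℕ i) ℤ.* u i ℤ.+ c ℤ.* (shift (suc d) g (toℕ i) ℤ.* u i))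
      ≡⟨ ∑-distrib-+ {suc n} (λ i → s (toℕ i) ℤ.* u i) (λ i → c ℤ.* (shift (suc d) g (toℕ i) ℤ.* u i)) ⟩
    (s ⊛ t) n ℤ.+ ∑[ i ≤ n ] (c ℤ.* (shift (suc d) g (toℕ i) ℤ.* u i))
      ≡⟨ cong (λ r → (s ⊛ t) n ℤ.+ r) (*-distribˡ-sum {suc n} c (λ i → shift (suc d) g (toℕ i) ℤ.* u i)) ⟨
    (s ⊛ t) n ℤ.+ c ℤ.* (shift (suc d) g ⊛ t) n
      ≡⟨ cong (λ r → (s ⊛ t) n ℤ.+ c ℤ.* r) (⊛-shift (suc d) g t n) ⟩
    (s ⊛ t) n ℤ.+ c ℤ.* shift (suc d) (g ⊛ t) n ∎
    where
    open ≡-Reasoning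
    rearrange : ∀ s c g t → (s ℤ.+ c ℤ.* g) ℤ.* t ≡ s ℤ.* t ℤ.+ c ℤ.* (g ℤ.* t)
    rearrange = solve-∀

  ⊛-expandʳ : ∀ {g s c d} t → g ≐ s /[1- c t^1+ d ] → t ⊛ g ≐ t ⊛ s /[1- c t^1+ d ]
  ⊛-expandʳ {g} {s} {c} {d} t e = mk≐ λ n → ≡.trans (⊛-comm t g n) (≡.trans (recurrence (⊛-expandˡ t e) n)
    (cong₂ (λ x y → x ℤ.+ c ℤ.* y) (⊛-comm s t n) (shift-cong (suc d) n λ m _ → ⊛-comm g t m)))

  -- The recurrence for the coefficient `n` reaches back by `1 + d` steps at once, hence the
  -- induction on a bound `N` for the index.
  expand-unique : ∀ {g g′ s s′ c d} → g ≐ s /[1- c t^1+ d ] → g′ ≐ s′ /[1- c t^1+ d ] → s ≗ s′ → g ≗ g′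
  expand-unique {g} {g′} {s} {s′} {c} {d} e e′ s≗s′ n = upTo n n ℕ.≤-refl
    where
    upTo : ∀ N n → n ℕ.≤ N → g n ≡ g′ n
    tail : ∀ N n → n ℕ.≤ N → shift (suc d) g n ≡ shift (suc d) g′ n
    upTo N n n≤N = ≡.trans (recurrence e n) (≡.trans (cong₂ (λ x y → x ℤ.+ c ℤ.* y) (s≗s′ n) (tail N n n≤N)) (≡.sym (recurrence e′ n)))
    tail N       zero    _         = ≡.refl
    tail (suc N) (suc n) (s≤s n≤N) = shift-cong d n λ m m≤n → upTo N m (ℕ.≤-trans m≤n n≤N)

  shift-shift : ∀ d e s → shift d (shift e s) ≗ shift (d ℕ.+ e) s
  shift-shift zero    e s n       = ≡.refl
  shift-shift (suc d) e s zero    = ≡.refl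
  shift-shift (suc d) e s (suc n) = shift-shift d e s n

  shift-- : ∀ d s t n → shift d (λ m → s m ℤ.- t m) n ≡ shift d s n ℤ.- shift d t n
  shift-- zero    s t n       = ≡.refl
  shift-- (suc d) s t zero    = ≡.refl
  shift-- (suc d) s t (suc n) = shift-- d s t n

  -- The value of χ at a point of degree 1 + d, and the degrees (minus one) of the points above it
  data SplittingType (d : ℕ) : ℤ → List ℕ → Set where
    ramified : SplittingType d 0ℤ (d ∷ [])
    split    : SplittingType d 1ℤ (d ∷ d ∷ [])
    inert    : SplittingType d -1ℤ (d ℕ.+ suc d ∷ [])

  -- The identity (1 - T)(1 + T) = 1 - T² for T = t¹⁺ᵈ: substituting u = (1 - T) w into the second
  -- recurrence makes the terms in T w cancel. A degree of 2 (1 + d) is stored minus one, as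
  -- `d ℕ.+ suc d`.
  inert-expand : ∀ {w u v d} → w ≐ u /[1- 1ℤ t^1+ d ] → u ≐ v /[1- -1ℤ t^1+ d ] →
    w ≐ v /[1- 1ℤ t^1+ d ℕ.+ suc d ]
  inert-expand {w} {u} {v} {d} ew eu = mk≐ λ n → begin
    w n
      ≡⟨ ≡.trans (recurrence ew n) (cong (λ x → x ℤ.+ 1ℤ ℤ.* sh w n) (recurrence eu n)) ⟩
    v n ℤ.+ -1ℤ ℤ.* sh u n ℤ.+ 1ℤ ℤ.* sh w n
      ≡⟨ cong (λ x → v n ℤ.+ -1ℤ ℤ.* x ℤ.+ 1ℤ ℤ.* sh w n) (≡.trans (shift-cong (suc d) n λ m _ → u≗ m) (shift-- (suc d) w (sh w) n)) ⟩
    v n ℤ.+ -1ℤ ℤ.* (sh w n ℤ.- sh (sh w) n) ℤ.+ 1ℤ ℤ.* sh w n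
      ≡⟨ rearrange (v n) (sh w n) (sh (sh w) n) ⟩
    v n ℤ.+ 1ℤ ℤ.* sh (sh w) n
      ≡⟨ cong (λ x → v n ℤ.+ 1ℤ ℤ.* x) (shift-shift (suc d) (suc d) w n) ⟩
    v n ℤ.+ 1ℤ ℤ.* shift (suc (d ℕ.+ suc d)) w n ∎
    where
    open ≡-Reasoning
    sh = shift (suc d)
    rearrange : ∀ v x y → v ℤ.+ -1ℤ ℤ.* (x ℤ.- y) ℤ.+ 1ℤ ℤ.* x ≡ v ℤ.+ 1ℤ ℤ.* y
    rearrange = solve-∀
    cancel : ∀ u x → u ≡ (u ℤ.+ 1ℤ ℤ.* x) ℤ.- x
    cancel = solve-∀
    u≗ : ∀ m → u m ≡ w m ℤ.- sh w m
    u≗ m = ≡.trans (cancel (u m) (sh w m)) (cong (ℤ._- sh w m) (≡.sym (recurrence ew m)))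

  δ : ℕ → ℤ
  δ zero    = 1ℤ
  δ (suc n) = 0ℤ

  ⊛-identityˡ : ∀ s → δ ⊛ s ≗ s
  ⊛-identityˡ s n = begin
    1ℤ ℤ.* s n ℤ.+ sum (λ (i : Fin n) → 0ℤ ℤ.* s (n ∸ suc (toℕ i)))
      ≡⟨ cong₂ ℤ._+_ (ℤ.*-identityˡ (s n)) (≡.sym (*-distribˡ-sum {n} 0ℤ (λ i → s (n ∸ suc (toℕ i))))) ⟩
    s n ℤ.+ 0ℤ
      ≡⟨ ℤ.+-identityʳ (s n) ⟩
    s n ∎
    where open ≡-Reasoning

  module EulerFactorisation
    {S : Setoid a ℓ₁} {deg : Setoid.Carrier S → ℕ → Set b}
    (uniqueS : ∀ {x y d e} → Setoid._≈_ S x y → deg x d → deg y e → d ≡ e)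
    {T : Setoid a′ ℓ₂} {deg′ : Setoid.Carrier T → ℕ → Set b′}
    (uniqueT : ∀ {x y d e} → Setoid._≈_ T x y → deg′ x d → deg′ y e → d ≡ e)
    (χ : Setoid.Carrier S → ℤ) where

    private
      module S = Cycles S deg uniqueS
      module T = Cycles T deg′ uniqueT

    module _ (degree : Setoid.Carrier S → ℕ) (fibre : Setoid.Carrier S → T.Points)
      (splitting : ∀ x → SplittingType (degree x) (χ x) (map proj₂ (fibre x))) where

      private
        ζ : S.Points → ℕ → ℤ
        ζ = S.eulerProduct (λ _ → 1ℤ)

        ζ′ : T.Points → ℕ → ℤ
        ζ′ = T.eulerProduct (λ _ → 1ℤ)

        L : S.Points → ℕ → ℤ
        L = S.eulerProduct χ

        -- The three cases compare Z = 1 / (1 - tᵈ) for the base with the local factors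
        -- 1 / (1 - tᵈ), 1 / (1 - tᵈ)² and 1 / (1 - t²ᵈ) = 1 / (1 - tᵈ)(1 + tᵈ) of the cover.
        local : ∀ x d vs {ws us} c → SplittingType d c (map proj₂ vs) → c ≡ χ x → ζ′ ws ≗ ζ us ⊛ L us →
          ζ′ (vs ++ ws) ≗ ζ ((x , d) ∷ us) ⊛ L ((x , d) ∷ us)
        local x d ((y , .d) ∷ []) {ws} {us} _ ramified e ih =
          expand-unique (T.eulerProduct-∷ _ y d ws) W-expand λ n → ≡.trans (ih n) (≡.sym (U≗V n))
          where
          U = ζ us ⊛ L ((x , d) ∷ us)
          W-expand = ⊛-expandˡ (L ((x , d) ∷ us)) (S.eulerProduct-∷ _ x d us)
          U≗V : U ≗ ζ us ⊛ L us
          U≗V n = ≡.trans (recurrence (⊛-expandʳ (ζ us) (S.eulerProduct-∷ χ x d us)) n)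
            (≡.trans (cong (λ c → (ζ us ⊛ L us) n ℤ.+ c ℤ.* shift (suc d) U n) (≡.sym e)) (ℤ.+-identityʳ _))
        local x d ((y , .d) ∷ (z , .d) ∷ []) {ws} {us} _ split e ih =
          expand-unique (T.eulerProduct-∷ _ y d ((z , d) ∷ ws)) W-expand
            (expand-unique (T.eulerProduct-∷ _ z d ws) U-expand ih)
          where
          W-expand = ⊛-expandˡ (L ((x , d) ∷ us)) (S.eulerProduct-∷ _ x d us)
          U-expand : ζ us ⊛ L ((x , d) ∷ us) ≐ ζ us ⊛ L us /[1- 1ℤ t^1+ d ]
          U-expand = ≡.subst (λ c → ζ us ⊛ L ((x , d) ∷ us) ≐ ζ us ⊛ L us /[1- c t^1+ d ]) (≡.sym e)
            (⊛-expandʳ (ζ us) (S.eulerProduct-∷ χ x d us))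
        local x d ((y , .(d ℕ.+ suc d)) ∷ []) {ws} {us} _ inert e ih =
          expand-unique (T.eulerProduct-∷ _ y (d ℕ.+ suc d) ws)
            (inert-expand W-expand U-expand) ih
          where
          W-expand = ⊛-expandˡ (L ((x , d) ∷ us)) (S.eulerProduct-∷ _ x d us)
          U-expand : ζ us ⊛ L ((x , d) ∷ us) ≐ ζ us ⊛ L us /[1- -1ℤ t^1+ d ]
          U-expand = ≡.subst (λ c → ζ us ⊛ L ((x , d) ∷ us) ≐ ζ us ⊛ L us /[1- c t^1+ d ]) (≡.sym e)
            (⊛-expandʳ (ζ us) (S.eulerProduct-∷ χ x d us))

      weighted : List (Setoid.Carrier S) → S.Points
      weighted = map λ x → x , degree x

      eulerProduct-factor : ∀ xs → T.eulerProduct (λ _ → 1ℤ) (concatMap fibre xs) ≗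
        S.eulerProduct (λ _ → 1ℤ) (weighted xs) ⊛ S.eulerProduct χ (weighted xs)
      eulerProduct-factor []       n = begin
        ζ′ [] n            ≡⟨ one n ⟩
        δ n                ≡⟨ one′ n ⟨
        L [] n             ≡⟨ ⊛-identityˡ (L []) n ⟨
        (δ ⊛ L []) n       ≡⟨ ⊛-congˡ (L []) (λ m → ≡.sym (one″ m)) n ⟩
        (ζ [] ⊛ L []) n    ∎
        where
        open ≡-Reasoning
        one : ζ′ [] ≗ δ
        one zero    = ≡.refl
        one (suc n) = ≡.refl
        one′ : L [] ≗ δ
        one′ zero    = ≡.refl
        one′ (suc n) = ≡.refl
        one″ : ζ [] ≗ δ
        one″ zero    = ≡.refl
        one″ (suc n) = ≡.refl
      eulerProduct-factor (x ∷ xs) = local x (degree x) (fibre x) {us = weighted xs} _ (splitting x) ≡.refl (eulerProduct-factor xs)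

  module _ {S : Setoid a ℓ₁} {deg : Setoid.Carrier S → ℕ → Set b}
    (uniqueS : ∀ {x y d e} → Setoid._≈_ S x y → deg x d → deg y e → d ≡ e) where

    open Cycles S deg uniqueS

    eulerProduct-0 : ∀ f ws → eulerProduct f ws 0 ≡ 1ℤ
    eulerProduct-0 f []             = ≡.refl
    eulerProduct-0 f ((x , d) ∷ ws) = ≡.trans (recurrence (eulerProduct-∷ f x d ws) 0)
      (≡.trans (cong₂ ℤ._+_ (eulerProduct-0 f ws) (ℤ.*-zeroʳ (f x))) (ℤ.+-identityʳ 1ℤ))

    eulerProduct-1 : ∀ f xs → eulerProduct f (map (λ x → x , 0) xs) 1 ≡ foldr ℤ._+_ 0ℤ (map f xs)
    eulerProduct-1 f []       = ≡.refl
    eulerProduct-1 f (x ∷ xs) = ≡.trans (recurrence (eulerProduct-∷ f x 0 (map (λ x → x , 0) xs)) 1)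
      (≡.trans (cong₂ ℤ._+_ (eulerProduct-1 f xs) (≡.trans (cong (λ u → f x ℤ.* u) (eulerProduct-0 f (map (λ x → x , 0) (x ∷ xs)))) (ℤ.*-identityʳ (f x))))
        (ℤ.+-comm _ (f x)))

    module _ {T : Setoid a′ ℓ₂} {deg′ : Setoid.Carrier T → ℕ → Set b′}
      (uniqueT : ∀ {x y d e} → Setoid._≈_ T x y → deg′ x d → deg′ y e → d ≡ e) where

      private module T = Cycles T deg′ uniqueT

      -- Only degrees matter when every point has the value 1. This compares affine points of the
      -- line with irreducible polynomials, which form a different setoid.
      eulerProduct-weights : ∀ us vs → map proj₂ us ≡ map proj₂ vs →
        eulerProduct (λ _ → 1ℤ) us ≗ T.eulerProduct (λ _ → 1ℤ) vs
      eulerProduct-weights []             []             _ zero    = ≡.refl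
      eulerProduct-weights []             []             _ (suc n) = ≡.refl
      eulerProduct-weights ((x , d) ∷ us) ((y , d′) ∷ vs) e with ≡.refl , e′ ← ListProperties.∷-injective e =
        expand-unique (eulerProduct-∷ _ x d us) (T.eulerProduct-∷ _ y d vs) (eulerProduct-weights us vs e′)

open PowerSeries using (_⊛_; SplittingType; ramified; split; inert; module EulerFactorisation; eulerProduct-0; eulerProduct-1; eulerProduct-weights)

-- Ideals, products and maximal ideals.

module IdealProperties {a ℓ} (R : CommutativeRing a ℓ) where

  open CommutativeRing R hiding (zero)
  open Ideals R
  open RawMonoid +-rawMonoid using (sum)
  open RingProperties ring using (-1*x≈-x)
  private
    module S = IntegerCoefficients R

  sum-cong : ∀ {n} {u v : Vector Carrier n} → (∀ i → u i ≈ v i) → sum u ≈ sum v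
  sum-cong {zero}  e = refl
  sum-cong {suc n} e = +-cong (e zero) (sum-cong (λ i → e (suc i)))

  sum-difference : ∀ {n} {u v w : Vector Carrier n} → (∀ i → w i ≈ u i - v i) → sum w ≈ sum u - sum v
  sum-difference {zero}  e = sym (-‿inverseʳ 0#)
  sum-difference {suc n} {u} {v} {w} e = trans (+-cong (e zero) (sum-difference {u = u ∘ suc} {v ∘ suc} (λ i → e (suc i))))
    (S.solve 4 (λ x y s t → (x S.:- y) S.:+ (s S.:- t) S.:= (x S.:+ s) S.:- (y S.:+ t)) refl (u zero) (v zero) (sum (u ∘ suc)) (sum (v ∘ suc)))

  module IsIdealProperties {I : Pred Carrier (a ⊔ ℓ)} (isIdeal : IsIdeal I) where

    open IsIdeal isIdeal public

    -∈ : ∀ {x} → x ∈ I → - x ∈ I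
    -∈ x∈I = resp (-1*x≈-x _) (*∈ (- 1#) x∈I)

    *∈ʳ : ∀ {x} r → x ∈ I → x * r ∈ I
    *∈ʳ r x∈I = resp (*-comm _ _) (*∈ r x∈I)

    sum∈ : ∀ {n} {u : Vector Carrier n} → (∀ i → u i ∈ I) → sum u ∈ I
    sum∈ {zero}  u∈ = 0∈
    sum∈ {suc n} u∈ = +∈ (u∈ zero) (sum∈ (λ i → u∈ (suc i)))

    difference∈ : ∀ {x y z} → x - y ≈ z → x ∈ I → z ∈ I → y ∈ I
    difference∈ {x} {y} {z} e x∈ z∈ = resp
      (trans (+-congˡ (-‿cong (sym e))) (S.solve 2 (λ x y → x S.:- (x S.:- y) S.:= y) refl x y))
      (+∈ x∈ (-∈ z∈))

  multiples : Carrier → Pred Carrier (a ⊔ ℓ)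
  multiples w x = ∃[ m ] x ≈ m * w

  multiples-isIdeal : ∀ w → IsIdeal (multiples w)
  multiples-isIdeal w = record
    { resp = λ { e (m , f) → m , trans (sym e) f }
    ; 0∈   = 0# , sym (zeroˡ w)
    ; +∈   = λ { (m , e) (n , f) → m + n , trans (+-cong e f) (sym (distribʳ w m n)) }
    ; *∈   = λ { r (m , e) → r * m , trans (*-congˡ e) (sym (*-assoc r m w)) } }

  generator∈ : ∀ w → w ∈ multiples w
  generator∈ w = 1# , sym (*-identityˡ w)

  multiples-⊆ : ∀ {I w} → IsIdeal I → w ∈ I → multiples w ⊆ I
  multiples-⊆ isIdeal w∈I (m , e) = IsIdeal.resp isIdeal (sym e) (IsIdeal.*∈ isIdeal m w∈I)

  module MaximalIdealProperties (P : MaximalIdeal) where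

    open MaximalIdeal P using () renaming (ideal to I)
    open IsIdealProperties (MaximalIdeal.isIdeal P) public
    open MaximalIdeal P public using (proper; maximal) renaming (isIdeal to isIdeal′)

    unit∉ : ∀ {x} y → 1# - y * x ∈ I → x ∉ I
    unit∉ {x} y inv x∈ = proper (resp (S.solve 2 (λ x y → (S.con (+ 1) S.:- y S.:* x) S.:+ y S.:* x S.:= S.con (+ 1)) refl x y)
      (+∈ inv (*∈ y x∈)))

    ∈? : ∀ x → Dec (x ∈ I)
    ∈? x with maximal x
    ... | inj₁ x∈       = yes x∈
    ... | inj₂ (y , inv) = no (unit∉ y inv)

    -- Maximality decides whether `x` lies in the ideal; if not, it supplies an inverse `z`, and y =
    -- z (x y) + (1 - z x) y.
    prime : ∀ {x y} → x * y ∈ I → x ∈ I ⊎ y ∈ I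
    prime {x} {y} xy∈ with maximal x
    ... | inj₁ x∈       = inj₁ x∈
    ... | inj₂ (z , inv) = inj₂ (resp
      (S.solve 3 (λ x y z → z S.:* (x S.:* y) S.:+ (S.con (+ 1) S.:- z S.:* x) S.:* y S.:= y) refl x y z)
      (+∈ (*∈ z xy∈) (*∈ʳ y inv)))

  -- An element outside `P` is invertible modulo `P`, hence modulo `Q`, and so cannot lie in `Q`.
  maximal-⊆⇒≐ : ∀ (P Q : MaximalIdeal) → ideal P ⊆ ideal Q → ideal P ≐ ideal Q
  maximal-⊆⇒≐ P Q P⊆Q = P⊆Q , λ {x} x∈Q → help x x∈Q (MaximalIdeal.maximal P x)
    where
    help : ∀ x → x ∈ ideal Q → x ∈ ideal P ⊎ (∃[ y ] 1# - y * x ∈ ideal P) → x ∈ ideal P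
    help x x∈Q (inj₁ x∈P)       = x∈P
    help x x∈Q (inj₂ (y , inv)) = ⊥-elim (MaximalIdealProperties.unit∉ Q y (P⊆Q inv) x∈Q)

  ·-mono : ∀ {ℓ₁ ℓ₂ ℓ₃ ℓ₄} {I : Pred Carrier ℓ₁} {J : Pred Carrier ℓ₂} {I′ : Pred Carrier ℓ₃} {J′ : Pred Carrier ℓ₄} →
    I ⊆ I′ → J ⊆ J′ → I · J ⊆ I′ · J′
  ·-mono f g (m , u , v , u∈ , v∈ , e) = m , u , v , (λ i → f {u i} (u∈ i)) , (λ i → g {v i} (v∈ i)) , e

  ^-mono : ∀ {I J} n → I ⊆ J → I ^ n ⊆ J ^ n
  ^-mono zero    f _ = tt
  ^-mono {I} {J} (suc n) f = ·-mono {I = I} {I ^ n} {J} {J ^ n} f (^-mono n f)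

  ·-⊆ : ∀ {ℓ₁ ℓ₂} {I : Pred Carrier ℓ₁} {J : Pred Carrier ℓ₂} {K} → IsIdeal K →
    (∀ {x y} → x ∈ I → y ∈ J → x * y ∈ K) → I · J ⊆ K
  ·-⊆ isIdeal f (m , u , v , u∈ , v∈ , e) = IsIdeal.resp isIdeal (sym e)
    (IsIdealProperties.sum∈ isIdeal {u = λ i → u i * v i} λ i → f {u i} {v i} (u∈ i) (v∈ i))

  ^1-⊆ : ∀ {I} → IsIdeal I → I ^ 1 ⊆ I
  ^1-⊆ isIdeal = ·-⊆ isIdeal λ {_} {y} x∈I _ → IsIdealProperties.*∈ʳ isIdeal y x∈I

  ⊆-^1 : ∀ {I} → I ⊆ I ^ 1
  ⊆-^1 {I} {x} x∈I = 1 , (λ _ → x) , (λ _ → 1#) , (λ _ → x∈I) , (λ _ → tt) ,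
    sym (trans (+-identityʳ _) (*-identityʳ x))

-- Residue degrees over a finite field.

module ResidueDegreeProperties {a b ℓ₁ ℓ₂} (A : CommutativeRing a ℓ₁) (B : CommutativeRing b ℓ₂)
  (φ : CommutativeRing.Carrier A → CommutativeRing.Carrier B) where

  private
    module B = CommutativeRing B
  open Ideals B
  open IdealProperties B

  ResidueDegree-resp : ∀ {P Q n} → ideal P ≐ ideal Q → ResidueDegree A B φ P n → ResidueDegree A B φ Q n
  ResidueDegree-resp (P⊆Q , Q⊆P) D = record
    { basis = basis
    ; spanning = λ y → proj₁ (spanning y) , P⊆Q (proj₂ (spanning y))
    ; independent = λ c s i → P⊆Q (independent c (Q⊆P s) i) }
    where open ResidueDegree D

  RamificationExponent-resp : ∀ {P Q e} → ideal P ≐ ideal Q →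
    RamificationExponent A B φ P e → RamificationExponent A B φ Q e
  RamificationExponent-resp {e = e} (P⊆Q , Q⊆P) (p , ¬p) =
    (λ x φx∈Q → ^-mono e P⊆Q (p x (Q⊆P φx∈Q))) ,
    (λ q → ¬p λ x φx∈P → ^-mono (suc e) Q⊆P (q x (P⊆Q φx∈P)))

  -- An empty basis can span 1 only if 1 lies in `P`.
  ResidueDegree-positive : ∀ {P} → ¬ ResidueDegree A B φ P 0
  ResidueDegree-positive {P} D = MaximalIdeal.proper P
    (MaximalIdeal.resp P (B.trans (B.+-congˡ -0#≈0#) (B.+-identityʳ B.1#)) (proj₂ (ResidueDegree.spanning D B.1#)))
    where open RingProperties B.ring using (-0#≈0#)

module FiniteResidueDegree {a b ℓ₁ ℓ₂} (k : FiniteField a ℓ₁) (B : CommutativeRing b ℓ₂)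
  (φ : FiniteField.Carrier k → CommutativeRing.Carrier B)
  (φ-hom : RingMorphisms.IsRingHomomorphism (FiniteField.rawRing k) (CommutativeRing.rawRing B) φ) where

  private
    module k = FiniteField k
    module B = CommutativeRing B
    module φ = RingMorphisms.IsRingHomomorphism φ-hom
    module R = SetoidReasoning B.setoid
    module S = IntegerCoefficients B
  open Ideals B
  open IdealProperties B
  open ResidueDegreeProperties k.commutativeRing B φ
  open RawMonoid B.+-rawMonoid using (sum)
  open RingProperties k.ring using (x∙y⁻¹≈ε⇒x≈y)

  φ∈⇒≈0 : ∀ P {x} → φ x ∈ ideal P → x k.≈ k.0#
  φ∈⇒≈0 P {x} φx∈ with finite⇒decidable k.finite x k.0#
  ... | yes x≈0 = x≈0
  ... | no x≉0 with k.inverse x x≉0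
  ... | u , xu≈1 = ⊥-elim (proper (resp (B.trans (B.sym (φ.*-homo x u)) (B.trans (φ.⟦⟧-cong xu≈1) φ.1#-homo)) (*∈ʳ (φ u) φx∈)))
    where open MaximalIdealProperties P

  private
    toVector : ∀ {n} → Fin (k.order ℕ.^ n) → Vector k.Carrier n
    toVector i j = Bijection.to (proj₂ k.finite) (finToFun i j)

    toVector-injective : ∀ {n} {i j : Fin (k.order ℕ.^ n)} → (∀ l → toVector {n} i l k.≈ toVector {n} j l) → i ≡ j
    toVector-injective {n} {i} {j} e = ≡.trans (≡.sym (funToFin-finToFin {n} i)) (≡.trans
      (funToFin-cong {f = finToFun {k.order} {n} i} {finToFun {k.order} {n} j} λ l → Bijection.injective (proj₂ k.finite) (e l)) (funToFin-finToFin {n} j))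
      where
      funToFin-cong : ∀ {m n} {f g : Fin m → Fin n} → (∀ i → f i ≡ g i) → funToFin f ≡ funToFin g
      funToFin-cong {zero}  e = ≡.refl
      funToFin-cong {suc m} e = ≡.cong₂ combine (e zero) (funToFin-cong (λ i → e (suc i)))

    fromVector : ∀ {n} → Vector k.Carrier n → Fin (k.order ℕ.^ n)
    fromVector v = funToFin λ i → index k.finite (v i)

    fromVector-injective : ∀ {n} {u v : Vector k.Carrier n} → fromVector u ≡ fromVector v → ∀ i → u i k.≈ v i
    fromVector-injective {n} {u} {v} e i = index-injective k.finite (≡.trans (≡.sym (finToFun-funToFin _ i))
      (≡.trans (≡.cong (λ w → finToFun {k.order} {n} w i) e) (finToFun-funToFin _ i)))

    -- Invariance of dimension by counting in place of linear algebra: coordinates with respect to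
    -- the second basis embed kᵐ into kⁿ, so qᵐ ≤ qⁿ, and q is at least 2.
    order-^-≤ : ∀ P {m n} → ResidueDegree k.commutativeRing B φ P m → ResidueDegree k.commutativeRing B φ P n →
      k.order ℕ.^ m ℕ.≤ k.order ℕ.^ n
    order-^-≤ P {m} {n} D E = injective⇒≤ {f = λ i → fromVector (f (toVector {m} i))}
      λ {i} {j} e → toVector-injective {m} (f-injective (toVector {m} i) (toVector {m} j) (fromVector-injective e))
      where
      module D = ResidueDegree D
      module E = ResidueDegree E
      open MaximalIdealProperties P
      combination : ∀ {n} → Vector B.Carrier n → Vector k.Carrier n → B.Carrier
      combination b c = sum (λ i → φ (c i) B.* b i)
      f : Vector k.Carrier m → Vector k.Carrier n
      f c = proj₁ (E.spanning (combination D.basis c))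
      f-injective : ∀ c c′ → (∀ i → f c i k.≈ f c′ i) → ∀ i → c i k.≈ c′ i
      f-injective c c′ e i = x∙y⁻¹≈ε⇒x≈y _ _ (φ∈⇒≈0 P (D.independent (λ i → c i k.- c′ i) sum-∈ i))
        where
        y  = combination D.basis c
        y′ = combination D.basis c′
        z  = combination E.basis (f c)
        z′ = combination E.basis (f c′)
        y-y′∈ : y B.- y′ ∈ ideal P
        y-y′∈ = resp (R.begin
          (y B.- z) B.+ B.- (y′ B.- z′)  R.≈⟨ B.+-congˡ (B.-‿cong (B.+-congˡ (B.-‿cong (sum-cong (λ i → B.*-congʳ (φ.⟦⟧-cong (k.sym (e i)))))))) ⟩
          (y B.- z) B.+ B.- (y′ B.- z)   R.≈⟨ S.solve 3 (λ y y′ z → (y S.:- z) S.:+ S.:- (y′ S.:- z) S.:= y S.:- y′) B.refl y y′ z ⟩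
          y B.- y′                       R.∎)
          (+∈ (proj₂ (E.spanning y)) (-∈ (proj₂ (E.spanning y′))))
        sum-∈ : combination D.basis (λ i → c i k.- c′ i) ∈ ideal P
        sum-∈ = resp (B.sym (sum-difference {w = λ i → φ (c i k.- c′ i) B.* D.basis i} (λ i → B.trans
          (B.*-congʳ (B.trans (φ.+-homo (c i) (k.- c′ i)) (B.+-congˡ (φ.-‿homo (c′ i)))))
          (S.solve 3 (λ u v b → (u S.:- v) S.:* b S.:= u S.:* b S.:- v S.:* b) B.refl (φ (c i)) (φ (c′ i)) (D.basis i))))) y-y′∈

    2≤order : 2 ℕ.≤ k.order
    2≤order = atLeast2 (index k.finite k.0#) (index k.finite k.1#) λ e → k.1≉0 (k.sym (index-injective k.finite e))
      where
      atLeast2 : ∀ {n} (i j : Fin n) → ¬ i ≡ j → 2 ℕ.≤ n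
      atLeast2 {suc (suc n)} i j _ = s≤s (s≤s z≤n)
      atLeast2 {suc zero} zero zero i≢j = ⊥-elim (i≢j ≡.refl)

    dimension-≤ : ∀ P {m n} → ResidueDegree k.commutativeRing B φ P m → ResidueDegree k.commutativeRing B φ P n → m ℕ.≤ n
    dimension-≤ P {m} {n} D E with m ℕ.≤? n
    ... | yes m≤n = m≤n
    ... | no m≰n  = ⊥-elim (ℕ.<⇒≱ (ℕ.^-monoʳ-< k.order 2≤order (ℕ.≰⇒> m≰n)) (order-^-≤ P D E))

  ResidueDegree-unique : ∀ {P Q m n} → ideal P ≐ ideal Q →
    ResidueDegree k.commutativeRing B φ P m → ResidueDegree k.commutativeRing B φ Q n → m ≡ n
  ResidueDegree-unique {P} {Q} P≐Q D E = ℕ.≤-antisym (dimension-≤ Q D′ E) (dimension-≤ Q E D′)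
    where D′ = ResidueDegree-resp {P} {Q} P≐Q D

  -- The residue field is k. If β is the basis element, 1 ≡ u β and f ≡ v β, then f ≡ v / u; here u
  -- ≠ 0, as otherwise 1 would lie in `P`.
  value : ∀ P → ResidueDegree k.commutativeRing B φ P 1 → ∀ f → ∃[ x ] f B.- φ x ∈ ideal P
  value P D f = go (finite⇒decidable k.finite u k.0#)
    where
    module D = ResidueDegree D
    open MaximalIdealProperties P
    β : B.Carrier
    β = D.basis zero
    u v : k.Carrier
    u = proj₁ (D.spanning B.1#) zero
    v = proj₁ (D.spanning f) zero
    go : Dec (u k.≈ k.0#) → ∃[ x ] f B.- φ x ∈ ideal P
    go (yes u≈0) = ⊥-elim (proper (resp (B.trans (B.+-congˡ (B.-‿cong (B.+-congʳ (B.*-congʳ (B.trans (φ.⟦⟧-cong u≈0) φ.0#-homo)))))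
      (S.solve 1 (λ b → S.con (+ 1) S.:- (S.con (+ 0) S.:* b S.:+ S.con (+ 0)) S.:= S.con (+ 1)) B.refl β)) (proj₂ (D.spanning B.1#))))
    go (no u≉0) with k.inverse u u≉0
    ... | w , uw≈1 = v k.* w , resp (R.begin
      (f B.- (φ v B.* β B.+ B.0#)) B.- φ (v k.* w) B.* (B.1# B.- (φ u B.* β B.+ B.0#))
        R.≈⟨ B.+-congˡ (B.-‿cong (B.*-congʳ (φ.*-homo v w))) ⟩
      (f B.- (φ v B.* β B.+ B.0#)) B.- φ v B.* φ w B.* (B.1# B.- (φ u B.* β B.+ B.0#))
        R.≈⟨ S.solve 5 (λ f v b w u → (f S.:- (v S.:* b S.:+ S.con (+ 0))) S.:- v S.:* w S.:* (S.con (+ 1) S.:- (u S.:* b S.:+ S.con (+ 0))) S.:=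
              (f S.:- v S.:* w) S.:+ v S.:* b S.:* (u S.:* w S.:- S.con (+ 1))) B.refl f (φ v) β (φ w) (φ u) ⟩
      (f B.- φ v B.* φ w) B.+ φ v B.* β B.* (φ u B.* φ w B.- B.1#)
        R.≈⟨ B.+-congˡ (B.*-congˡ (B.+-congʳ (B.trans (B.sym (φ.*-homo u w)) (B.trans (φ.⟦⟧-cong uw≈1) φ.1#-homo)))) ⟩
      (f B.- φ v B.* φ w) B.+ φ v B.* β B.* (B.1# B.- B.1#)
        R.≈⟨ S.solve 4 (λ f v b w → (f S.:- v S.:* w) S.:+ v S.:* b S.:* (S.con (+ 1) S.:- S.con (+ 1)) S.:= f S.:- v S.:* w) B.refl f (φ v) β (φ w) ⟩
      f B.- φ v B.* φ w
        R.≈⟨ B.+-congˡ (B.-‿cong (φ.*-homo v w)) ⟨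
      f B.- φ (v k.* w) R.∎)
      (+∈ (proj₂ (D.spanning f)) (-∈ (*∈ (φ (v k.* w)) (proj₂ (D.spanning B.1#)))))

-- Monic irreducible polynomials over a finite field.

module FieldPolynomials {c ℓ} (k : FiniteField c ℓ) where

  open FiniteField k hiding (zero)
  open Polynomial commutativeRing renaming (commutativeRing to k[x])
  open PolynomialProperties commutativeRing
  open IdealProperties k[x]
  open Ideals k[x] using (MaximalIdeal; IsIdeal; ideal)
  private
    module Sₚ = IntegerCoefficients k[x]
    module P = SetoidReasoning setoidₚ

  infix 4 _≟_
  _≟_ : Decidable _≈_
  _≟_ = finite⇒decidable finite

  zero? : ∀ p → Dec (p ≈ₚ [])
  zero? []      = yes reflₚ
  zero? (a ∷ p) with a ≟ 0# | zero? p
  ... | yes a≈0 | yes p≈0 = yes (transₚ (∷-cong a≈0 p≈0) 0∷[]≈[])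
  ... | no a≉0  | _       = no λ e → a≉0 (at e 0)
  ... | _       | no p≉0  = no λ e → p≉0 (mk≈ₚ λ n → at e (suc n))

  lead : ∀ p → p ≈ₚ [] ⊎ ∃[ d ] ∃[ a ] (¬ a ≈ 0#) × Leading d a p
  lead []      = inj₁ reflₚ
  lead (a ∷ p) with lead p
  ... | inj₂ (d , b , b≉0 , l , below) = inj₂ (suc d , b , b≉0 , l , λ { (s≤s d<i) → below d<i })
  ... | inj₁ p≈0 with a ≟ 0#
  ... | yes a≈0 = inj₁ (transₚ (∷-cong a≈0 p≈0) 0∷[]≈[])
  ... | no a≉0  = inj₂ (0 , a , a≉0 , refl , λ { (s≤s _) → at p≈0 _ })

  Leading-unique : ∀ {d e a b p} → ¬ a ≈ 0# → ¬ b ≈ 0# → Leading d a p → Leading e b p → d ≡ e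
  Leading-unique {d} {e} a≉0 b≉0 (l , below) (l′ , below′) with ℕ.<-cmp d e
  ... | tri< d<e _ _ = contradiction (trans (sym l′) (below d<e)) b≉0
  ... | tri≈ _ d≡e _ = d≡e
  ... | tri> _ _ e<d = contradiction (trans (sym l) (below′ e<d)) a≉0

  Leading-scale : ∀ {d a p} u → Leading d a p → Leading d (u * a) (scale u p)
  Leading-scale {p = p} u (l , below) =
    trans (coeff-scale u p _) (*-congˡ l) , λ d<i → trans (coeff-scale u p _) (trans (*-congˡ (below d<i)) (zeroʳ u))

  scale-const : ∀ a p → const a *ₚ p ≈ₚ scale a p
  scale-const a p = transₚ (+ₚ-cong (reflₚ {scale a p}) 0∷[]≈[]) (+ₚ-identityʳ _)

  make-monic : ∀ {d a p} → ¬ a ≈ 0# → Leading d a p → ∃[ u ] a * u ≈ 1# × Monic d (const u *ₚ p)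
  make-monic {p = p} a≉0 l with inverse _ a≉0
  ... | u , au≈1 with Leading-scale {p = p} u l
  ... | l′ , below = u , au≈1 , Leading-resp {p = scale u p} (symₚ (scale-const u p)) (trans l′ (trans (*-comm _ _) au≈1) , below)

  Monic-1 : Monic 0 (const 1#)
  Monic-1 = refl , λ { (s≤s _) → refl }

  Monic⇒≉0 : ∀ {d p} → Monic d p → ¬ p ≈ₚ []
  Monic⇒≉0 (l , _) p≈0 = 1≉0 (trans (sym l) (at p≈0 _))

  Monic-unique : ∀ {d e p q} → p ≈ₚ q → Monic d p → Monic e q → d ≡ e
  Monic-unique {p = p} {q} p≈q m m′ = Leading-unique {p = q} 1≉0 1≉0 (Leading-resp {p = p} p≈q m) m′

  -- Leading coefficients multiply and two of the three are 1, so the cofactor is monic of the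
  -- complementary degree.
  Monic-quotient : ∀ {d e m p s} → Monic d m → Monic e p → p ≈ₚ s *ₚ m → ∃[ f ] Monic f s × f ℕ.+ d ≡ e
  Monic-quotient {m = m} {p} {s} mon mon′ p≈ with lead s
  ... | inj₁ s≈0 = contradiction (transₚ p≈ (*ₚ-cong s≈0 (reflₚ {m}))) (Monic⇒≉0 mon′)
  ... | inj₂ (f , a , a≉0 , l) with Leading-resp (symₚ p≈) (Leading-* s l mon)
  ... | l′ with Leading-unique {p = p} (λ a1≈0 → a≉0 (trans (sym (*-identityʳ a)) a1≈0)) 1≉0 l′ mon′
  ... | ≡.refl = f , (trans (proj₁ l) (trans (sym (*-identityʳ a)) (trans (sym (proj₁ l′)) (proj₁ mon′))) , proj₂ l) , ≡.refl

  open SetoidMembership setoidₚ using () renaming (_∈_ to _∈ₗ_)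

  monics : ℕ → List Poly
  monics zero    = const 1# ∷ []
  monics (suc d) = cartesianProductWith _∷_ (elements finite) (monics d)

  monics-Monic : ∀ d {p} → p ∈ₗ monics d → Monic d p
  monics-Monic zero (here e) = Leading-resp (symₚ e) Monic-1
  monics-Monic (suc d) p∈ with Membership.∈-cartesianProductWith⁻ setoid setoidₚ setoidₚ _∷_ (elements finite) (monics d) p∈
  ... | a , q , _ , q∈ , e = Leading-resp (symₚ e) (proj₁ mon , λ { (s≤s d<i) → proj₂ mon d<i })
    where mon = monics-Monic d q∈

  monics-complete : ∀ d {p} → Monic d p → p ∈ₗ monics d
  monics-complete zero mon = here (Leading-0 mon)
  monics-complete (suc d) {[]} (l , _) = contradiction (sym l) 1≉0
  monics-complete (suc d) {a ∷ p} (l , below) = Membership.∈-cartesianProductWith⁺ setoid setoidₚ setoidₚ ∷-cong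
    (∈-elements finite a) (monics-complete d (l , λ d<i → below (s≤s d<i)))

  monics-unique : ∀ d → Unique setoidₚ (monics d)
  monics-unique zero    = [] ∷ []
  monics-unique (suc d) = Unique.cartesianProductWith⁺ setoid setoidₚ setoidₚ _∷_
    (λ e → at e 0 , mk≈ₚ λ n → at e (suc n)) (elements-unique finite) (monics-unique d)

  length-monics : ∀ d → length (monics d) ≡ order ℕ.^ d
  length-monics zero    = ≡.refl
  length-monics (suc d) = ≡.trans (go (elements finite))
    (≡.cong₂ ℕ._*_ (ListProperties.length-tabulate (Bijection.to (proj₂ finite))) (length-monics d))
    where
    go : ∀ (xs : List Carrier) → length (cartesianProductWith {C = Poly} _∷_ xs (monics d)) ≡ length xs ℕ.* length (monics d)
    go []       = ≡.refl
    go (x ∷ xs) = ≡.trans (ListProperties.length-++ (map (x ∷_) (monics d)))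
      (≡.cong₂ ℕ._+_ (ListProperties.length-map (x ∷_) (monics d)) (go xs))

  -- The monic polynomials of a given degree form a finite list. Irreducibility, elements of least
  -- degree in an ideal and roots modulo p are all decided by this search.
  search : ∀ {q} d {Q : Pred Poly q} → Q Respects _≈ₚ_ → (∀ {m} → Monic d m → Dec (Q m)) →
    (∃[ m ] Monic d m × Q m) ⊎ (∀ {m} → Monic d m → ¬ Q m)
  search d {Q} resp Q? = done (go (monics d) (All.tabulateₛ setoidₚ (monics-Monic d)))
    where
    go : ∀ xs → All (Monic d) xs → (∃[ m ] Monic d m × Q m) ⊎ All (λ m → ¬ Q m) xs
    go []       []           = inj₂ []
    go (x ∷ xs) (mon ∷ mons) with Q? mon
    ... | yes q = inj₁ (x , mon , q)
    ... | no ¬q with go xs mons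
    ... | inj₁ found = inj₁ found
    ... | inj₂ ¬qs   = inj₂ (¬q ∷ ¬qs)
    done : (∃[ m ] Monic d m × Q m) ⊎ All (λ m → ¬ Q m) (monics d) →
      (∃[ m ] Monic d m × Q m) ⊎ (∀ {m} → Monic d m → ¬ Q m)
    done (inj₁ found) = inj₁ found
    done (inj₂ ¬qs)   = inj₂ λ mon q → All.All¬⇒¬Any ¬qs (Any.map (λ e → resp e q) (monics-complete d mon))

  multiple? : ∀ {d m} → Monic d m → ∀ f → Dec (f ∈ multiples m)
  multiple? {m = m} mon f with divide mon f
  ... | s , r , f≈ , below with zero? r
  ... | yes r≈0 = yes (s , transₚ f≈ (transₚ (+ₚ-cong (reflₚ {s *ₚ m}) r≈0) (+ₚ-identityʳ _)))
  ... | no r≉0  = no λ { (t , f≈t) → r≉0 (transₚ (r≈ t f≈t)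
      (*ₚ-cong (multiple-Below mon (t +ₚ -ₚ s) (Below-resp (r≈ t f≈t) below)) (reflₚ {m}))) }
    where
    r≈ : ∀ t → f ≈ₚ t *ₚ m → r ≈ₚ (t +ₚ -ₚ s) *ₚ m
    r≈ t f≈t = P.begin
      r                              P.≈⟨ Sₚ.solve 2 (λ x y → y Sₚ.:= (x Sₚ.:+ y) Sₚ.:- x) reflₚ (s *ₚ m) r ⟩
      (s *ₚ m +ₚ r) +ₚ -ₚ (s *ₚ m)   P.≈⟨ +ₚ-cong (transₚ (symₚ f≈) f≈t) (reflₚ { -ₚ (s *ₚ m)}) ⟩
      t *ₚ m +ₚ -ₚ (s *ₚ m)          P.≈⟨ Sₚ.solve 3 (λ t s m → t Sₚ.:* m Sₚ.:- s Sₚ.:* m Sₚ.:= (t Sₚ.:- s) Sₚ.:* m) reflₚ t s m ⟩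
      (t +ₚ -ₚ s) *ₚ m P.∎

  -- The degree is stored minus one, so that it is positive by construction and fits the entries (x
  -- , d) of lists of points. A monic divisor of degree 1 + e with `e ℕ.< deg-1` is a proper one.
  record Prime : Set (c ⊔ ℓ) where
    field
      deg-1       : ℕ
      poly        : Poly
      monic       : Monic (suc deg-1) poly
      irreducible : ∀ {e m} → Monic (suc e) m → e ℕ.< deg-1 → poly ∉ multiples m

  linear : Carrier → Prime
  linear a = record { deg-1 = 0 ; poly = X- a ; monic = Monic-X- a ; irreducible = λ _ () }

  X-prime : Prime
  X-prime = record { deg-1 = 0 ; poly = X ; monic = refl , λ { (s≤s (s≤s z≤n)) → refl } ; irreducible = λ _ () }

  multiples-resp : ∀ {f} → (λ m → f ∈ multiples m) Respects _≈ₚ_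
  multiples-resp e (s , f≈) = s , transₚ f≈ (*ₚ-cong (reflₚ {s}) e)

  -- The negative answer is a proper monic divisor and not a mere refutation, because factorisation
  -- has to continue with it.
  irreducible? : ∀ {d p} → Monic (suc d) p →
    (∀ {e m} → Monic (suc e) m → e ℕ.< d → p ∉ multiples m) ⊎
    (∃[ e ] ∃[ m ] Monic (suc e) m × e ℕ.< d × p ∈ multiples m)
  irreducible? {d} {p} mon = go d ℕ.≤-refl
    where
    go : ∀ n → n ℕ.≤ d → (∀ {e m} → Monic (suc e) m → e ℕ.< n → p ∉ multiples m) ⊎
      (∃[ e ] ∃[ m ] Monic (suc e) m × e ℕ.< d × p ∈ multiples m)
    go zero    _   = inj₁ λ _ ()
    go (suc n) n<d with go n (ℕ.<⇒≤ n<d)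
    ... | inj₂ found = inj₂ found
    ... | inj₁ none with search (suc n) multiples-resp (λ m → multiple? m p)
    ... | inj₁ (m , mon′ , p∈) = inj₂ (n , m , mon′ , n<d , p∈)
    ... | inj₂ none′ = inj₁ λ {e} mon′ e<1+n p∈ → case e mon′ e<1+n p∈
      where
      case : ∀ e {m} → Monic (suc e) m → e ℕ.< suc n → p ∉ multiples m
      case e mon′ (s≤s e≤n) with ℕ.m≤n⇒m<n∨m≡n e≤n
      ... | inj₁ e<n    = none mon′ e<n
      ... | inj₂ ≡.refl = none′ mon′

  module _ (𝔭 : Prime) where

    open Prime 𝔭 renaming (poly to p; deg-1 to d)
    open IsIdealProperties (multiples-isIdeal p)

    private
      -- Dividing p by r gives a remainder smaller than r, inverse to r up to a factor.
      inverse-below : ∀ N {e a r} → e ℕ.< N → e ℕ.≤ d → ¬ a ≈ 0# → Leading e a r →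
        ∃[ u ] const 1# +ₚ -ₚ (u *ₚ r) ∈ multiples p
      inverse-below (suc N) {zero} {a} {r} _ _ a≉0 l with inverse a a≉0
      ... | u , au≈1 = const u , [] , (P.begin
        const 1# +ₚ -ₚ (const u *ₚ r)            P.≈⟨ +ₚ-cong (reflₚ {const 1#}) (-ₚ-cong (*ₚ-cong (reflₚ {const u}) (Leading-0 {p = r} l))) ⟩
        const 1# +ₚ -ₚ (const u *ₚ const a)      P.≈⟨ +ₚ-cong (reflₚ {const 1#}) (-ₚ-cong (∷-cong (trans (+-identityʳ _) (trans (*-comm u a) au≈1)) (reflₚ {[]}))) ⟩
        const 1# +ₚ -ₚ (const 1#)                P.≈⟨ +ₚ-inverseʳ (const 1#) ⟩
        [] P.∎)
      inverse-below (suc N) {suc e} {a} {r} (s≤s e<N) e<d a≉0 l with make-monic {p = r} a≉0 l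
      ... | v , _ , mon with divide mon p
      ... | s , r′ , p≈ , below with lead r′
      ... | inj₁ r′≈0 = contradiction (s , transₚ p≈ (transₚ (+ₚ-cong (reflₚ {s *ₚ (const v *ₚ r)}) r′≈0) (+ₚ-identityʳ _)))
        (irreducible mon e<d)
      -- The remainder is r′ = p - s (v r), so an inverse u′ of r′ modulo p yields the inverse - u′
      -- s v of r.
      ... | inj₂ (e′ , a′ , a′≉0 , l′) = -ₚ (u′ *ₚ s *ₚ const v) , resp (symₚ (P.begin
          const 1# +ₚ -ₚ (-ₚ (u′ *ₚ s *ₚ const v) *ₚ r)
            P.≈⟨ Sₚ.solve 5 (λ u s v r r′ → Sₚ.con (+ 1) Sₚ.:- (Sₚ.:- (u Sₚ.:* s Sₚ.:* v) Sₚ.:* r) Sₚ.:=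
                (Sₚ.con (+ 1) Sₚ.:- u Sₚ.:* r′) Sₚ.:+ u Sₚ.:* (s Sₚ.:* (v Sₚ.:* r) Sₚ.:+ r′)) reflₚ u′ s (const v) r r′ ⟩
          (const 1# +ₚ -ₚ (u′ *ₚ r′)) +ₚ u′ *ₚ (s *ₚ (const v *ₚ r) +ₚ r′)
            P.≈⟨ +ₚ-cong (reflₚ {const 1# +ₚ -ₚ (u′ *ₚ r′)}) (*ₚ-cong (reflₚ {u′}) (symₚ p≈)) ⟩
          (const 1# +ₚ -ₚ (u′ *ₚ r′)) +ₚ u′ *ₚ p P.∎))
          (+∈ (proj₂ ih) (u′ , reflₚ))
        where
        e′≤e : e′ ℕ.≤ e
        e′≤e with e′ ℕ.≤? e
        ... | yes e′≤e = e′≤e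
        ... | no e′≰e  = contradiction (trans (sym (proj₁ l′)) (below (ℕ.≰⇒> e′≰e))) a′≉0
        ih = inverse-below N (ℕ.≤-trans (s≤s e′≤e) e<N) (ℕ.≤-trans e′≤e (ℕ.<⇒≤ e<d)) a′≉0 l′
        u′ = proj₁ ih

    ⟨_⟩ : MaximalIdeal
    ⟨_⟩ = record
      { ideal   = multiples p
      ; isIdeal = multiples-isIdeal p
      ; proper  = λ { (s , 1≈) → case s (Monic-quotient {s = s} monic Monic-1 1≈) }
      ; maximal = maximal }
      where
      case : ∀ s → ¬ (∃[ f ] Monic f s × f ℕ.+ suc d ≡ 0)
      case s (f , _ , e) with () ← ≡.trans (≡.sym (ℕ.+-suc f d)) e
      maximal : ∀ f → f ∈ multiples p ⊎ (∃[ u ] const 1# +ₚ -ₚ (u *ₚ f) ∈ multiples p)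
      maximal f with divide monic f
      ... | s , r , f≈ , below with lead r
      ... | inj₁ r≈0 = inj₁ (s , transₚ f≈ (transₚ (+ₚ-cong (reflₚ {s *ₚ p}) r≈0) (+ₚ-identityʳ _)))
      ... | inj₂ (e , a , a≉0 , l) with inverse-below (suc d) (e<1+d e l a≉0) (ℕ.≤-pred (e<1+d e l a≉0)) a≉0 l
        where
        e<1+d : ∀ e {a} → Leading e a r → ¬ a ≈ 0# → e ℕ.< suc d
        e<1+d e l a≉0 with suc e ℕ.≤? suc d
        ... | yes e<1+d = e<1+d
        ... | no e≮1+d  = contradiction (trans (sym (proj₁ l)) (below (ℕ.≤-pred (ℕ.≰⇒> e≮1+d)))) a≉0
      ... | u , inv = inj₂ (u , resp (symₚ (P.begin
        const 1# +ₚ -ₚ (u *ₚ f)                          P.≈⟨ +ₚ-cong (reflₚ {const 1#}) (-ₚ-cong (*ₚ-cong (reflₚ {u}) f≈)) ⟩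
        const 1# +ₚ -ₚ (u *ₚ (s *ₚ p +ₚ r))              P.≈⟨ Sₚ.solve 4 (λ u s p r → Sₚ.con (+ 1) Sₚ.:- u Sₚ.:* (s Sₚ.:* p Sₚ.:+ r) Sₚ.:= (Sₚ.con (+ 1) Sₚ.:- u Sₚ.:* r) Sₚ.:+ (Sₚ.:- (u Sₚ.:* s)) Sₚ.:* p) reflₚ u s p r ⟩
        (const 1# +ₚ -ₚ (u *ₚ r)) +ₚ (-ₚ (u *ₚ s)) *ₚ p  P.∎))
        (+∈ inv (-ₚ (u *ₚ s) , reflₚ)))

    -- An element of `I` outside (p) would be invertible modulo p, and with p in `I` this puts 1 in
    -- `I`.
    proper⇒⊆ : ∀ {I} → IsIdeal I → const 1# ∉ I → p ∈ I → I ⊆ multiples p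
    proper⇒⊆ {I} isIdeal 1∉I p∈I {f} f∈I with MaximalIdeal.maximal ⟨_⟩ f
    ... | inj₁ f∈ = f∈
    ... | inj₂ (u , inv) = contradiction
      (I.resp (Sₚ.solve 2 (λ f u → (Sₚ.con (+ 1) Sₚ.:- u Sₚ.:* f) Sₚ.:+ u Sₚ.:* f Sₚ.:= Sₚ.con (+ 1)) reflₚ f u)
        (I.+∈ (multiples-⊆ isIdeal p∈I inv) (I.*∈ u f∈I))) 1∉I
      where module I = IsIdealProperties isIdeal

  module _ {I : Pred Poly (c ⊔ ℓ)} (isIdeal : IsIdeal I) (1∉I : const 1# ∉ I)
    (prime : ∀ {f g} → f *ₚ g ∈ I → f ∈ I ⊎ g ∈ I) (_∈I? : ∀ f → Dec (f ∈ I)) where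

    private
      module I = IsIdealProperties isIdeal

      -- If a monic element of least degree in `I` had a proper factorisation, one of its two
      -- factors would lie in the prime ideal `I` and have smaller degree.
      minimal⇒prime : ∀ d {m} → Monic d m → m ∈ I → (∀ {e m′} → e ℕ.< d → Monic e m′ → m′ ∉ I) → ∃[ 𝔭 ] Prime.poly 𝔭 ∈ I
      minimal⇒prime zero    mon m∈ none = contradiction (I.resp (Leading-0 mon) m∈) 1∉I
      minimal⇒prime (suc d) {m} mon m∈ none = record
        { deg-1 = d ; poly = m ; monic = mon ; irreducible = irr } , m∈
        where
        irr : ∀ {e m′} → Monic (suc e) m′ → e ℕ.< d → m ∉ multiples m′
        irr {e} {m′} mon′ e<d (s , m≈) with prime {s} {m′} (I.resp m≈ m∈) | Monic-quotient {s = s} mon′ mon m≈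
        ... | inj₂ m′∈ | _ = none (s≤s e<d) mon′ m′∈
        ... | inj₁ s∈  | f , mon″ , eq = none (ℕ.≤-trans (ℕ.m≤m+n (suc f) e) (ℕ.≤-reflexive (≡.trans (≡.sym (ℕ.+-suc f e)) eq))) mon″ s∈

    -- A monic multiple of `f` lies in `I`, so the search for a monic element of least degree stops
    -- at the degree of `f` at the latest.
    generator : ∀ {f} → f ∈ I → ¬ f ≈ₚ [] → ∃[ 𝔭 ] Prime.poly 𝔭 ∈ I
    generator {f} f∈ f≉0 with lead f
    ... | inj₁ f≈0 = contradiction f≈0 f≉0
    ... | inj₂ (D , a , a≉0 , l) with make-monic {p = f} a≉0 l
    ... | u , _ , mon = go (suc D) 0 (λ ()) (s≤s (ℕ.m≤m+n D 0))
      where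
      go : ∀ N d → (∀ {e m′} → e ℕ.< d → Monic e m′ → m′ ∉ I) → D ℕ.< N ℕ.+ d → ∃[ 𝔭 ] Prime.poly 𝔭 ∈ I
      -- `N` counts the degrees that remain to be tried. Once it is zero, the degree `D` of the
      -- monic multiple of `f` has been excluded, a contradiction.
      go zero    d none D<d = contradiction (I.*∈ (const u) f∈) (none D<d mon)
      go (suc N) d none D<N+d with search d I.resp (λ {m} _ → m ∈I?)
      ... | inj₁ (m , mon′ , m∈) = minimal⇒prime d mon′ m∈ none
      ... | inj₂ none′ = go N (suc d) (λ e<1+d → extend e<1+d) (ℕ.≤-trans D<N+d (ℕ.≤-reflexive (≡.sym (ℕ.+-suc N d))))
        where
        extend : ∀ {e m′} → e ℕ.< suc d → Monic e m′ → m′ ∉ I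
        extend (s≤s e≤d) with ℕ.m≤n⇒m<n∨m≡n e≤d
        ... | inj₁ e<d    = none e<d
        ... | inj₂ ≡.refl = none′

-- Unique factorisation and the number of monic polynomials.

module UniqueFactorisation {c ℓ} (k : FiniteField c ℓ) where

  open FiniteField k hiding (zero)
  open Polynomial commutativeRing renaming (commutativeRing to k[x])
  open PolynomialProperties commutativeRing
  open FieldPolynomials k
  open Prime
  open IdealProperties k[x]
  open Ideals k[x] using (MaximalIdeal)
  private
    module k[x] = CommutativeRing k[x]
    module P = SetoidReasoning setoidₚ

  primes : Setoid (c ⊔ ℓ) ℓ
  primes = On.setoid {B = Prime} setoidₚ poly

  HasDegree : Prime → ℕ → Set
  HasDegree 𝔭 d = suc (deg-1 𝔭) ≡ d

  degree-unique : ∀ {𝔭 𝔮 d e} → poly 𝔭 ≈ₚ poly 𝔮 → HasDegree 𝔭 d → HasDegree 𝔮 e → d ≡ e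
  degree-unique {𝔭} {𝔮} e ≡.refl ≡.refl = Monic-unique e (monic 𝔭) (monic 𝔮)

  open Cycles primes HasDegree (λ {𝔭} {𝔮} → degree-unique {𝔭} {𝔮}) public
  open Permutation primes using (_↭_; ↭-refl; ↭-trans; ↭-sym; ↭-prep; prep)

  product : List Prime → Poly
  product α = foldr _*ₚ_ (const 1#) (map poly α)

  product-cong : ∀ {α β} → α ↭ β → product α ≈ₚ product β
  product-cong α↭β = ↭.foldr-commMonoid setoidₚ k[x].*-isCommutativeMonoid
    (↭.map⁺ primes setoidₚ {poly} (λ e → e) α↭β)

  product-++ : ∀ α β → product (α ++ β) ≈ₚ product α *ₚ product β
  product-++ []      β = symₚ (*ₚ-identityˡ _)
  product-++ (𝔭 ∷ α) β = transₚ (*ₚ-cong (reflₚ {poly 𝔭}) (product-++ α β)) (symₚ (*ₚ-assoc (poly 𝔭) (product α) (product β)))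

  product-Monic : ∀ {α n} → Degrees n α → Monic n (product α)
  product-Monic ([] , [] , ≡.refl) = Monic-1
  product-Monic {𝔭 ∷ α} (_ ∷ ds , ≡.refl ∷ hs , ≡.refl) = Monic-* (poly 𝔭) (monic 𝔭) (product-Monic (ds , hs , ≡.refl))

  divides⇒≈ : ∀ 𝔭 𝔮 → poly 𝔮 ∈ multiples (poly 𝔭) → poly 𝔭 ≈ₚ poly 𝔮
  divides⇒≈ 𝔭 𝔮 (s , q≈) with Monic-quotient {s = s} (monic 𝔭) (monic 𝔮) q≈
  ... | zero , mon , _ = symₚ (transₚ q≈ (transₚ (*ₚ-cong (Leading-0 {p = s} mon) (reflₚ {poly 𝔭})) (*ₚ-identityˡ _)))
  ... | suc f , mon , eq = contradiction (s , q≈) (irreducible 𝔮 (monic 𝔭)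
    (ℕ.≤-trans (s≤s (ℕ.m≤n+m _ f)) (ℕ.≤-reflexive (ℕ.suc-injective (≡.trans (≡.cong suc (≡.sym (ℕ.+-suc f _))) eq)))))

  divides-product : ∀ 𝔭 α → product α ∈ multiples (poly 𝔭) → Any (λ 𝔮 → poly 𝔭 ≈ₚ poly 𝔮) α
  divides-product 𝔭 []      1∈ = contradiction 1∈ (MaximalIdeal.proper ⟨ 𝔭 ⟩)
  divides-product 𝔭 (𝔮 ∷ α) p∣ with MaximalIdealProperties.prime ⟨ 𝔭 ⟩ {poly 𝔮} {product α} p∣
  ... | inj₁ p∣q = here (divides⇒≈ 𝔭 𝔮 p∣q)
  ... | inj₂ p∣α = there (divides-product 𝔭 α p∣α)

  private
    extract : ∀ 𝔭 {α} → Any (λ 𝔮 → poly 𝔭 ≈ₚ poly 𝔮) α → ∃[ β ] α ↭ 𝔭 ∷ β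
    extract 𝔭 {𝔮 ∷ α} (here e)  = α , prep (symₚ e) ↭-refl
    extract 𝔭 {𝔮 ∷ α} (there i) with extract 𝔭 i
    ... | β , α↭ = 𝔮 ∷ β , ↭-trans (↭-prep 𝔮 α↭) (Permutation.↭-swap primes 𝔮 𝔭 ↭-refl)

  -- Euclid's lemma finds the head of `α` among the factors in `β`; cancelling this monic factor
  -- shortens both lists.
  product-injective : ∀ α β → product α ≈ₚ product β → α ↭ β
  product-injective []      []      e = ↭-refl
  product-injective []      (𝔮 ∷ β) e = contradiction
    (product β , transₚ e (*ₚ-comm (poly 𝔮) (product β))) (MaximalIdeal.proper ⟨ 𝔮 ⟩)
  product-injective (𝔭 ∷ α) β e with extract 𝔭 (divides-product 𝔭 β (product α , transₚ (symₚ e) (*ₚ-comm (poly 𝔭) (product α))))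
  ... | β′ , β↭ = ↭-trans (↭-prep 𝔭 (product-injective α β′ (*-cancelʳ-monic (monic 𝔭) (P.begin
      product α *ₚ poly 𝔭   P.≈⟨ *ₚ-comm (product α) (poly 𝔭) ⟩
      poly 𝔭 *ₚ product α   P.≈⟨ e ⟩
      product β             P.≈⟨ product-cong β↭ ⟩
      poly 𝔭 *ₚ product β′  P.≈⟨ *ₚ-comm (poly 𝔭) (product β′) ⟩
      product β′ *ₚ poly 𝔭  P.∎)))) (↭-sym β↭)

  private
    Degrees-++ : ∀ {α β m n} → Degrees m α → Degrees n β → Degrees (m ℕ.+ n) (α ++ β)
    Degrees-++ (ds , hs , ≡.refl) (es , is , ≡.refl) = ds ++ es , Pointwise.++⁺ hs is , List.sum-++ ds es

  -- Either `f` is irreducible or `irreducible?` yields two monic factors of smaller degree; the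
  -- induction runs over a bound for the degree, as these degrees drop by unknown amounts.
  product-surjective : ∀ n {f} → Monic n f → ∃[ α ] Degrees n α × product α ≈ₚ f
  product-surjective n mon = go n ℕ.≤-refl mon
    where
    go : ∀ N {n f} → n ℕ.≤ N → Monic n f → ∃[ α ] Degrees n α × product α ≈ₚ f
    go N {zero} _ mon = [] , ([] , [] , ≡.refl) , symₚ (Leading-0 mon)
    go (suc N) {suc d} {f} (s≤s d≤N) mon with irreducible? {d} {f} mon
    ... | inj₁ irr = 𝔭 ∷ [] , (suc d ∷ [] , ≡.refl ∷ [] , ℕ.+-identityʳ _) ,
      transₚ (*ₚ-comm f (const 1#)) (*ₚ-identityˡ f)
      where
      𝔭 : Prime
      𝔭 = record { deg-1 = d ; poly = f ; monic = mon ; irreducible = irr }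
    ... | inj₂ (e , m , mon′ , e<d , s , f≈) with Monic-quotient {m = m} {f} {s} mon′ mon f≈
    ... | g , mon″ , eq with go N {f = s} g≤N mon″ | go N {f = m} (ℕ.≤-trans e<d d≤N) mon′
      where
      g≤N : g ℕ.≤ N
      g≤N = ℕ.≤-trans (ℕ.m≤m+n g e) (ℕ.≤-trans (ℕ.≤-reflexive (ℕ.suc-injective (≡.trans (≡.sym (ℕ.+-suc g e)) eq))) d≤N)
    ... | α , dα , α≈ | β , dβ , β≈ = α ++ β , ≡.subst (λ n → Degrees n (α ++ β)) eq (Degrees-++ dα dβ) ,
      transₚ (product-++ α β) (transₚ (*ₚ-cong α≈ β≈) (symₚ f≈))

  private
    collect : ∀ d {fs} → All (Monic (suc d)) fs → List Prime
    collect d [] = []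
    collect d {f ∷ _} (mon ∷ mons) with irreducible? {d} {f} mon
    ... | inj₁ irr = record { deg-1 = d ; poly = f ; monic = mon ; irreducible = irr } ∷ collect d mons
    ... | inj₂ _   = collect d mons

    collect-degree : ∀ d {fs} (mons : All (Monic (suc d)) fs) → All (λ 𝔭 → deg-1 𝔭 ≡ d) (collect d mons)
    collect-degree d [] = []
    collect-degree d {f ∷ _} (mon ∷ mons) with irreducible? {d} {f} mon
    ... | inj₁ irr = ≡.refl ∷ collect-degree d mons
    ... | inj₂ _   = collect-degree d mons

    collect-All : ∀ {q} {Q : Poly → Set q} d {fs} (mons : All (Monic (suc d)) fs) → All Q fs → All (λ 𝔭 → Q (poly 𝔭)) (collect d mons)
    collect-All d [] [] = []
    collect-All d {f ∷ _} (mon ∷ mons) (q ∷ qs) with irreducible? {d} {f} mon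
    ... | inj₁ irr = q ∷ collect-All d mons qs
    ... | inj₂ _   = collect-All d mons qs

    collect-unique : ∀ d {fs} (mons : All (Monic (suc d)) fs) → Unique setoidₚ fs → Unique primes (collect d mons)
    collect-unique d [] [] = []
    collect-unique d {f ∷ _} (mon ∷ mons) (f∉ ∷ u) with irreducible? {d} {f} mon
    ... | inj₁ irr = collect-All d mons f∉ ∷ collect-unique d mons u
    ... | inj₂ _   = collect-unique d mons u

    collect-complete : ∀ d {fs} (mons : All (Monic (suc d)) fs) 𝔭 → deg-1 𝔭 ≡ d → Any (poly 𝔭 ≈ₚ_) fs →
      Any (λ 𝔮 → poly 𝔭 ≈ₚ poly 𝔮) (collect d mons)
    collect-complete d {f ∷ _} (mon ∷ mons) 𝔭 e (here p≈f) with irreducible? {d} {f} mon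
    ... | inj₁ irr = here p≈f
    ... | inj₂ (_ , _ , mon′ , e<d , s , f≈) = contradiction (s , transₚ p≈f f≈)
      (irreducible 𝔭 mon′ (≡.subst (_ ℕ.<_) (≡.sym e) e<d))
    collect-complete d {f ∷ _} (mon ∷ mons) 𝔭 e (there i) with irreducible? {d} {f} mon
    ... | inj₁ irr = there (collect-complete d mons 𝔭 e i)
    ... | inj₂ _   = collect-complete d mons 𝔭 e i

    monics-All : ∀ d → All (Monic (suc d)) (monics (suc d))
    monics-All d = All.tabulateₛ setoidₚ (monics-Monic (suc d))

  primesUpTo : ℕ → List Prime
  primesUpTo zero    = []
  primesUpTo (suc N) = collect N (monics-All N) ++ primesUpTo N

  primesUpTo-degree : ∀ N → All (λ 𝔭 → deg-1 𝔭 ℕ.< N) (primesUpTo N)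
  primesUpTo-degree zero    = []
  primesUpTo-degree (suc N) = All.++⁺
    (All.map (λ { ≡.refl → ℕ.≤-refl }) (collect-degree N (monics-All N)))
    (All.map ℕ.m≤n⇒m≤1+n (primesUpTo-degree N))

  primesUpTo-unique : ∀ N → Unique primes (primesUpTo N)
  primesUpTo-unique zero    = []
  primesUpTo-unique (suc N) = Unique.++⁺ primes
    (collect-unique N (monics-All N) (monics-unique (suc N))) (primesUpTo-unique N)
    λ { {𝔭} (p∈ , p∈′) → disjoint 𝔭 {Any.lookup p∈} {Any.lookup p∈′} (All.lookupAny (collect-degree N (monics-All N)) p∈) (All.lookupAny (primesUpTo-degree N) p∈′) }
    where
    disjoint : ∀ 𝔭 {𝔮 𝔯} → deg-1 𝔮 ≡ N × poly 𝔭 ≈ₚ poly 𝔮 → deg-1 𝔯 ℕ.< N × poly 𝔭 ≈ₚ poly 𝔯 → ⊥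
    disjoint 𝔭 {𝔮} {𝔯} (≡.refl , p≈q) (r<N , p≈r) = ℕ.<-irrefl
      (ℕ.suc-injective (degree-unique {𝔯} {𝔮} (transₚ (symₚ p≈r) p≈q) ≡.refl ≡.refl)) r<N

  primesUpTo-complete : ∀ N 𝔭 → deg-1 𝔭 ℕ.< N → Any (λ 𝔮 → poly 𝔭 ≈ₚ poly 𝔮) (primesUpTo N)
  primesUpTo-complete (suc N) 𝔭 (s≤s d≤N) with ℕ.m≤n⇒m<n∨m≡n d≤N
  ... | inj₁ d<N    = Any.++⁺ʳ (collect N (monics-All N)) (primesUpTo-complete N 𝔭 d<N)
  ... | inj₂ ≡.refl = Any.++⁺ˡ (collect-complete N (monics-All N) 𝔭 ≡.refl (monics-complete (suc N) (monic 𝔭)))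

  weighted : List Prime → Points
  weighted = map λ 𝔭 → 𝔭 , deg-1 𝔭

  enumeration : ∀ N → Enumeration N
  enumeration N = record
    { list     = weighted (primesUpTo N)
    ; graded   = All.map⁺ (All.universal (λ _ → ≡.refl) (primesUpTo N))
    ; unique   = ≡.subst (Unique primes) (≡.sym (forget (primesUpTo N))) (primesUpTo-unique N)
    ; complete = λ { {𝔭} ≡.refl d≤N → ≡.subst (Any (λ 𝔮 → poly 𝔭 ≈ₚ poly 𝔮)) (≡.sym (forget (primesUpTo N))) (primesUpTo-complete N 𝔭 d≤N) } }
    where
    forget : ∀ xs → map proj₁ (weighted xs) ≡ xs
    forget []       = ≡.refl
    forget (x ∷ xs) = ≡.cong (x ∷_) (forget xs)

  -- Unique factorisation in the form ∏ 1 / (1 - t^deg p) = 1 / (1 - q t). Taking products and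
  -- factoring are injections in opposite directions between multisets of primes and monic
  -- polynomials, of which there are qⁿ in degree n.
  count-monics : ∀ {n N} → n ℕ.≤ N → eulerProduct (λ _ → 1ℤ) (weighted (primesUpTo N)) n ≡ + (order ℕ.^ n)
  count-monics {n} {N} n≤N = ≡.trans (≡.sym (size-finiteSym (enumeration N) n≤N)) (≡.cong +_ (≡.trans
    (ℕ.≤-antisym
      (injection⇒≤ {S = Sym n} {T = subsetoid setoidₚ (Monic n)} F G (λ { (α , h) → product α , product-Monic h }) (λ {x} {y} → product-injective (proj₁ x) (proj₁ y)))
      (injection⇒≤ {S = subsetoid setoidₚ (Monic n)} {T = Sym n} G F
        (λ { (f , mon) → let α , h , _ = product-surjective n mon in α , h })
        (λ {x} {y} e → transₚ (symₚ (proj₂ (proj₂ (product-surjective n (proj₂ x))))) (transₚ (product-cong e) (proj₂ (proj₂ (product-surjective n (proj₂ y))))))))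
    (≡.trans (size-fromAll setoidₚ (All.tabulateₛ setoidₚ (monics-Monic n)) (monics-unique n) (monics-complete n)) (length-monics n))))
    where
    F = finiteSym (enumeration N) n≤N
    G = fromAll setoidₚ (All.tabulateₛ setoidₚ (monics-Monic n)) (monics-unique n) (monics-complete n)

-- The residue field of a monic irreducible polynomial.

module PrimeResidueField {c ℓ} (k : FiniteField c ℓ) where

  open FiniteField k hiding (zero)
  open Polynomial commutativeRing renaming (commutativeRing to k[x])
  open PolynomialProperties commutativeRing
  open FieldPolynomials k
  open IdealProperties k[x]
  private
    module k[x] = CommutativeRing k[x]
    module Sₚ = IntegerCoefficients k[x]
    module P = SetoidReasoning setoidₚ
  open RawMonoid k[x].+-rawMonoid using (sum)

  monomial : ℕ → Poly
  monomial zero    = const 1#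
  monomial (suc n) = 0# ∷ monomial n

  sum-shift : ∀ {n} (u : Vector Poly n) → sum (λ i → 0# ∷ u i) ≈ₚ 0# ∷ sum u
  sum-shift {zero}  u = symₚ 0∷[]≈[]
  sum-shift {suc n} u = transₚ (+ₚ-cong (reflₚ {0# ∷ u zero}) (sum-shift (λ i → u (suc i)))) (symₚ (0∷-+ (u zero) _))

  combination : ∀ {n} → Vector Carrier n → Poly
  combination {n} a = sum {n} (λ i → const (a i) *ₚ monomial (toℕ i))

  sum-monomials : ∀ {n} (a : Vector Carrier n) → combination a ≈ₚ tabulate a
  sum-monomials {zero}  a = reflₚ
  sum-monomials {suc n} a = P.begin
    const (a zero) *ₚ const 1# +ₚ sum (λ i → const (a (suc i)) *ₚ (0# ∷ monomial (toℕ i)))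
      P.≈⟨ +ₚ-cong {p′ = const (a zero)} (transₚ (*ₚ-comm (const (a zero)) (const 1#)) (*ₚ-identityˡ (const (a zero))))
        (transₚ (sum-cong {n} λ i → transₚ (scale-const (a (suc i)) (0# ∷ monomial (toℕ i))) (transₚ (scale-0∷ (a (suc i)) (monomial (toℕ i))) (∷-cong refl (symₚ (scale-const (a (suc i)) (monomial (toℕ i)))))))
          (transₚ (sum-shift (λ i → const (a (suc i)) *ₚ monomial (toℕ i))) (∷-cong refl (sum-monomials (λ i → a (suc i)))))) ⟩
    const (a zero) +ₚ (0# ∷ tabulate (λ i → a (suc i)))
      P.≈⟨ ∷-cong (+-identityʳ (a zero)) reflₚ ⟩
    a zero ∷ tabulate (λ i → a (suc i)) P.∎

  tabulate-coeff : ∀ {d r} → Below d r → tabulate (λ (i : Fin d) → coeff r (toℕ i)) ≈ₚ r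
  tabulate-coeff {zero}  {r}     below = symₚ (Below-0 below)
  tabulate-coeff {suc d} {[]}    below = transₚ (∷-cong refl (tabulate-coeff {d} {[]} λ _ → refl)) 0∷[]≈[]
  tabulate-coeff {suc d} {a ∷ r} below = ∷-cong refl (tabulate-coeff {d} {r} λ d≤i → below (s≤s d≤i))

  tabulate-Below : ∀ {d} (a : Vector Carrier d) → Below d (tabulate a)
  tabulate-Below {zero}  a _         = refl
  tabulate-Below {suc d} a (s≤s d≤i) = tabulate-Below (λ i → a (suc i)) d≤i

  tabulate-≈[] : ∀ {d} (a : Vector Carrier d) → tabulate a ≈ₚ [] → ∀ i → a i ≈ 0#
  tabulate-≈[] a e zero    = at e 0
  tabulate-≈[] a e (suc i) = tabulate-≈[] (λ i → a (suc i)) (mk≈ₚ λ n → at e (suc n)) i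

  -- The basis consists of the powers of x below the degree: division with remainder shows that they
  -- span, and uniqueness of the remainder that they are independent.
  residueDegree : ∀ 𝔭 → ResidueDegree commutativeRing k[x] const ⟨ 𝔭 ⟩ (suc (Prime.deg-1 𝔭))
  residueDegree 𝔭 = record
    { basis       = λ i → monomial (toℕ i)
    ; spanning    = λ y → spanning y (divide monic y)
    ; independent = λ a → λ { (s , e) i → [] , transₚ (∷-cong (tabulate-≈[] a (vanishes a s e) i) (reflₚ {[]})) 0∷[]≈[] } }
    where
    open Prime 𝔭
    spanning : ∀ y → ∃[ s ] ∃[ r ] y ≈ₚ s *ₚ poly +ₚ r × Below (suc deg-1) r →
      Σ[ a ∈ Vector Carrier (suc deg-1) ] y +ₚ -ₚ combination a ∈ multiples poly
    spanning y (s , r , y≈ , below) = (λ i → coeff r (toℕ i)) , s , (P.begin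
      y +ₚ -ₚ combination {suc deg-1} (λ i → coeff r (toℕ i))
        P.≈⟨ +ₚ-cong y≈ (-ₚ-cong (transₚ (sum-monomials {suc deg-1} (λ i → coeff r (toℕ i))) (tabulate-coeff {suc deg-1} {r} below))) ⟩
      (s *ₚ poly +ₚ r) +ₚ -ₚ r
        P.≈⟨ Sₚ.solve 2 (λ x r → (x Sₚ.:+ r) Sₚ.:- r Sₚ.:= x) reflₚ (s *ₚ poly) r ⟩
      s *ₚ poly P.∎)
    vanishes : ∀ (a : Vector Carrier (suc deg-1)) s →
      combination a ≈ₚ s *ₚ poly → tabulate a ≈ₚ []
    vanishes a s e = transₚ t≈ (*ₚ-cong (multiple-Below monic s (Below-resp t≈ (tabulate-Below a))) (reflₚ {poly}))
      where
      t≈ : tabulate a ≈ₚ s *ₚ poly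
      t≈ = transₚ (symₚ (sum-monomials a)) e

-- Quadratic extensions of a commutative ring.

module QuadraticIdentities {a ℓ} (R : CommutativeRing a ℓ) where

  open CommutativeRing R hiding (zero)
  open IntegerCoefficients R
  open Ideals R using (_^_)
  open IdealProperties R using (⊆-^1)
  private module R = SetoidReasoning setoid

  -- If u inverts c modulo p and z² = - p (c + a z), then p lies in (p , z)².
  uniformiser : ∀ {x x′ p u c s a z} → x ≈ x′ * p → 1# - u * c ≈ s * p → z * z ≈ - (c * p) - a * p * z →
    x ≈ (x′ * (- u) * z) * z + ((x′ * (- u) * a * z) * p + ((x′ * s * p) * p + 0#))
  uniformiser {x} {x′} {p} {u} {c} {s} {a} {z} x≈ inv z² = sym (R.begin
    (x′ * (- u) * z) * z + ((x′ * (- u) * a * z) * p + ((x′ * s * p) * p + 0#))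
      R.≈⟨ solve 6 (λ x p u s a z → (x :* (:- u) :* z) :* z :+ ((x :* (:- u) :* a :* z) :* p :+ ((x :* s :* p) :* p :+ con (+ 0))) :=
          x :* (:- u) :* (z :* z) :+ (x :* (:- u) :* a :* z :* p :+ x :* p :* (s :* p))) refl x′ p u s a z ⟩
    x′ * (- u) * (z * z) + (x′ * (- u) * a * z * p + x′ * p * (s * p))
      R.≈⟨ +-cong (*-congˡ z²) (+-congˡ (*-congˡ (sym inv))) ⟩
    x′ * (- u) * (- (c * p) - a * p * z) + (x′ * (- u) * a * z * p + x′ * p * (1# - u * c))
      R.≈⟨ solve 6 (λ x p u c a z → x :* (:- u) :* (:- (c :* p) :- a :* p :* z) :+ (x :* (:- u) :* a :* z :* p :+ x :* p :* (con (+ 1) :- u :* c)) := x :* p) refl x′ p u c a z ⟩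
    x′ * p
      R.≈⟨ x≈ ⟨
    x R.∎)

  uniformiser∈² : ∀ {I x x′ p u c s a z} → Ideals.IsIdeal R I → p ∈ I → z ∈ I →
    x ≈ x′ * p → 1# - u * c ≈ s * p → z * z ≈ - (c * p) - a * p * z → x ∈ I ^ 2
  uniformiser∈² {I} {x} {x′} {p} {u} {c} {s} {a} {z} isIdeal p∈ z∈ x≈ inv z² =
    3 , us , vs , us∈ , vs∈ , uniformiser x≈ inv z²
    where
    open Ideals.IsIdeal isIdeal
    us vs : Vector Carrier 3
    us zero             = x′ * (- u) * z
    us (suc zero)       = x′ * (- u) * a * z
    us (suc (suc zero)) = x′ * s * p
    vs zero             = z
    vs (suc zero)       = p
    vs (suc (suc zero)) = p
    us∈ : ∀ i → us i ∈ I
    us∈ zero             = *∈ _ z∈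
    us∈ (suc zero)       = *∈ _ z∈
    us∈ (suc (suc zero)) = *∈ _ p∈
    vs∈ : ∀ i → vs i ∈ I ^ 1
    vs∈ zero             = ⊆-^1 {I} z∈
    vs∈ (suc zero)       = ⊆-^1 {I} p∈
    vs∈ (suc (suc zero)) = ⊆-^1 {I} p∈

  -- Newton's step for F = y² + h y - g, with `u` an inverse of F′(r) = 2 r + h modulo p. To first
  -- order F(r) = c p becomes c p (1 - u F′(r)), which is divisible by p², and so is the quadratic
  -- term.
  newton : ∀ {r h g p c u t} → r * r + h * r - g ≈ c * p → 1# - u * (r + r + h) ≈ t * p →
    let r′ = r - c * p * u in
    r′ * r′ + h * r′ - g ≈ (c * t + c * c * u * u) * (p * p)
  newton {r} {h} {g} {p} {c} {u} {t} root inv = R.begin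
    (r - c * p * u) * (r - c * p * u) + h * (r - c * p * u) - g
      R.≈⟨ solve 6 (λ r h g p c u → (r :- c :* p :* u) :* (r :- c :* p :* u) :+ h :* (r :- c :* p :* u) :- g :=
            (r :* r :+ h :* r :- g) :- c :* p :* (u :* (r :+ r :+ h)) :+ c :* c :* u :* u :* (p :* p)) refl r h g p c u ⟩
    (r * r + h * r - g) - c * p * (u * (r + r + h)) + c * c * u * u * (p * p)
      R.≈⟨ +-congʳ (+-congʳ root) ⟩
    c * p - c * p * (u * (r + r + h)) + c * c * u * u * (p * p)
      R.≈⟨ solve 5 (λ c p v u w → c :* p :- c :* p :* v :+ w := c :* p :* (con (+ 1) :- v) :+ w) refl c p (u * (r + r + h)) u (c * c * u * u * (p * p)) ⟩
    c * p * (1# - u * (r + r + h)) + c * c * u * u * (p * p)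
      R.≈⟨ +-congʳ (*-congˡ inv) ⟩
    c * p * (t * p) + c * c * u * u * (p * p)
      R.≈⟨ solve 4 (λ c p t u → c :* p :* (t :* p) :+ c :* c :* u :* u :* (p :* p) := (c :* t :+ c :* c :* u :* u) :* (p :* p)) refl c p t u ⟩
    (c * t + c * c * u * u) * (p * p) R.∎

-- The ring R[y]/(y² + h y - g)
module Quadratic {a ℓ} (R : CommutativeRing a ℓ) (h g : CommutativeRing.Carrier R) where

  open CommutativeRing R hiding (zero)
  open Polynomial R renaming (commutativeRing to R[y])
  open PolynomialProperties R
  open IntegerCoefficients R
  open RingProperties ring using (x∙y⁻¹≈ε⇒x≈y)
  private
    module Sₚ = IntegerCoefficients R[y]

  F : Poly
  F = - g ∷ h ∷ 1# ∷ []

  F-Monic : Monic 2 F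
  F-Monic = refl , λ { (s≤s (s≤s (s≤s _))) → refl }

  module Mod = PrincipalQuotient R[y] F
  B : CommutativeRing _ _
  B = Mod.commutativeRing
  private
    module B = CommutativeRing B
    module M = SetoidReasoning B.setoid
  open Mod using (_≈ᵐ_; ≈⇒≈ᵐ) public

  -- The norm of b₀ + b₁ y: the conjugate of y is - h - y, and y (- h - y) = - g.
  norm : (b₀ b₁ : Carrier) → Carrier
  norm b₀ b₁ = b₀ * b₀ - b₀ * b₁ * h - b₁ * b₁ * g

  eval-F : ∀ r → eval r F ≈ r * r + h * r - g
  eval-F r = solve 3 (λ r h g → :- g :+ r :* (h :+ r :* (con (+ 1) :+ r :* con (+ 0))) := r :* r :+ h :* r :- g) refl r h g

  reduce : ∀ f → ∃[ b₀ ] ∃[ b₁ ] f ≈ᵐ b₀ ∷ b₁ ∷ []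
  reduce f with divide F-Monic f
  ... | s , r , f≈ , below = coeff r 0 , coeff r 1 , s ,
    transₚ f≈ (transₚ (+ₚ-comm (s *ₚ F) r) (+ₚ-cong (Below-2 {r} below) (reflₚ {s *ₚ F})))

  reduced-unique : ∀ {b₀ b₁ c₀ c₁} → b₀ ∷ b₁ ∷ [] ≈ᵐ c₀ ∷ c₁ ∷ [] → b₀ ≈ c₀ × b₁ ≈ c₁
  reduced-unique {b₀} {b₁} {c₀} {c₁} (m , e) = x∙y⁻¹≈ε⇒x≈y b₀ c₀ (at d≈0 0) , x∙y⁻¹≈ε⇒x≈y b₁ c₁ (at d≈0 1)
    where
    d≈ : b₀ - c₀ ∷ b₁ - c₁ ∷ [] ≈ₚ m *ₚ F
    d≈ = transₚ (+ₚ-cong e (reflₚ { - c₀ ∷ - c₁ ∷ []}))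
      (Sₚ.solve 2 (λ c x → (c Sₚ.:+ x) Sₚ.:- c Sₚ.:= x) reflₚ (c₀ ∷ c₁ ∷ []) (m *ₚ F))
    below : Below 2 (b₀ - c₀ ∷ b₁ - c₁ ∷ [])
    below (s≤s (s≤s _)) = refl
    d≈0 : b₀ - c₀ ∷ b₁ - c₁ ∷ [] ≈ₚ []
    d≈0 = transₚ d≈ (*ₚ-cong (multiple-Below F-Monic m (Below-resp d≈ below)) (reflₚ {F}))

  linear-* : ∀ b₀ b₁ p → (b₀ ∷ b₁ ∷ []) *ₚ const p ≈ₚ b₀ * p ∷ b₁ * p ∷ []
  linear-* b₀ b₁ p = ∷-cong (+-identityʳ _) (∷-cong (+-identityʳ _) reflₚ)

  const-* : ∀ u b₀ b₁ → const u *ₚ (b₀ ∷ b₁ ∷ []) ≈ₚ u * b₀ ∷ u * b₁ ∷ []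
  const-* u b₀ b₁ = ∷-cong (+-identityʳ _) reflₚ

  norm-eq : ∀ b₀ b₁ → (b₀ ∷ b₁ ∷ []) *ₚ (b₀ - b₁ * h ∷ - b₁ ∷ []) ≈ₚ const (norm b₀ b₁) +ₚ const (- (b₁ * b₁)) *ₚ F
  norm-eq b₀ b₁ = mk≈ₚ λ where
    0 → solve 4 (λ b₀ b₁ h g → b₀ :* (b₀ :- b₁ :* h) :+ con (+ 0) :=
          (b₀ :* b₀ :- b₀ :* b₁ :* h :- b₁ :* b₁ :* g) :+ (:- (b₁ :* b₁) :* (:- g) :+ con (+ 0))) refl b₀ b₁ h g
    1 → solve 4 (λ b₀ b₁ h g → b₀ :* (:- b₁) :+ (b₁ :* (b₀ :- b₁ :* h) :+ con (+ 0)) := (:- (b₁ :* b₁)) :* h) refl b₀ b₁ h g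
    2 → solve 2 (λ b₁ h → b₁ :* (:- b₁) := (:- (b₁ :* b₁)) :* con (+ 1)) refl b₁ h
    (suc (suc (suc n))) → refl

  norm-≈ᵐ : ∀ b₀ b₁ → (b₀ ∷ b₁ ∷ []) *ₚ (b₀ - b₁ * h ∷ - b₁ ∷ []) ≈ᵐ const (norm b₀ b₁)
  norm-≈ᵐ b₀ b₁ = const (- (b₁ * b₁)) , norm-eq b₀ b₁

  -- Over any ring F - F(r) = (y - r) (y + h + r), so modulo F the product of the two conjugate
  -- linear elements is the scalar - F(r).
  conjugate-roots : ∀ r → (X- r) *ₚ (X- (- h - r)) ≈ₚ const (- eval r F) +ₚ const 1# *ₚ F
  conjugate-roots r = mk≈ₚ λ where
    0 → solve 3 (λ r h g → (:- r) :* (:- (:- h :- r)) :+ con (+ 0) :=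
          (:- (:- g :+ r :* (h :+ r :* (con (+ 1) :+ r :* con (+ 0))))) :+ (con (+ 1) :* (:- g) :+ con (+ 0))) refl r h g
    1 → solve 2 (λ r h → (:- r) :* con (+ 1) :+ (con (+ 1) :* (:- (:- h :- r)) :+ con (+ 0)) := con (+ 1) :* h) refl r h
    2 → refl
    (suc (suc (suc n))) → refl

  -- The Taylor expansion F = F(r) + (2 r + h) (y - r) + (y - r)², solved for the square.
  root-square : ∀ r → (X- r) *ₚ (X- r) ≈ₚ (const (- eval r F) +ₚ -ₚ (const (r + r + h) *ₚ (X- r))) +ₚ const 1# *ₚ F
  root-square r = mk≈ₚ λ where
    0 → solve 3 (λ r h g → (:- r) :* (:- r) :+ con (+ 0) :=
          ((:- (:- g :+ r :* (h :+ r :* (con (+ 1) :+ r :* con (+ 0))))) :- ((r :+ r :+ h) :* (:- r) :+ con (+ 0))) :+ (con (+ 1) :* (:- g) :+ con (+ 0))) refl r h g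
    1 → solve 2 (λ r h → (:- r) :* con (+ 1) :+ (con (+ 1) :* (:- r) :+ con (+ 0)) := (:- ((r :+ r :+ h) :* con (+ 1))) :+ con (+ 1) :* h) refl r h
    2 → refl
    (suc (suc (suc n))) → refl

  eval-conjugate : ∀ r → eval (- h - r) F ≈ eval r F
  eval-conjugate r = trans (eval-F (- h - r)) (trans
    (solve 3 (λ r h g → (:- h :- r) :* (:- h :- r) :+ h :* (:- h :- r) :- g := r :* r :+ h :* r :- g) refl r h g) (sym (eval-F r)))

  -- Evaluation at `r` descends to the quotient by F only modulo F(r).
  eval-≈ᵐ : ∀ r {f f′} → f ≈ᵐ f′ → ∃[ m ] eval r f ≈ eval r f′ + m * eval r F
  eval-≈ᵐ r {f} {f′} (m , e) = eval r m ,
    trans (eval-cong r e) (trans (eval-+ r f′ (m *ₚ F)) (+-congˡ (eval-* r m F)))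

  -- In the basis 1, y, multiplication by p acts on each coordinate separately.
  torsion-free : ∀ {p} → (∀ {b} → b * p ≈ 0# → b ≈ 0#) → ∀ {f} → f *ₚ const p ≈ᵐ [] → f ≈ᵐ []
  torsion-free {p} regular {f} e with reduce f
  ... | b₀ , b₁ , f≈ = M.begin
    f              M.≈⟨ f≈ ⟩
    b₀ ∷ b₁ ∷ []   M.≈⟨ ≈⇒≈ᵐ b≈0 ⟩
    [] M.∎
    where
    zeros : 0# ∷ 0# ∷ [] ≈ₚ []
    zeros = transₚ (∷-cong refl 0∷[]≈[]) 0∷[]≈[]
    b*p≈0 : b₀ * p ∷ b₁ * p ∷ [] ≈ᵐ 0# ∷ 0# ∷ []
    b*p≈0 = M.begin
      b₀ * p ∷ b₁ * p ∷ []         M.≈⟨ ≈⇒≈ᵐ (linear-* b₀ b₁ p) ⟨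
      (b₀ ∷ b₁ ∷ []) *ₚ const p    M.≈⟨ Mod.*-congʳᵐ {f} {b₀ ∷ b₁ ∷ []} (const p) f≈ ⟨
      f *ₚ const p                 M.≈⟨ e ⟩
      []                           M.≈⟨ ≈⇒≈ᵐ zeros ⟨
      0# ∷ 0# ∷ [] M.∎
    b≈0 : b₀ ∷ b₁ ∷ [] ≈ₚ []
    b≈0 = transₚ (∷-cong (regular (proj₁ (reduced-unique b*p≈0))) (∷-cong (regular (proj₂ (reduced-unique b*p≈0))) (reflₚ {[]}))) zeros

-- Norms, contraction and points above a root modulo p.

module QuadraticExtension {a ℓ} (R : CommutativeRing a ℓ) (h g : CommutativeRing.Carrier R) where

  open CommutativeRing R using (Carrier; _≈_; _+_; _*_; _-_; -_; 0#; 1#)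
  open Quadratic R h g
  open Polynomial R using (Poly; _*ₚ_; -ₚ_; reflₚ; symₚ; transₚ; ∷-cong; +ₚ-cong; 0∷[]≈[]) renaming (const to φ)
  open PolynomialProperties R using (eval; eval-+; eval-*; eval-neg; eval-const; X-_; eval-X-; factor)
  open Ideals B
  private
    module R = CommutativeRing R
    module B = CommutativeRing B
    module RI = IdealProperties R
    module BI = IdealProperties B
    module SR = IntegerCoefficients R
    module SB = IntegerCoefficients B
    module M = SetoidReasoning B.setoid
  open RawMonoid B.+-rawMonoid using (sum)

  φ-* : ∀ a b → φ (a * b) B.≈ φ a B.* φ b
  φ-* a b = ≈⇒≈ᵐ (∷-cong (R.sym (R.+-identityʳ _)) (reflₚ {[]}))

  φ-cong : ∀ {a b} → a ≈ b → φ a B.≈ φ b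
  φ-cong e = ≈⇒≈ᵐ (∷-cong e (reflₚ {[]}))

  φ-multiples : ∀ {p a} → a ∈ RI.multiples p → φ a ∈ BI.multiples (φ p)
  φ-multiples {p} {a} (m , e) = φ m , B.trans (φ-cong e) (φ-* m p)

  φ∈ : ∀ {I p a} → IsIdeal I → φ p ∈ I → a ∈ RI.multiples p → φ a ∈ I
  φ∈ {p = p} {a} isIdeal p∈ a∈ = BI.multiples-⊆ isIdeal p∈ {φ a} (φ-multiples {p} {a} a∈)

  contraction-isIdeal : ∀ (Q : MaximalIdeal) → Ideals.IsIdeal R (λ a → φ a ∈ ideal Q)
  contraction-isIdeal Q = record
    { resp = λ e → resp (φ-cong e)
    ; 0∈   = resp (≈⇒≈ᵐ (symₚ 0∷[]≈[])) 0∈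
    ; +∈   = +∈
    ; *∈   = λ r {a} a∈ → resp (B.sym (φ-* r a)) (*∈ (φ r) a∈) }
    where open BI.MaximalIdealProperties Q

  -- The norm of 1 - b x
  unit-norm : (x b₀ b₁ : Carrier) → Carrier
  unit-norm x b₀ b₁ = 1# - x * ((b₀ + (b₀ - b₁ * h)) - x * norm b₀ b₁)

  -- Multiplying 1 - b x by its conjugate 1 - b̄ x stays in `Q` and lands in R. The result is 1 - x
  -- (Tr b - x N b).
  unit-norm∈ : ∀ Q x b {b₀ b₁} → b B.≈ b₀ ∷ b₁ ∷ [] → B.1# B.- b B.* φ x ∈ ideal Q → φ (unit-norm x b₀ b₁) ∈ ideal Q
  unit-norm∈ Q x b {b₀} {b₁} b≈ inv = resp n≈ (*∈ʳ (B.1# B.- b̄ B.* φ x) inv)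
    where
    open BI.MaximalIdealProperties Q
    b̄ : Poly
    b̄ = b₀ - b₁ * h ∷ - b₁ ∷ []
    expand : ∀ b b̄ x s n → b B.+ b̄ B.≈ s → b B.* b̄ B.≈ n →
      (B.1# B.- b B.* x) B.* (B.1# B.- b̄ B.* x) B.≈ B.1# B.- x B.* (s B.- x B.* n)
    expand b b̄ x s n e f = M.begin
      (B.1# B.- b B.* x) B.* (B.1# B.- b̄ B.* x)
        M.≈⟨ SB.solve 3 (λ b b̄ x → (SB.con (+ 1) SB.:- b SB.:* x) SB.:* (SB.con (+ 1) SB.:- b̄ SB.:* x) SB.:=
          SB.con (+ 1) SB.:- x SB.:* ((b SB.:+ b̄) SB.:- x SB.:* (b SB.:* b̄))) B.refl b b̄ x ⟩
      B.1# B.- x B.* ((b B.+ b̄) B.- x B.* (b B.* b̄))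
        M.≈⟨ B.+-congˡ (B.-‿cong (B.*-congˡ {x} (B.+-cong e (B.-‿cong (B.*-congˡ {x} f))))) ⟩
      B.1# B.- x B.* (s B.- x B.* n) M.∎
    trace : b B.+ b̄ B.≈ φ (b₀ + (b₀ - b₁ * h))
    trace = M.begin
      b B.+ b̄                 M.≈⟨ B.+-congʳ {b̄} b≈ ⟩
      (b₀ ∷ b₁ ∷ []) B.+ b̄    M.≈⟨ ≈⇒≈ᵐ (∷-cong R.refl (transₚ (∷-cong (R.-‿inverseʳ b₁) (reflₚ {[]})) 0∷[]≈[])) ⟩
      φ (b₀ + (b₀ - b₁ * h)) M.∎
    nrm : b B.* b̄ B.≈ φ (norm b₀ b₁)
    nrm = M.begin
      b B.* b̄                  M.≈⟨ B.*-congʳ {b̄} b≈ ⟩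
      (b₀ ∷ b₁ ∷ []) B.* b̄     M.≈⟨ norm-≈ᵐ b₀ b₁ ⟩
      φ (norm b₀ b₁) M.∎
    n≈ : (B.1# B.- b B.* φ x) B.* (B.1# B.- b̄ B.* φ x) B.≈ φ (unit-norm x b₀ b₁)
    n≈ = M.begin
      (B.1# B.- b B.* φ x) B.* (B.1# B.- b̄ B.* φ x)
        M.≈⟨ expand b b̄ (φ x) (φ (b₀ + (b₀ - b₁ * h))) (φ (norm b₀ b₁)) trace nrm ⟩
      B.1# B.- φ x B.* (φ (b₀ + (b₀ - b₁ * h)) B.- φ x B.* φ (norm b₀ b₁))
        M.≈⟨ ≈⇒≈ᵐ (∷-cong (SR.solve 3 (λ x s n → SR.con (+ 1) SR.:- (x SR.:* (s SR.:- (x SR.:* n SR.:+ SR.con (+ 0))) SR.:+ SR.con (+ 0)) SR.:= SR.con (+ 1) SR.:- x SR.:* (s SR.:- x SR.:* n)) R.refl x (b₀ + (b₀ - b₁ * h)) (norm b₀ b₁)) (reflₚ {[]})) ⟩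
      φ (unit-norm x b₀ b₁) M.∎

  eval-difference : ∀ r f f′ → eval r (f B.- f′) ≈ eval r f - eval r f′
  eval-difference r f f′ = R.trans (eval-+ r f (-ₚ f′)) (R.+-congˡ (eval-neg r f′))

  eval-sum : ∀ r {n} (u : Vector Poly n) → eval r (sum u) ≈ RawMonoid.sum R.+-rawMonoid (λ i → eval r (u i))
  eval-sum r {zero}  u = R.refl
  eval-sum r {suc n} u = R.trans (eval-+ r (u zero) (sum (u ∘ suc))) (R.+-congˡ (eval-sum r (u ∘ suc)))

  eval-φ* : ∀ r a b → eval r (φ a B.* φ b) ≈ a * b
  eval-φ* r a b = R.trans (eval-* r (φ a) (φ b)) (R.*-cong (eval-const r a) (eval-const r b))

  module EvalIdeal {J : Pred Carrier (a ⊔ ℓ)} (J-isIdeal : Ideals.IsIdeal R J) (r : Carrier) (root : eval r F ∈ J) where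

    private module J = RI.IsIdealProperties J-isIdeal

    -- The kernel of B → R/J, y ↦ r, which is well defined because F(r) lies in `J`. For J = (p) it
    -- is a point; for J = (p²) it will contain the square of that point.
    evalIdeal : Pred Poly (a ⊔ ℓ)
    evalIdeal f = eval r f ∈ J

    isIdeal : IsIdeal evalIdeal
    isIdeal = record
      { resp = λ {f} {f′} e f∈ → let m , e′ = eval-≈ᵐ r {f′} {f} (B.sym {f} {f′} e) in
          J.resp (R.sym e′) (J.+∈ f∈ (J.*∈ m root))
      ; 0∈   = J.0∈
      ; +∈   = λ {f} {f′} f∈ f′∈ → J.resp (R.sym (eval-+ r f f′)) (J.+∈ f∈ f′∈)
      ; *∈   = λ s {f} f∈ → J.resp (R.sym (eval-* r s f)) (J.*∈ (eval r s) f∈) }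

    φ∈evalIdeal : ∀ {a} → a ∈ J → φ a ∈ evalIdeal
    φ∈evalIdeal {a} a∈ = J.resp (R.sym (eval-const r a)) a∈

    evalIdeal∋φ : ∀ {a} → φ a ∈ evalIdeal → a ∈ J
    evalIdeal∋φ {a} a∈ = J.resp (eval-const r a) a∈

    X-r∈evalIdeal : X- r ∈ evalIdeal
    X-r∈evalIdeal = J.resp (R.sym (R.trans (eval-X- r r) (R.-‿inverseʳ r))) J.0∈

  module Fibre (p : Carrier) (proper : 1# ∉ RI.multiples p)
    (maximal : ∀ x → x ∈ RI.multiples p ⊎ (∃[ y ] 1# - y * x ∈ RI.multiples p))
    (regular : ∀ {b} → b * p ≈ 0# → b ≈ 0#) where

    ⟨p⟩ : Ideals.MaximalIdeal R
    ⟨p⟩ = record { ideal = RI.multiples p ; isIdeal = RI.multiples-isIdeal p ; proper = proper ; maximal = maximal }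

    private
      module p = RI.MaximalIdealProperties ⟨p⟩
      isIdealₚ = RI.multiples-isIdeal p

    p*-cancel : ∀ {f f′} → φ p B.* f B.≈ φ p B.* f′ → f B.≈ f′
    p*-cancel {f} {f′} e = x∙y⁻¹≈ε⇒x≈y f f′ (torsion-free {p} regular {f B.- f′} (M.begin
      (f B.- f′) B.* φ p              M.≈⟨ SB.solve 3 (λ f f′ p → (f SB.:- f′) SB.:* p SB.:= p SB.:* f SB.:- p SB.:* f′) B.refl f f′ (φ p) ⟩
      φ p B.* f B.- φ p B.* f′        M.≈⟨ B.+-congʳ {B.- (φ p B.* f′)} e ⟩
      φ p B.* f′ B.- φ p B.* f′       M.≈⟨ B.-‿inverseʳ (φ p B.* f′) ⟩
      B.0# M.∎))
      where open import Algebra.Properties.Ring B.ring using (x∙y⁻¹≈ε⇒x≈y)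

    -- The point (p , y - r), for a root r modulo p
    module Point (r : Carrier) (root : eval r F ∈ RI.multiples p) where

      open EvalIdeal isIdealₚ r root

      point : MaximalIdeal
      point = record
        { ideal   = evalIdeal
        ; isIdeal = isIdeal
        ; proper  = λ 1∈ → p.proper (evalIdeal∋φ 1∈)
        ; maximal = λ f → invert f (p.maximal (eval r f)) }
        where
        invert : ∀ f → eval r f ∈ RI.multiples p ⊎ (∃[ u ] 1# - u * eval r f ∈ RI.multiples p) →
          eval r f ∈ RI.multiples p ⊎ (∃[ u ] eval r (B.1# B.- u B.* f) ∈ RI.multiples p)
        invert f (inj₁ f∈)        = inj₁ f∈
        invert f (inj₂ (u , inv)) = inj₂ (φ u , p.resp (R.sym (R.trans (eval-difference r B.1# (φ u B.* f))
          (R.+-cong (eval-const r 1#) (R.-‿cong (R.trans (eval-* r (φ u) f) (R.*-congʳ (eval-const r u))))))) inv)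

      over : φ p ∈ ideal point
      over = φ∈evalIdeal (RI.generator∈ p)

      X-r∈ : X- r ∈ ideal point
      X-r∈ = X-r∈evalIdeal

      φ∈point⇒ : ∀ {b} → φ b ∈ ideal point → b ∈ RI.multiples p
      φ∈point⇒ = evalIdeal∋φ

      decompose : ∀ {f} → f ∈ ideal point → ∃[ s ] ∃[ b ] f B.≈ s B.* (X- r) B.+ φ p B.* φ b
      decompose {f} (b , e) with factor r f
      ... | s , f≈ = s , b , ≈⇒≈ᵐ (transₚ f≈ (+ₚ-cong (reflₚ {s *ₚ (X- r)})
        (∷-cong (R.trans e (R.trans (R.*-comm b p) (R.sym (R.+-identityʳ _)))) (reflₚ {[]}))))

      point-⊆ : ∀ {I} → IsIdeal I → φ p ∈ I → X- r ∈ I → ideal point ⊆ I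
      point-⊆ isIdeal p∈ y-r∈ {f} f∈ with decompose {f} f∈
      ... | s , b , f≈ = I.resp (B.sym f≈) (I.+∈ (I.*∈ s y-r∈) (I.*∈ʳ (φ b) p∈))
        where module I = BI.IsIdealProperties isIdeal

      module _ {a′ ℓ′} (k : CommutativeRing a′ ℓ′) (ι : CommutativeRing.Carrier k → Carrier) {n} (deg : ResidueDegree k R ι ⟨p⟩ n) where

        private
          module k = CommutativeRing k
          module D = ResidueDegree deg

          eval-combination : ∀ (u : Vector k.Carrier n) → eval r (sum (λ i → φ (ι (u i)) B.* φ (D.basis i))) ≈
            RawMonoid.sum R.+-rawMonoid (λ i → ι (u i) * D.basis i)
          eval-combination u = R.trans (eval-sum r (λ i → φ (ι (u i)) B.* φ (D.basis i)))
            (RI.sum-cong (λ i → eval-φ* r (ι (u i)) (D.basis i)))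

        -- Evaluation at `r` identifies B/P with R/(p), so a basis of the latter serves for the
        -- former.
        degree : ResidueDegree k B (φ ∘ ι) point n
        degree = record
          { basis       = λ i → φ (D.basis i)
          ; spanning    = λ f → let u , u∈ = D.spanning (eval r f) in u ,
              p.resp (R.sym (R.trans (eval-difference r f (sum (λ i → φ (ι (u i)) B.* φ (D.basis i)))) (R.+-congˡ (R.-‿cong (eval-combination u))))) u∈
          ; independent = λ u u∈ i → φ∈evalIdeal (D.independent u (p.resp (eval-combination u) u∈) i) }

      relative-degree : ResidueDegree R B φ point 1
      relative-degree = record
        { basis       = λ _ → B.1#
        ; spanning    = λ f → (λ _ → eval r f) , p.resp (R.sym (R.trans (eval-difference r f (φ (eval r f) B.* B.1# B.+ B.0#))
            (R.trans (R.+-congˡ (R.-‿cong (combination (eval r f)))) (R.-‿inverseʳ (eval r f))))) p.0∈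
        ; independent = λ { u u∈ zero → φ∈evalIdeal (p.resp (combination (u zero)) u∈) } }
        where
        combination : ∀ b → eval r (φ b B.* B.1# B.+ B.0#) ≈ b
        combination b = R.trans (eval-+ r (φ b B.* B.1#) []) (R.trans (R.+-identityʳ _) (R.trans (eval-φ* r b 1#) (R.*-identityʳ b)))

-- Ramified, split and inert fibres over a prime element.

module QuadraticFibre {a ℓ} (R : CommutativeRing a ℓ) (h g : CommutativeRing.Carrier R)
  (p : CommutativeRing.Carrier R) (proper : ¬ IdealProperties.multiples R p (CommutativeRing.1# R))
  (maximal : ∀ x → IdealProperties.multiples R p x ⊎
    (∃[ y ] IdealProperties.multiples R p (CommutativeRing._-_ R (CommutativeRing.1# R) (CommutativeRing._*_ R y x))))
  (regular : ∀ {b} → CommutativeRing._≈_ R (CommutativeRing._*_ R b p) (CommutativeRing.0# R) →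
    CommutativeRing._≈_ R b (CommutativeRing.0# R)) where

  open CommutativeRing R using (Carrier; _≈_; _+_; _*_; _-_; -_; 0#; 1#)
  open Quadratic R h g
  open QuadraticExtension R h g
  open Fibre p proper maximal regular
  open Polynomial R using (Poly) renaming (const to φ)
  open PolynomialProperties R using (eval; eval-*; X-_; eval-X-)
  open Ideals B
  private
    module R = CommutativeRing R
    module B = CommutativeRing B
    module RI = IdealProperties R
    module BI = IdealProperties B
    module SR = IntegerCoefficients R
    module SB = IntegerCoefficients B
    module M = SetoidReasoning B.setoid
    module E = SetoidReasoning R.setoid
    module p = RI.MaximalIdealProperties ⟨p⟩

  pB : Pred Poly (a ⊔ ℓ)
  pB = BI.multiples (φ p)

  private
    module pB = BI.IsIdealProperties (BI.multiples-isIdeal (φ p))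

  over⇒RamificationExponent≥1 : ∀ P x → φ x ∈ ideal P → φ x ∈ ideal P ^ 1
  over⇒RamificationExponent≥1 P x = BI.⊆-^1 {ideal P} {φ x}

  module Ramified (r c b : Carrier) (root : eval r F ≈ c * p) (double : r + r + h ≈ b * p) (c∉ : c ∉ RI.multiples p) where

    open Point r (c , root)

    private
      z : Poly
      z = X- r
      module P = BI.MaximalIdealProperties point

      z² : z B.* z B.≈ B.- (φ c B.* φ p) B.- φ b B.* φ p B.* z
      z² = M.begin
        z B.* z
          M.≈⟨ φ 1# , root-square r ⟩
        φ (- eval r F) B.- φ (r + r + h) B.* z
          M.≈⟨ B.+-cong {φ (- eval r F)} {B.- (φ c B.* φ p)} (B.-‿cong {φ (eval r F)} (B.trans (φ-cong root) (φ-* c p)))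
               (B.-‿cong (B.*-congʳ {z} (B.trans (φ-cong double) (φ-* b p)))) ⟩
        B.- (φ c B.* φ p) B.- φ b B.* φ p B.* z M.∎

      z²∈pB : z B.* z ∈ pB
      z²∈pB = pB.resp (B.sym z²) (pB.+∈ (pB.-∈ (φ c , B.refl)) (pB.-∈ (φ b B.* z , SB.solve 3 (λ b p z → b SB.:* p SB.:* z SB.:= b SB.:* z SB.:* p) B.refl (φ b) (φ p) z)))

      -- In fact P² = pB, so that P³ = pP does not contain p.
      P²⊆pB : ideal point ^ 2 ⊆ pB
      P²⊆pB = BI.·-⊆ (BI.multiples-isIdeal (φ p)) λ {x} {y} x∈ y∈ → go x y (decompose {x} x∈) (decompose {y} (BI.^1-⊆ P.isIdeal′ {y} y∈))
        where
        go : ∀ x y → ∃[ s ] ∃[ u ] x B.≈ s B.* z B.+ φ p B.* φ u → ∃[ t ] ∃[ v ] y B.≈ t B.* z B.+ φ p B.* φ v → x B.* y ∈ pB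
        go x y (s , u , x≈) (t , v , y≈) = pB.resp (B.sym (M.begin
          x B.* y
            M.≈⟨ B.*-cong {x} {_} {y} x≈ y≈ ⟩
          (s B.* z B.+ φ p B.* φ u) B.* (t B.* z B.+ φ p B.* φ v)
            M.≈⟨ SB.solve 6 (λ s z p u t v → (s SB.:* z SB.:+ p SB.:* u) SB.:* (t SB.:* z SB.:+ p SB.:* v) SB.:=
                 (s SB.:* t) SB.:* (z SB.:* z) SB.:+ (s SB.:* z SB.:* v SB.:+ u SB.:* (t SB.:* z SB.:+ p SB.:* v)) SB.:* p) B.refl s z (φ p) (φ u) t (φ v) ⟩
          (s B.* t) B.* (z B.* z) B.+ (s B.* z B.* φ v B.+ φ u B.* (t B.* z B.+ φ p B.* φ v)) B.* φ p M.∎))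
          (pB.+∈ (pB.*∈ (s B.* t) z²∈pB) (s B.* z B.* φ v B.+ φ u B.* (t B.* z B.+ φ p B.* φ v) , B.refl))

      pP : Pred Poly (a ⊔ ℓ)
      pP f = ∃[ w ] w ∈ ideal point × f B.≈ φ p B.* w

      pP-isIdeal : IsIdeal pP
      pP-isIdeal = record
        { resp = λ { e (w , w∈ , f) → w , w∈ , B.trans (B.sym e) f }
        ; 0∈   = B.0# , P.0∈ , B.sym (B.zeroʳ (φ p))
        ; +∈   = λ { (w , w∈ , e) (v , v∈ , f) → w B.+ v , P.+∈ {w} {v} w∈ v∈ , B.trans (B.+-cong e f) (B.sym (B.distribˡ (φ p) w v)) }
        ; *∈   = λ { s (w , w∈ , e) → s B.* w , P.*∈ s {w} w∈ , B.trans (B.*-congˡ {s} e)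
                   (SB.solve 3 (λ s p w → s SB.:* (p SB.:* w) SB.:= p SB.:* (s SB.:* w)) B.refl s (φ p) w) } }

      P³⊆pP : ideal point ^ 3 ⊆ pP
      P³⊆pP = BI.·-⊆ pP-isIdeal λ {x} {y} x∈ y∈ → go x y x∈ (P²⊆pB y∈)
        where
        go : ∀ x y → x ∈ ideal point → y ∈ pB → x B.* y ∈ pP
        go x y x∈ (m , y≈) = x B.* m , P.*∈ʳ {x} m x∈ , B.trans (B.*-congˡ {x} y≈)
          (SB.solve 3 (λ x m p → x SB.:* (m SB.:* p) SB.:= p SB.:* (x SB.:* m)) B.refl x m (φ p))

    -- From above, p ∈ pP would cancel to 1 ∈ P. From below, `c` is invertible modulo p, so z² = - c
    -- p - b p z can be solved for p with all terms in P².
    exponent : RamificationExponent R B φ point 2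
    exponent = lower , λ q → upper (P³⊆pP (q p over))
      where
      upper : φ p ∈ pP → ⊥
      upper (w , w∈ , e) = P.proper (P.resp {w} {B.1#} (B.sym (p*-cancel {B.1#} {w} (B.trans (B.*-identityʳ (φ p)) e))) w∈)
      lower : ∀ x → φ x ∈ ideal point → φ x ∈ ideal point ^ 2
      lower x φx∈ with φ∈point⇒ {x} φx∈ | p.maximal c
      ... | x′ , x≈ | inj₁ c∈ = contradiction c∈ c∉
      ... | x′ , x≈ | inj₂ (u , s , inv) = QuadraticIdentities.uniformiser∈² B
        {ideal point} {φ x} {φ x′} {φ p} {φ u} {φ c} {φ s} {φ b} {z} P.isIdeal′ over X-r∈
        (B.trans (φ-cong x≈) (φ-* x′ p))
        (B.trans (B.+-congˡ {B.1#} (B.-‿cong (B.sym (φ-* u c)))) (B.trans (φ-cong inv) (φ-* s p)))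
        z²

    -- As z² ∈ pB lies in the prime ideal `Q`, so does `z`; and p and `z` generate the point.
    only : ∀ Q → φ p ∈ ideal Q → ideal Q ≐ ideal point
    only Q p∈ = let ⊆ , ⊇ = BI.maximal-⊆⇒≐ point Q (λ {f} → point-⊆ Q.isIdeal′ p∈ (root∈ z z²∈pB) {f}) in (λ {f} → ⊇ {f}) , λ {f} → ⊆ {f}
      where
      module Q = BI.MaximalIdealProperties Q
      root∈ : ∀ z → z B.* z ∈ pB → z ∈ ideal Q
      root∈ z z²∈ with Q.prime {z} {z} (BI.multiples-⊆ Q.isIdeal′ p∈ {z B.* z} z²∈)
      ... | inj₁ z∈ = z∈
      ... | inj₂ z∈ = z∈

  module Unramified (r : Carrier) (root : eval r F ∈ RI.multiples (p * p)) where

    open Point r (proj₁ root * p , R.trans (proj₂ root) (R.sym (R.*-assoc _ p p))) public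

    private
      module P² = EvalIdeal (RI.multiples-isIdeal (p * p)) r root
      module P = BI.MaximalIdealProperties point

      -- As r is a root modulo p², evaluation at r is defined on B modulo p².
      P²⊆ : ideal point ^ 2 ⊆ P².evalIdeal
      P²⊆ = BI.·-⊆ P².isIdeal λ {x} {y} x∈ y∈ → go x y x∈ (BI.^1-⊆ P.isIdeal′ {y} y∈)
        where
        go : ∀ x y → x ∈ ideal point → y ∈ ideal point → x B.* y ∈ P².evalIdeal
        go x y (m , e) (n , f) = m * n , R.trans (eval-* r x y) (R.trans (R.*-cong e f)
          (SR.solve 3 (λ m n p → (m SR.:* p) SR.:* (n SR.:* p) SR.:= (m SR.:* n) SR.:* (p SR.:* p)) R.refl m n p))

    -- Evaluation at `r` sends P² into (p²). Were p in P², it would lie in (p²), and cancelling p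
    -- would put 1 in (p).
    exponent : RamificationExponent R B φ point 1
    exponent = over⇒RamificationExponent≥1 point , λ q → upper (P².evalIdeal∋φ {p} (P²⊆ {φ p} (q p over)))
      where
      upper : p ∈ RI.multiples (p * p) → ⊥
      upper (m , e) = p.proper (m , x∙y⁻¹≈ε⇒x≈y 1# (m * p) (regular (E.begin
        (1# - m * p) * p     E.≈⟨ SR.solve 2 (λ m p → (SR.con (+ 1) SR.:- m SR.:* p) SR.:* p SR.:= p SR.:- m SR.:* (p SR.:* p)) R.refl m p ⟩
        p - m * (p * p)      E.≈⟨ R.+-congʳ e ⟩
        m * (p * p) - m * (p * p) E.≈⟨ R.-‿inverseʳ _ ⟩
        0# E.∎)))
        where open import Algebra.Properties.Ring R.ring using (x∙y⁻¹≈ε⇒x≈y)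

  module Split (r : Carrier) (root : eval r F ∈ RI.multiples (p * p)) (simple : r + r + h ∉ RI.multiples p) where

    -- The conjugate root. As F(r′) = F(r) exactly, it is a root modulo p² as soon as `r` is.
    r′ : Carrier
    r′ = - h - r

    module P₁ = Unramified r root
    module P₂ = Unramified r′ (proj₁ root , R.trans (eval-conjugate r) (proj₂ root))

    -- The element y - r vanishes at the first point and has the value r′ - r = - (2 r + h) at the
    -- second, which p does not divide.
    distinct : ¬ ideal P₁.point ≐ ideal P₂.point
    distinct (⊆ , _) = simple (p.resp
      (R.trans (R.-‿cong (eval-X- r′ r)) (SR.solve 2 (λ r h → SR.:- ((SR.:- h SR.:- r) SR.:- r) SR.:= r SR.:+ r SR.:+ h) R.refl r h))
      (p.-∈ (⊆ {X- r} P₁.X-r∈)))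

    only : ∀ Q → φ p ∈ ideal Q → ideal Q ≐ ideal P₁.point ⊎ ideal Q ≐ ideal P₂.point
    only Q p∈ = case (roots∈ (X- r) (X- r′) (B.sym (φ 1# , conjugate-roots r)))
      where
      module Q = BI.MaximalIdealProperties Q
      roots∈ : ∀ z z′ → φ (- eval r F) B.≈ z B.* z′ → z ∈ ideal Q ⊎ z′ ∈ ideal Q
      roots∈ z z′ e = Q.prime {z} {z′} (Q.resp {φ (- eval r F)} {z B.* z′} e
        (φ∈ Q.isIdeal′ p∈ (p.-∈ (proj₁ root * p , R.trans (proj₂ root) (R.sym (R.*-assoc _ p p))))))
      case : X- r ∈ ideal Q ⊎ X- r′ ∈ ideal Q → ideal Q ≐ ideal P₁.point ⊎ ideal Q ≐ ideal P₂.point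
      case (inj₁ z∈) = let ⊆ , ⊇ = BI.maximal-⊆⇒≐ P₁.point Q (λ {f} → P₁.point-⊆ Q.isIdeal′ p∈ z∈ {f}) in
        inj₁ ((λ {f} → ⊇ {f}) , λ {f} → ⊆ {f})
      case (inj₂ z∈) = let ⊆ , ⊇ = BI.maximal-⊆⇒≐ P₂.point Q (λ {f} → P₂.point-⊆ Q.isIdeal′ p∈ z∈ {f}) in
        inj₂ ((λ {f} → ⊇ {f}) , λ {f} → ⊆ {f})

module InertQuadraticFibre {a ℓ} (R : CommutativeRing a ℓ) (h g : CommutativeRing.Carrier R)
  (p : CommutativeRing.Carrier R) (proper : ¬ IdealProperties.multiples R p (CommutativeRing.1# R))
  (maximal : ∀ x → IdealProperties.multiples R p x ⊎
    (∃[ y ] IdealProperties.multiples R p (CommutativeRing._-_ R (CommutativeRing.1# R) (CommutativeRing._*_ R y x))))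
  (regular : ∀ {b} → CommutativeRing._≈_ R (CommutativeRing._*_ R b p) (CommutativeRing.0# R) →
    CommutativeRing._≈_ R b (CommutativeRing.0# R))
  (irreducible : ∀ r → ¬ IdealProperties.multiples R p (PolynomialProperties.eval R r (Quadratic.F R h g))) where

  open CommutativeRing R using (Carrier; _≈_; _+_; _*_; _-_; -_; 0#; 1#)
  open Quadratic R h g
  open QuadraticExtension R h g
  open Fibre p proper maximal regular
  open QuadraticFibre R h g p proper maximal regular using (over⇒RamificationExponent≥1; pB)
  open Polynomial R using (Poly; _≈ₚ_; reflₚ; symₚ; transₚ; ∷-cong; +ₚ-cong; 0∷[]≈[]) renaming (const to φ)
  open Ideals B
  private
    module R = CommutativeRing R
    module B = CommutativeRing B
    module RI = IdealProperties R
    module BI = IdealProperties B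
    module SR = IntegerCoefficients R
    module SB = IntegerCoefficients B
    module M = SetoidReasoning B.setoid
    module p = RI.MaximalIdealProperties ⟨p⟩
    module pB = BI.IsIdealProperties (BI.multiples-isIdeal (φ p))
  open RawMonoid B.+-rawMonoid using (sum)

  -- As 1, y is a basis of B over R, membership in `pB` is divisibility by p of both coordinates.
  reduced∈⇒ : ∀ {b₀ b₁} → b₀ ∷ b₁ ∷ [] ∈ pB → b₀ ∈ RI.multiples p × b₁ ∈ RI.multiples p
  reduced∈⇒ {b₀} {b₁} (m , e) = let m₀ , m₁ , m≈ = reduce m in go m₀ m₁ m≈
    where
    go : ∀ m₀ m₁ → m B.≈ m₀ ∷ m₁ ∷ [] → b₀ ∈ RI.multiples p × b₁ ∈ RI.multiples p
    go m₀ m₁ m≈ = (m₀ , proj₁ components) , (m₁ , proj₂ components)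
      where
      components : b₀ ≈ m₀ * p × b₁ ≈ m₁ * p
      components = reduced-unique {b₀} {b₁} {m₀ * p} {m₁ * p} (M.begin
        b₀ ∷ b₁ ∷ []                M.≈⟨ e ⟩
        m B.* φ p                   M.≈⟨ Mod.*-congʳᵐ {m} {m₀ ∷ m₁ ∷ []} (φ p) m≈ ⟩
        (m₀ ∷ m₁ ∷ []) B.* φ p      M.≈⟨ ≈⇒≈ᵐ (linear-* m₀ m₁ p) ⟩
        m₀ * p ∷ m₁ * p ∷ [] M.∎)

  ⇒reduced∈ : ∀ {b₀ b₁} → b₀ ∈ RI.multiples p → b₁ ∈ RI.multiples p → b₀ ∷ b₁ ∷ [] ∈ pB
  ⇒reduced∈ {b₀} {b₁} (m₀ , e₀) (m₁ , e₁) = m₀ ∷ m₁ ∷ [] , (M.begin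
      b₀ ∷ b₁ ∷ []                M.≈⟨ ≈⇒≈ᵐ (∷-cong e₀ (∷-cong e₁ (reflₚ {[]}))) ⟩
      m₀ * p ∷ m₁ * p ∷ []        M.≈⟨ ≈⇒≈ᵐ (linear-* m₀ m₁ p) ⟨
      (m₀ ∷ m₁ ∷ []) B.* φ p M.∎)

  φ≈reduced : ∀ b → φ b ≈ₚ b ∷ 0# ∷ []
  φ≈reduced b = ∷-cong R.refl (symₚ 0∷[]≈[])

  φ∈⇒ : ∀ {b} → φ b ∈ pB → b ∈ RI.multiples p
  φ∈⇒ {b} b∈ = proj₁ (reduced∈⇒ (pB.resp {φ b} {b ∷ 0# ∷ []} (≈⇒≈ᵐ (φ≈reduced b)) b∈))

  pB-proper : B.1# ∉ pB
  pB-proper 1∈ = p.proper (φ∈⇒ {1#} 1∈)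

  -- A zero b₀ + b₁ y of the norm modulo p, with b₁ invertible, gives the root - b₀ / b₁.
  norm∈⇒ : ∀ b₀ b₁ → b₁ ∉ RI.multiples p → norm b₀ b₁ ∉ RI.multiples p
  norm∈⇒ b₀ b₁ b₁∉ n∈ with p.maximal b₁
  ... | inj₁ b₁∈       = b₁∉ b₁∈
  ... | inj₂ (u , inv) = irreducible (- (u * b₀)) (p.resp (R.sym (R.trans (eval-F (- (u * b₀))) identity))
      (p.+∈ (p.*∈ (u * u) n∈) (p.*∈ (- (h * u * b₀ + g * (1# + u * b₁))) inv)))
    where
    identity : - (u * b₀) * - (u * b₀) + h * - (u * b₀) - g ≈
      u * u * norm b₀ b₁ + - (h * u * b₀ + g * (1# + u * b₁)) * (1# - u * b₁)
    identity = SR.solve 5 (λ b₀ b₁ u h g →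
      (SR.:- (u SR.:* b₀)) SR.:* (SR.:- (u SR.:* b₀)) SR.:+ h SR.:* (SR.:- (u SR.:* b₀)) SR.:- g SR.:=
      u SR.:* u SR.:* (b₀ SR.:* b₀ SR.:- b₀ SR.:* b₁ SR.:* h SR.:- b₁ SR.:* b₁ SR.:* g) SR.:+
      SR.:- (h SR.:* u SR.:* b₀ SR.:+ g SR.:* (SR.con (+ 1) SR.:+ u SR.:* b₁)) SR.:* (SR.con (+ 1) SR.:- u SR.:* b₁)) R.refl b₀ b₁ u h g

  -- Modulo p, an element b₀ + b₁ y is a scalar if p divides b₁. Otherwise its norm is nonzero by
  -- `norm∈⇒`, and the conjugate divided by the norm is an inverse.
  pB-maximal : ∀ f → f ∈ pB ⊎ ∃[ v ] B.1# B.- v B.* f ∈ pB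
  pB-maximal f with reduce f
  ... | b₀ , b₁ , f≈ with p.maximal b₁
  ... | inj₁ b₁∈ with p.maximal b₀
  ... | inj₁ b₀∈ = inj₁ (pB.resp {b₀ ∷ b₁ ∷ []} {f} (B.sym f≈) (⇒reduced∈ b₀∈ b₁∈))
  ... | inj₂ (u , inv) = inj₂ (φ u , pB.resp {1# - u * b₀ ∷ - (u * b₁) ∷ []} {B.1# B.- φ u B.* f} (M.begin
      1# - u * b₀ ∷ - (u * b₁) ∷ []             M.≈⟨ ≈⇒≈ᵐ (+ₚ-cong (reflₚ {φ 1#}) (∷-cong (R.-‿cong (R.sym (R.+-identityʳ (u * b₀)))) (reflₚ { - (u * b₁) ∷ []}))) ⟩
      B.1# B.- φ u B.* (b₀ ∷ b₁ ∷ [])           M.≈⟨ B.+-congˡ {B.1#} (B.-‿cong (B.*-congˡ {φ u} (B.sym f≈))) ⟩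
      B.1# B.- φ u B.* f M.∎)
      (⇒reduced∈ inv (p.-∈ (p.*∈ u b₁∈))))
  pB-maximal f | b₀ , b₁ , f≈ | inj₂ (w , inv₁) with p.maximal (norm b₀ b₁)
  ... | inj₁ n∈        = contradiction n∈ (norm∈⇒ b₀ b₁ (p.unit∉ w inv₁))
  ... | inj₂ (v , inv) = inj₂ (φ v B.* b̄ , pB.resp {φ (1# - v * norm b₀ b₁)} {B.1# B.- (φ v B.* b̄) B.* f} (B.sym (M.begin
      B.1# B.- (φ v B.* b̄) B.* f            M.≈⟨ B.+-congˡ {B.1#} (B.-‿cong eq) ⟩
      φ (1# - v * norm b₀ b₁) M.∎))
      (φ-multiples {p} {1# - v * norm b₀ b₁} inv))
    where
    b̄ : Poly
    b̄ = b₀ - b₁ * h ∷ - b₁ ∷ []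
    eq : (φ v B.* b̄) B.* f B.≈ φ (v * norm b₀ b₁)
    eq = M.begin
      (φ v B.* b̄) B.* f                  M.≈⟨ B.*-assoc (φ v) b̄ f ⟩
      φ v B.* (b̄ B.* f)                  M.≈⟨ B.*-congˡ {φ v} (B.*-comm b̄ f) ⟩
      φ v B.* (f B.* b̄)                  M.≈⟨ B.*-congˡ {φ v} (B.*-congʳ {b̄} f≈) ⟩
      φ v B.* ((b₀ ∷ b₁ ∷ []) B.* b̄)     M.≈⟨ B.*-congˡ {φ v} (norm-≈ᵐ b₀ b₁) ⟩
      φ v B.* φ (norm b₀ b₁)             M.≈⟨ φ-* v (norm b₀ b₁) ⟨
      φ (v * norm b₀ b₁) M.∎

  point : MaximalIdeal
  point = record { ideal = pB ; isIdeal = BI.multiples-isIdeal (φ p) ; proper = pB-proper ; maximal = pB-maximal }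

  over : φ p ∈ ideal point
  over = BI.generator∈ (φ p)

  only : ∀ Q → φ p ∈ ideal Q → ideal Q ≐ ideal point
  only Q p∈ = let ⊆ , ⊇ = BI.maximal-⊆⇒≐ point Q (λ {f} → BI.multiples-⊆ (BI.MaximalIdealProperties.isIdeal′ Q) p∈ {f}) in (λ {f} → ⊇ {f}) , λ {f} → ⊆ {f}

  -- The point is `pB`, so its square lies in p²B, and p ∈ p²B would cancel to 1 ∈ pB.
  exponent : RamificationExponent R B φ point 1
  exponent = over⇒RamificationExponent≥1 point , λ q → upper (P²⊆ (q p over))
    where
    P²⊆ : ideal point ^ 2 ⊆ BI.multiples (φ p B.* φ p)
    P²⊆ = BI.·-⊆ (BI.multiples-isIdeal (φ p B.* φ p)) λ {x} {y} x∈ y∈ → go x y x∈ (BI.^1-⊆ (BI.multiples-isIdeal (φ p)) {y} y∈)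
      where
      go : ∀ x y → x ∈ pB → y ∈ pB → x B.* y ∈ BI.multiples (φ p B.* φ p)
      go x y (m , e) (n , f) = m B.* n , B.trans (B.*-cong {x} {m B.* φ p} {y} {n B.* φ p} e f)
        (SB.solve 3 (λ m n p → (m SB.:* p) SB.:* (n SB.:* p) SB.:= (m SB.:* n) SB.:* (p SB.:* p)) B.refl m n (φ p))
    upper : φ p ∈ BI.multiples (φ p B.* φ p) → ⊥
    upper (m , e) = pB-proper (m , p*-cancel {B.1#} {m B.* φ p} (M.begin
      φ p B.* B.1#          M.≈⟨ B.*-identityʳ (φ p) ⟩
      φ p                   M.≈⟨ e ⟩
      m B.* (φ p B.* φ p)   M.≈⟨ SB.solve 2 (λ m p → m SB.:* (p SB.:* p) SB.:= p SB.:* (m SB.:* p)) B.refl m (φ p) ⟩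
      φ p B.* (m B.* φ p) M.∎))

  -- If 1 ≡ u d and y ≡ v d, then v - u y ∈ pB, so p divides u, and 1 ≡ u d ≡ 0. This separates
  -- inert from split fibres, both of which are unramified.
  ¬relative-degree-1 : ¬ ResidueDegree R B φ point 1
  ¬relative-degree-1 D = p.proper 1∈
    where
    module D = ResidueDegree D
    y : Poly
    y = 0# ∷ 1# ∷ []
    d : Poly
    d = D.basis zero
    u v : Carrier
    u = proj₁ (D.spanning B.1#) zero
    v = proj₁ (D.spanning y) zero
    u∈ : B.1# B.- (φ u B.* d B.+ B.0#) ∈ pB
    u∈ = proj₂ (D.spanning B.1#)
    v∈ : y B.- (φ v B.* d B.+ B.0#) ∈ pB
    v∈ = proj₂ (D.spanning y)
    eliminate : ∀ u v d y → B.1# B.- (u B.* d B.+ B.0#) ∈ pB → y B.- (v B.* d B.+ B.0#) ∈ pB → v B.- u B.* y ∈ pB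
    eliminate u v d y u∈ v∈ = pB.resp
      (SB.solve 4 (λ u v d y → v SB.:* (SB.con (+ 1) SB.:- (u SB.:* d SB.:+ SB.con (+ 0))) SB.:+ SB.:- (u SB.:* (y SB.:- (v SB.:* d SB.:+ SB.con (+ 0)))) SB.:= v SB.:- u SB.:* y) B.refl u v d y)
      (pB.+∈ (pB.*∈ v u∈) (pB.-∈ (pB.*∈ u v∈)))
    recover : ∀ u d → B.1# B.- (u B.* d B.+ B.0#) ∈ pB → u ∈ pB → B.1# ∈ pB
    recover u d u∈ ∈pB = pB.resp
      (SB.solve 2 (λ u d → (SB.con (+ 1) SB.:- (u SB.:* d SB.:+ SB.con (+ 0))) SB.:+ u SB.:* d SB.:= SB.con (+ 1)) B.refl u d)
      (pB.+∈ u∈ (pB.*∈ʳ d ∈pB))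
    linear : v ∷ - u ∷ [] ∈ pB
    linear = pB.resp {φ v B.- φ u B.* y} {v ∷ - u ∷ []} (≈⇒≈ᵐ (∷-cong
        (SR.solve 2 (λ u v → v SR.:- (u SR.:* SR.con (+ 0) SR.:+ SR.con (+ 0)) SR.:= v) R.refl u v)
        (∷-cong (R.-‿cong (R.*-identityʳ u)) (reflₚ {[]}))))
      (eliminate (φ u) (φ v) d y u∈ v∈)
    u∈p : u ∈ RI.multiples p
    u∈p = p.resp (SR.solve 1 (λ u → SR.:- (SR.:- u) SR.:= u) R.refl u) (p.-∈ (proj₂ (reduced∈⇒ linear)))
    1∈ : 1# ∈ RI.multiples p
    1∈ = φ∈⇒ {1#} (recover (φ u) d u∈ (φ-multiples u∈p))

  module _ {a′ ℓ′} (k : CommutativeRing a′ ℓ′) (ι : CommutativeRing.Carrier k → Carrier) {n} (deg : ResidueDegree k R ι ⟨p⟩ n) where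

    private
      module k = CommutativeRing k
      module D = ResidueDegree deg

      ∑ᴿ : ∀ {m} → Vector Carrier m → Carrier
      ∑ᴿ = RawMonoid.sum R.+-rawMonoid

      sum-split : ∀ m {n} (w : Vector Poly (m ℕ.+ n)) → sum w B.≈ sum (λ i → w (i ↑ˡ n)) B.+ sum (λ i → w (m ↑ʳ i))
      sum-split zero    w = B.refl
      sum-split (suc m) w = B.trans (B.+-congˡ {w zero} (sum-split m (w ∘ suc))) (B.sym (B.+-assoc (w zero) _ _))

      sum-constant : ∀ {m} (u d : Vector Carrier m) → sum (λ i → φ (u i) B.* φ (d i)) ≈ₚ ∑ᴿ (λ i → u i * d i) ∷ 0# ∷ []
      sum-constant {zero}  u d = symₚ (transₚ (∷-cong R.refl 0∷[]≈[]) 0∷[]≈[])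
      sum-constant {suc m} u d = transₚ (+ₚ-cong (reflₚ {φ (u zero) B.* φ (d zero)}) (sum-constant (u ∘ suc) (d ∘ suc)))
        (∷-cong (R.+-congʳ (R.+-identityʳ _)) (reflₚ {0# ∷ []}))

      sum-linear : ∀ {m} (u d : Vector Carrier m) → sum (λ i → φ (u i) B.* (0# ∷ d i ∷ [])) ≈ₚ 0# ∷ ∑ᴿ (λ i → u i * d i) ∷ []
      sum-linear {zero}  u d = symₚ (transₚ (∷-cong R.refl 0∷[]≈[]) 0∷[]≈[])
      sum-linear {suc m} u d = transₚ (+ₚ-cong (const-* (u zero) 0# (d zero)) (sum-linear (u ∘ suc) (d ∘ suc)))
        (∷-cong (R.trans (R.+-identityʳ _) (R.zeroʳ (u zero))) (reflₚ {u zero * d zero + ∑ᴿ (λ i → u (suc i) * d (suc i)) ∷ []}))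

      basis : Vector Poly (n ℕ.+ n)
      basis i = [ (λ j → φ (D.basis j)) , (λ j → 0# ∷ D.basis j ∷ []) ]′ (splitAt n i)

      combination : ∀ (u : Vector k.Carrier (n ℕ.+ n)) → sum (λ i → φ (ι (u i)) B.* basis i) B.≈
        ∑ᴿ (λ i → ι (u (i ↑ˡ n)) * D.basis i) ∷ ∑ᴿ (λ i → ι (u (n ↑ʳ i)) * D.basis i) ∷ []
      combination u = B.trans (sum-split n (λ i → φ (ι (u i)) B.* basis i)) (B.trans
        (B.+-cong
          (BI.sum-cong λ i → B.reflexive (≡.cong (λ s → φ (ι (u (i ↑ˡ n))) B.* [ (λ j → φ (D.basis j)) , (λ j → 0# ∷ D.basis j ∷ []) ]′ s) (Fin.splitAt-↑ˡ n i n)))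
          (BI.sum-cong λ i → B.reflexive (≡.cong (λ s → φ (ι (u (n ↑ʳ i))) B.* [ (λ j → φ (D.basis j)) , (λ j → 0# ∷ D.basis j ∷ []) ]′ s) (Fin.splitAt-↑ʳ n n i))))
        (≈⇒≈ᵐ (transₚ (+ₚ-cong (sum-constant (λ i → ι (u (i ↑ˡ n))) D.basis) (sum-linear (λ i → ι (u (n ↑ʳ i))) D.basis))
          (∷-cong (R.+-identityʳ _) (∷-cong (R.+-identityˡ _) (reflₚ {[]}))))))

      left right : Vector k.Carrier (n ℕ.+ n) → Carrier
      left u  = ∑ᴿ (λ i → ι (u (i ↑ˡ n)) * D.basis i)
      right u = ∑ᴿ (λ i → ι (u (n ↑ʳ i)) * D.basis i)

      total : Vector k.Carrier (n ℕ.+ n) → Poly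
      total u = sum (λ i → φ (ι (u i)) B.* basis i)

      append : Vector k.Carrier n → Vector k.Carrier n → Vector k.Carrier (n ℕ.+ n)
      append u₀ u₁ i = [ u₀ , u₁ ]′ (splitAt n i)

      left-append : ∀ u₀ u₁ → ∑ᴿ (λ i → ι (u₀ i) * D.basis i) ≈ left (append u₀ u₁)
      left-append u₀ u₁ = RI.sum-cong λ i → R.reflexive (≡.cong (λ s → ι ([ u₀ , u₁ ]′ s) * D.basis i) (≡.sym (Fin.splitAt-↑ˡ n i n)))

      right-append : ∀ u₀ u₁ → ∑ᴿ (λ i → ι (u₁ i) * D.basis i) ≈ right (append u₀ u₁)
      right-append u₀ u₁ = RI.sum-cong λ i → R.reflexive (≡.cong (λ s → ι ([ u₀ , u₁ ]′ s) * D.basis i) (≡.sym (Fin.splitAt-↑ʳ n n i)))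

      difference : ∀ f s b₀ b₁ l r → f B.≈ b₀ ∷ b₁ ∷ [] → s B.≈ l ∷ r ∷ [] → b₀ - l ∈ RI.multiples p → b₁ - r ∈ RI.multiples p → f B.- s ∈ pB
      difference f s b₀ b₁ l r f≈ s≈ ∈₀ ∈₁ = pB.resp {b₀ - l ∷ b₁ - r ∷ []} {f B.- s}
        (B.sym {f B.- s} {b₀ - l ∷ b₁ - r ∷ []} (B.+-cong {f} {b₀ ∷ b₁ ∷ []} {B.- s} {B.- (l ∷ r ∷ [])} f≈ (B.-‿cong {s} {l ∷ r ∷ []} s≈)))
        (⇒reduced∈ ∈₀ ∈₁)

      spanning : ∀ f → Σ[ u ∈ Vector k.Carrier (n ℕ.+ n) ] f B.- total u ∈ pB
      spanning f = let b₀ , b₁ , f≈ = reduce f in go b₀ b₁ f≈ (D.spanning b₀) (D.spanning b₁)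
        where
        go : ∀ b₀ b₁ → f B.≈ b₀ ∷ b₁ ∷ [] →
          Σ[ u ∈ Vector k.Carrier n ] b₀ - ∑ᴿ (λ i → ι (u i) * D.basis i) ∈ RI.multiples p →
          Σ[ u ∈ Vector k.Carrier n ] b₁ - ∑ᴿ (λ i → ι (u i) * D.basis i) ∈ RI.multiples p →
          Σ[ u ∈ Vector k.Carrier (n ℕ.+ n) ] f B.- total u ∈ pB
        go b₀ b₁ f≈ (u₀ , ∈₀) (u₁ , ∈₁) = u , difference f (total u) b₀ b₁ (left u) (right u) f≈ (combination u)
          (p.resp (R.+-congˡ {b₀} (R.-‿cong (left-append u₀ u₁))) ∈₀) (p.resp (R.+-congˡ {b₁} (R.-‿cong (right-append u₀ u₁))) ∈₁)
          where
          u = append u₀ u₁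

      independent : ∀ (u : Vector k.Carrier (n ℕ.+ n)) → total u ∈ pB → ∀ i → φ (ι (u i)) ∈ pB
      independent u u∈ i = go (reduced∈⇒ {left u} {right u} (pB.resp {total u} {left u ∷ right u ∷ []} (combination u) u∈)) (splitAt n i) ≡.refl
        where
        go : left u ∈ RI.multiples p × right u ∈ RI.multiples p → ∀ s → splitAt n i ≡ s → φ (ι (u i)) ∈ pB
        go (∈₀ , ∈₁) (inj₁ j) eq = ≡.subst (λ i → φ (ι (u i)) ∈ pB) (Fin.splitAt⁻¹-↑ˡ eq) (φ-multiples (D.independent (λ i → u (i ↑ˡ n)) ∈₀ j))
        go (∈₀ , ∈₁) (inj₂ j) eq = ≡.subst (λ i → φ (ι (u i)) ∈ pB) (Fin.splitAt⁻¹-↑ʳ eq) (φ-multiples (D.independent (λ i → u (n ↑ʳ i)) ∈₁ j))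

    -- The residue field is R/(p) ⊕ R/(p) y, so a basis of R/(p) together with its multiples by y is
    -- a basis.
    degree : ResidueDegree k B (φ ∘ ι) point (n ℕ.+ n)
    degree = record { basis = basis ; spanning = spanning ; independent = independent }

-- Transfer between rings that differ only in the proofs of their axioms.

module RingTransfer {a ℓ} {Carrier : Set a} {_≈_ : Carrier → Carrier → Set ℓ} {_+_ _*_ : Carrier → Carrier → Carrier}
  { -_ : Carrier → Carrier} {0# 1# : Carrier}
  (isRing₁ isRing₂ : IsCommutativeRing _≈_ _+_ _*_ -_ 0# 1#) where

  private
    R₁ R₂ : CommutativeRing a ℓ
    R₁ = record { isCommutativeRing = isRing₁ }
    R₂ = record { isCommutativeRing = isRing₂ }
    module I₁ = Ideals R₁
    module I₂ = Ideals R₂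

  maximalIdeal : I₁.MaximalIdeal → I₂.MaximalIdeal
  maximalIdeal P = record
    { ideal   = P.ideal
    ; isIdeal = record { resp = P.resp ; 0∈ = P.0∈ ; +∈ = P.+∈ ; *∈ = P.*∈ }
    ; proper  = P.proper
    ; maximal = P.maximal }
    where module P = I₁.MaximalIdeal P

  power : ∀ {I} n {x} → (I I₁.^ n) x → (I I₂.^ n) x
  power zero    _ = tt
  power (suc n) (m , u , v , u∈ , v∈ , e) = m , u , v , u∈ , (λ i → power n (v∈ i)) , e

  module _ {b ℓ′} (A : CommutativeRing b ℓ′) (φ : CommutativeRing.Carrier A → Carrier) where

    residueDegree : ∀ {P n} → ResidueDegree A R₁ φ P n → ResidueDegree A R₂ φ (maximalIdeal P) n
    residueDegree D = record { basis = D.basis ; spanning = D.spanning ; independent = D.independent }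
      where module D = ResidueDegree D

module RamificationTransfer {a ℓ} {Carrier : Set a} {_≈_ : Carrier → Carrier → Set ℓ} {_+_ _*_ : Carrier → Carrier → Carrier}
  { -_ : Carrier → Carrier} {0# 1# : Carrier}
  (isRing₁ isRing₂ : IsCommutativeRing _≈_ _+_ _*_ -_ 0# 1#)
  {b ℓ′} (A : CommutativeRing b ℓ′) (φ : CommutativeRing.Carrier A → Carrier) where

  private
    R₁ R₂ : CommutativeRing a ℓ
    R₁ = record { isCommutativeRing = isRing₁ }
    R₂ = record { isCommutativeRing = isRing₂ }
    module T₁₂ = RingTransfer isRing₁ isRing₂
    module T₂₁ = RingTransfer isRing₂ isRing₁

  -- The non-inclusion is a negation, so for it powers are carried in the opposite direction.
  ramificationExponent : ∀ {P e} → RamificationExponent A R₁ φ P e → RamificationExponent A R₂ φ (T₁₂.maximalIdeal P) e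
  ramificationExponent {P} {e} (p⊆ , p⊈) =
    (λ x φx∈ → T₁₂.power {Ideals.ideal P} e (p⊆ x φx∈)) ,
    λ q → p⊈ λ x φx∈ → T₂₁.power {Ideals.ideal P} (suc e) (q x φx∈)

-- The three types of fibre over a prime of k[x].

module PrimeFibres {c ℓ} (k : FiniteField c ℓ) (B : CommutativeRing c (c ⊔ ℓ))
  (φ : List (FiniteField.Carrier k) → CommutativeRing.Carrier B) where

  private
    module k = FiniteField k
    module x = Polynomial k.commutativeRing
  open Curves k using (k[x])
  open FieldPolynomials k
  open Prime
  open Ideals B

  HasDegree : MaximalIdeal → ℕ → Set (c ⊔ ℓ)
  HasDegree = ResidueDegree k.commutativeRing B (φ ∘ x.const)

  record RamifiedFibre (𝔭 : Prime) : Set (lsuc (c ⊔ ℓ)) where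
    field
      point    : MaximalIdeal
      over     : φ (poly 𝔭) ∈ ideal point
      degree   : HasDegree point (suc (deg-1 𝔭))
      exponent : RamificationExponent k[x] B φ point 2
      only     : ∀ Q → φ (poly 𝔭) ∈ ideal Q → ideal Q ≐ ideal point

  record SplitFibre (𝔭 : Prime) : Set (lsuc (c ⊔ ℓ)) where
    field
      point₁ point₂ : MaximalIdeal
      over₁     : φ (poly 𝔭) ∈ ideal point₁
      over₂     : φ (poly 𝔭) ∈ ideal point₂
      degree₁   : HasDegree point₁ (suc (deg-1 𝔭))
      degree₂   : HasDegree point₂ (suc (deg-1 𝔭))
      exponent₁ : RamificationExponent k[x] B φ point₁ 1
      exponent₂ : RamificationExponent k[x] B φ point₂ 1
      relative₁ : ResidueDegree k[x] B φ point₁ 1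
      relative₂ : ResidueDegree k[x] B φ point₂ 1
      distinct  : ¬ ideal point₁ ≐ ideal point₂
      only      : ∀ Q → φ (poly 𝔭) ∈ ideal Q → ideal Q ≐ ideal point₁ ⊎ ideal Q ≐ ideal point₂

  -- The residue degree 2 over k[x] enters through `¬relative`, which is what rules out `Split`.
  record InertFibre (𝔭 : Prime) : Set (lsuc (c ⊔ ℓ)) where
    field
      point     : MaximalIdeal
      over      : φ (poly 𝔭) ∈ ideal point
      degree    : HasDegree point (suc (deg-1 𝔭) ℕ.+ suc (deg-1 𝔭))
      exponent  : RamificationExponent k[x] B φ point 1
      ¬relative : ¬ ResidueDegree k[x] B φ point 1
      only      : ∀ Q → φ (poly 𝔭) ∈ ideal Q → ideal Q ≐ ideal point

module FibreTransfer {c ℓ} (k : FiniteField c ℓ) {Carrier : Set c} {_≈_ : Carrier → Carrier → Set (c ⊔ ℓ)} {_+_ _*_ : Carrier → Carrier → Carrier}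
  { -_ : Carrier → Carrier} {0# 1# : Carrier}
  (isRing₁ isRing₂ : IsCommutativeRing _≈_ _+_ _*_ -_ 0# 1#)
  (φ : List (FiniteField.Carrier k) → Carrier) where

  private
    R₁ R₂ : CommutativeRing c (c ⊔ ℓ)
    R₁ = record { isCommutativeRing = isRing₁ }
    R₂ = record { isCommutativeRing = isRing₂ }
    module F₁ = PrimeFibres k R₁ φ
    module F₂ = PrimeFibres k R₂ φ
    module T₁₂ = RingTransfer isRing₁ isRing₂
    module T₂₁ = RingTransfer isRing₂ isRing₁

    k[x] = Curves.k[x] k

    degree : ∀ {P n} → F₁.HasDegree P n → F₂.HasDegree (T₁₂.maximalIdeal P) n
    degree {P} = T₁₂.residueDegree (FiniteField.commutativeRing k) (φ ∘ Polynomial.const (FiniteField.commutativeRing k)) {P}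

    exponent : ∀ {P e} → RamificationExponent k[x] R₁ φ P e → RamificationExponent k[x] R₂ φ (T₁₂.maximalIdeal P) e
    exponent {P} {e} = RamificationTransfer.ramificationExponent isRing₁ isRing₂ k[x] φ {P} {e}

  ramifiedFibre : ∀ {𝔭} → F₁.RamifiedFibre 𝔭 → F₂.RamifiedFibre 𝔭
  ramifiedFibre F = record
    { point    = T₁₂.maximalIdeal F.point
    ; over     = F.over
    ; degree   = degree {F.point} F.degree
    ; exponent = exponent {F.point} {2} F.exponent
    ; only     = λ Q → F.only (T₂₁.maximalIdeal Q) }
    where module F = F₁.RamifiedFibre F

  splitFibre : ∀ {𝔭} → F₁.SplitFibre 𝔭 → F₂.SplitFibre 𝔭
  splitFibre F = record
    { point₁    = T₁₂.maximalIdeal F.point₁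
    ; point₂    = T₁₂.maximalIdeal F.point₂
    ; over₁     = F.over₁
    ; over₂     = F.over₂
    ; degree₁   = degree {F.point₁} F.degree₁
    ; degree₂   = degree {F.point₂} F.degree₂
    ; exponent₁ = exponent {F.point₁} {1} F.exponent₁
    ; exponent₂ = exponent {F.point₂} {1} F.exponent₂
    ; relative₁ = T₁₂.residueDegree k[x] φ {F.point₁} F.relative₁
    ; relative₂ = T₁₂.residueDegree k[x] φ {F.point₂} F.relative₂
    ; distinct  = F.distinct
    ; only      = λ Q → F.only (T₂₁.maximalIdeal Q) }
    where module F = F₁.SplitFibre F

  inertFibre : ∀ {𝔭} → F₁.InertFibre 𝔭 → F₂.InertFibre 𝔭
  inertFibre F = record
    { point     = T₁₂.maximalIdeal F.point
    ; over      = F.over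
    ; degree    = degree {F.point} F.degree
    ; exponent  = exponent {F.point} {1} F.exponent
    ; ¬relative = λ D → F.¬relative (T₂₁.residueDegree k[x] φ {T₁₂.maximalIdeal F.point} D)
    ; only      = λ Q → F.only (T₂₁.maximalIdeal Q) }
    where module F = F₁.InertFibre F

-- Double covers of the affine line over a finite field.

module DoubleCovers {c ℓ} (k : FiniteField c ℓ) (h g : List (FiniteField.Carrier k)) where

  private
    module k = FiniteField k
    module x = Polynomial k.commutativeRing
    module PP = PolynomialProperties k.commutativeRing
  open Curves k using (k[x])
  open FieldPolynomials k
  open Prime
  open PrimeResidueField k renaming (residueDegree to ⟨⟩-residueDegree)
  private
    module A = CommutativeRing k[x]
    module AI = IdealProperties k[x]
    module SA = IntegerCoefficients k[x]
  open A using (Carrier; _≈_; _+_; _*_; _-_; -_; 0#; 1#)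
  open Quadratic k[x] h g
  open QuadraticExtension k[x] h g
  open PolynomialProperties k[x] using (eval; X-_)
  open Polynomial k[x] using () renaming (const to φ)
  open Ideals B
  private
    module B = CommutativeRing B
    module BI = IdealProperties B

  open PrimeFibres k B φ

  -- If x is invertible at Q with inverse b, then the norm of 1 - b x is a nonzero polynomial in Q.
  below : ∀ Q → ∃[ 𝔭 ] φ (poly 𝔭) ∈ ideal Q
  below Q = case (maximal (φ x.X))
    where
    open BI.MaximalIdealProperties Q
    prime-below : ∀ {f} → φ f ∈ ideal Q → ¬ f ≈ 0# → ∃[ 𝔭 ] φ (poly 𝔭) ∈ ideal Q
    prime-below = generator (contraction-isIdeal Q) proper
      (λ {a} {b} ab∈ → prime {φ a} {φ b} (resp {φ (a * b)} {φ a B.* φ b} (φ-* a b) ab∈)) (λ f → ∈? (φ f))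
    -- It has the form 1 - x t, so its constant coefficient is 1.
    unit-norm≉0 : ∀ b₀ b₁ → ¬ unit-norm x.X b₀ b₁ ≈ 0#
    unit-norm≉0 b₀ b₁ e = k.1≉0 (k.trans (k.sym (coeff₀ ((b₀ + (b₀ - b₁ * h)) - x.X * norm b₀ b₁))) (x.at e 0))
      where
      open import Algebra.Properties.Ring k.ring using (-0#≈0#)
      coeff₀ : ∀ t → x.coeff (1# - x.X * t) 0 k.≈ k.1#
      coeff₀ t = k.trans (x.coeff-+ (x.const k.1#) (x.-ₚ (x.X x.*ₚ t)) 0) (k.trans (k.+-congˡ (k.trans (x.coeff-neg (x.X x.*ₚ t) 0)
        (k.trans (k.-‿cong (k.trans (PP.coeff-∷* k.0# (k.1# ∷ []) t 0) (k.trans (k.+-identityʳ _) (k.zeroˡ _)))) -0#≈0#))) (k.+-identityʳ _))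
    case : φ x.X ∈ ideal Q ⊎ (∃[ b ] B.1# B.- b B.* φ x.X ∈ ideal Q) → ∃[ 𝔭 ] φ (poly 𝔭) ∈ ideal Q
    case (inj₁ x∈)        = prime-below x∈ λ e → k.1≉0 (x.at e 1)
    case (inj₂ (b , inv)) = let b₀ , b₁ , b≈ = reduce b in
      prime-below (unit-norm∈ Q x.X b b≈ inv) (unit-norm≉0 b₀ b₁)

  -- The contraction is a proper ideal containing (p), and (p) is maximal.
  contraction : ∀ Q 𝔭 → φ (poly 𝔭) ∈ ideal Q → AI.multiples (poly 𝔭) ≐ (λ a → φ a ∈ ideal Q)
  contraction Q 𝔭 p∈ = (λ {a} a∈ → φ∈ {ideal Q} {poly 𝔭} {a} Q.isIdeal′ p∈ a∈) ,
    λ {a} a∈ → proper⇒⊆ 𝔭 (contraction-isIdeal Q) Q.proper p∈ {a} a∈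
    where module Q = BI.MaximalIdealProperties Q

  -- In B the scalar - F(r) is the multiple (y - r) (y + h + r) of y - r.
  root-vanishes : ∀ Q r → X- r ∈ ideal Q → φ (eval r F) ∈ ideal Q
  root-vanishes Q r z∈ = vanishes (X- r) (X- (- h - r)) (φ 1# , conjugate-roots r) z∈
    where
    module Q = BI.MaximalIdealProperties Q
    vanishes : ∀ z z′ → z B.* z′ B.≈ φ (- eval r F) → z ∈ ideal Q → φ (eval r F) ∈ ideal Q
    vanishes z z′ e z∈ = Q.resp {B.- φ (- eval r F)} {φ (eval r F)} (φ-cong (-‿involutive (eval r F)))
      (Q.-∈ {φ (- eval r F)} (Q.resp {z B.* z′} {φ (- eval r F)} e (Q.*∈ʳ {z} z′ z∈)))
      where open import Algebra.Properties.Ring A.ring using (-‿involutive)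

  module _ (𝔭 : Prime) where

    private
      p = poly 𝔭
      module p = AI.MaximalIdealProperties ⟨ 𝔭 ⟩

      regular : ∀ {b} → b * p ≈ 0# → b ≈ 0#
      regular {b} = PP.*-cancelʳ-monic (monic 𝔭) {b} {[]}

    open QuadraticFibre k[x] h g p p.proper p.maximal regular
    open Fibre p p.proper p.maximal regular

    module Root (r : Carrier) (root : AI.multiples p (eval r F)) where

      open Point r root public using (point; over; X-r∈)

      root-degree : HasDegree point (suc (deg-1 𝔭))
      root-degree = Point.degree r root k.commutativeRing x.const (⟨⟩-residueDegree 𝔭)

      root-only : ∀ Q → φ p ∈ ideal Q → X- r ∈ ideal Q → ideal point ≐ ideal Q
      root-only Q p∈ z∈ = BI.maximal-⊆⇒≐ point Q (λ {f} → Point.point-⊆ r root (BI.MaximalIdealProperties.isIdeal′ Q) p∈ z∈ {f})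

    ramifiedFibre : ∀ r c b → eval r F ≈ c * p → r + r + h ≈ b * p → ¬ AI.multiples p c → RamifiedFibre 𝔭
    ramifiedFibre r c b root double c∉ = record
      { point    = Point.point r (c , root)
      ; over     = Point.over r (c , root)
      ; degree   = Point.degree r (c , root) k.commutativeRing x.const (⟨⟩-residueDegree 𝔭)
      ; exponent = Ramified.exponent r c b root double c∉
      ; only     = Ramified.only r c b root double c∉ }

    splitFibre : ∀ r → AI.multiples (p * p) (eval r F) → ¬ AI.multiples p (r + r + h) → SplitFibre 𝔭
    splitFibre r root simple = record
      { point₁    = S.P₁.point
      ; point₂    = S.P₂.point
      ; over₁     = S.P₁.over
      ; over₂     = S.P₂.over
      ; degree₁   = S.P₁.degree k.commutativeRing x.const (⟨⟩-residueDegree 𝔭)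
      ; degree₂   = S.P₂.degree k.commutativeRing x.const (⟨⟩-residueDegree 𝔭)
      ; exponent₁ = S.P₁.exponent
      ; exponent₂ = S.P₂.exponent
      ; relative₁ = S.P₁.relative-degree
      ; relative₂ = S.P₂.relative-degree
      ; distinct  = S.distinct
      ; only      = S.only }
      where module S = Split r root simple

    inertFibre : (∀ r → ¬ AI.multiples p (eval r F)) → InertFibre 𝔭
    inertFibre irreducible = record
      { point     = I.point
      ; over      = I.over
      ; degree    = I.degree k.commutativeRing x.const (⟨⟩-residueDegree 𝔭)
      ; exponent  = I.exponent
      ; ¬relative = I.¬relative-degree-1
      ; only      = I.only }
      where module I = InertQuadraticFibre k[x] h g p p.proper p.maximal regular irreducible

    -- Newton's step lifts a simple root modulo p to a root modulo p².
    liftFibre : ∀ r → AI.multiples p (eval r F) → ¬ AI.multiples p (r + r + h) → SplitFibre 𝔭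
    liftFibre r (c , root) simple = go (p.maximal (r + r + h))
      where
      go : AI.multiples p (r + r + h) ⊎ (∃[ u ] AI.multiples p (1# - u * (r + r + h))) → SplitFibre 𝔭
      go (inj₁ ∈p) = contradiction ∈p simple
      go (inj₂ (u , t , inv)) = splitFibre (r - c * p * u)
        (c * t + c * c * u * u , A.trans (eval-F (r - c * p * u)) (QuadraticIdentities.newton k[x] {r} {h} {g} {p} {c} {u} {t} (A.trans (A.sym (eval-F r)) root) inv))
        -- The lifted root differs from `r` by c p u, so 2 r + h changes by the multiple 2 c u of p
        -- and remains nonzero modulo p.
        λ r′∈ → simple (p.resp (lift r h c p u) (p.+∈ r′∈ (c * u + c * u , A.refl)))
        where
        lift : ∀ r h c p u → (r - c * p * u) + (r - c * p * u) + h + (c * u + c * u) * p ≈ r + r + h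
        lift = SA.solve 5 (λ r h c p u → (r SA.:- c SA.:* p SA.:* u) SA.:+ (r SA.:- c SA.:* p SA.:* u) SA.:+ h SA.:+ (c SA.:* u SA.:+ c SA.:* u) SA.:* p SA.:= r SA.:+ r SA.:+ h) A.refl

    -- Whether p divides F(r) depends only on `r` modulo p, so testing one representative of each
    -- class decides it.
    root? : (∃[ r ] AI.multiples p (eval r F)) ⊎ (∀ r → ¬ AI.multiples p (eval r F))
    root? = go (search (suc (deg-1 𝔭)) {λ m → AI.multiples p (eval m F)} (λ {m} {m′} e → p.resp (eval-congˡ m m′ e)) (λ {m} _ → multiple? (monic 𝔭) (eval m F)))
      where
      eval-congˡ : ∀ m m′ → m ≈ m′ → eval m F ≈ eval m′ F
      eval-congˡ m m′ e = A.trans (eval-F m) (A.trans (A.+-congʳ (A.+-cong (A.*-cong e e) (A.*-congˡ {h} e))) (A.sym (eval-F m′)))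
      -- Every residue class modulo p contains a monic polynomial of the degree of p.
      monic-representative : ∀ r → ∃[ s ] PP.Monic (suc (deg-1 𝔭)) (r + s * p)
      monic-representative r with PP.divide (monic 𝔭) r
      ... | s , r₀ , r≈ , r₀-below = 1# - s , PP.Leading-resp {p = r₀ + p} (A.trans (shuffle r₀ p s) (A.+-congʳ {(1# - s) * p} (A.sym r≈)))
        ( k.trans (x.coeff-+ r₀ p _) (k.trans (k.+-cong (r₀-below ℕ.≤-refl) (proj₁ (monic 𝔭))) (k.+-identityˡ _))
        , λ {i} d<i → k.trans (x.coeff-+ r₀ p i) (k.trans (k.+-cong (r₀-below (ℕ.<⇒≤ d<i)) (proj₂ (monic 𝔭) d<i)) (k.+-identityˡ _)))
        where
        shuffle : ∀ r₀ p s → r₀ + p ≈ (s * p + r₀) + (1# - s) * p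
        shuffle = SA.solve 3 (λ r₀ p s → r₀ SA.:+ p SA.:= (s SA.:* p SA.:+ r₀) SA.:+ (SA.con (+ 1) SA.:- s) SA.:* p) A.refl
      go : (∃[ m ] PP.Monic (suc (deg-1 𝔭)) m × AI.multiples p (eval m F)) ⊎ (∀ {m} → PP.Monic (suc (deg-1 𝔭)) m → ¬ AI.multiples p (eval m F)) →
        (∃[ r ] AI.multiples p (eval r F)) ⊎ (∀ r → ¬ AI.multiples p (eval r F))
      go (inj₁ (m , _ , root)) = inj₁ (m , root)
      go (inj₂ none) = inj₂ λ r r∈ → let s , mon = monic-representative r in
        none {r + s * p} mon (p.resp {_} {eval (r + s * p) F} (A.sym (A.trans (eval-F (r + s * p)) (translate r h g s p))) (p.+∈ (p.resp (eval-F r) r∈) ((r + r + h + s * p) * s , A.refl)))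
        where
        translate : ∀ r h g s p → (r + s * p) * (r + s * p) + h * (r + s * p) - g ≈ (r * r + h * r - g) + (r + r + h + s * p) * s * p
        translate = SA.solve 5 (λ r h g s p → (r SA.:+ s SA.:* p) SA.:* (r SA.:+ s SA.:* p) SA.:+ h SA.:* (r SA.:+ s SA.:* p) SA.:- g SA.:=
          (r SA.:* r SA.:+ h SA.:* r SA.:- g) SA.:+ (r SA.:+ r SA.:+ h SA.:+ s SA.:* p) SA.:* s SA.:* p) A.refl

    -- A root modulo p is double exactly if p divides F′(r) = 2 r + h, which division with remainder
    -- decides. The hypothesis `nonsingular` enters at a double root.
    fibre : (∀ r c b → eval r F ≈ c * p → r + r + h ≈ b * p → ¬ AI.multiples p c) →
      RamifiedFibre 𝔭 ⊎ SplitFibre 𝔭 ⊎ InertFibre 𝔭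
    fibre nonsingular = go root?
      where
      decide : ∀ r → AI.multiples p (eval r F) → Dec (AI.multiples p (r + r + h)) → RamifiedFibre 𝔭 ⊎ SplitFibre 𝔭
      decide r (c , root) (yes (b , double)) = inj₁ (ramifiedFibre r c b root double (nonsingular r c b root double))
      decide r (c , root) (no simple)        = inj₂ (liftFibre r (c , root) simple)
      go : (∃[ r ] AI.multiples p (eval r F)) ⊎ (∀ r → ¬ AI.multiples p (eval r F)) →
        RamifiedFibre 𝔭 ⊎ SplitFibre 𝔭 ⊎ InertFibre 𝔭
      go (inj₂ none)       = inj₂ (inj₂ (inertFibre none))
      go (inj₁ (r , root)) = [ inj₁ , inj₂ ∘ inj₁ ]′ (decide r root (multiple? (monic 𝔭) (r + r + h)))

RingAxioms : ∀ {a ℓ} → CommutativeRing a ℓ → Set (a ⊔ ℓ)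
RingAxioms R = IsCommutativeRing _≈_ _+_ _*_ -_ 0# 1#
  where open CommutativeRing R

-- The coordinate rings of the two charts of an elliptic curve are instances of B, but the definitional
-- equality is only feasible to check for the operations, so the proofs of the axioms may differ.
module Charts {c ℓ} (k : FiniteField c ℓ) (h g : List (FiniteField.Carrier k))
  (isRing₁ : RingAxioms (Quadratic.B (Curves.k[x] k) h g)) where

  open Curves k using (k[x])
  open FieldPolynomials k
  open Prime
  private
    module D = DoubleCovers k h g
    module A = CommutativeRing k[x]
    module Y = Polynomial k[x]

    B : CommutativeRing c (c ⊔ ℓ)
    B = Quadratic.B k[x] h g

    ring : CommutativeRing c (c ⊔ ℓ)
    ring = record { isCommutativeRing = isRing₁ }

    φ : A.Carrier → CommutativeRing.Carrier ring
    φ = Y.const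

    isRing₂ = CommutativeRing.isCommutativeRing B
    module T₁₂ = RingTransfer isRing₁ isRing₂
    module T₂₁ = RingTransfer isRing₂ isRing₁
    module F₂₁ = FibreTransfer k isRing₂ isRing₁ Y.const
  open PrimeFibres k ring φ public
  open Ideals ring

  ramifiedFibre : ∀ 𝔭 r c b → PolynomialProperties.eval k[x] r (Quadratic.F k[x] h g) A.≈ c A.* poly 𝔭 → r A.+ r A.+ h A.≈ b A.* poly 𝔭 →
    ¬ IdealProperties.multiples k[x] (poly 𝔭) c → RamifiedFibre 𝔭
  ramifiedFibre 𝔭 r c b root double c∉ = F₂₁.ramifiedFibre (D.ramifiedFibre 𝔭 r c b root double c∉)

  fibre : ∀ 𝔭 → (∀ r c b → PolynomialProperties.eval k[x] r (Quadratic.F k[x] h g) A.≈ c A.* poly 𝔭 → r A.+ r A.+ h A.≈ b A.* poly 𝔭 →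
    ¬ IdealProperties.multiples k[x] (poly 𝔭) c) → RamifiedFibre 𝔭 ⊎ SplitFibre 𝔭 ⊎ InertFibre 𝔭
  fibre 𝔭 nonsingular = Sum.map F₂₁.ramifiedFibre (Sum.map F₂₁.splitFibre F₂₁.inertFibre) (D.fibre 𝔭 nonsingular)

  below : ∀ Q → ∃[ 𝔭 ] φ (poly 𝔭) ∈ ideal Q
  below Q = D.below (T₁₂.maximalIdeal Q)

  contraction : ∀ Q 𝔭 → φ (poly 𝔭) ∈ ideal Q → Ideals.ideal ⟨ 𝔭 ⟩ ≐ (λ a → φ a ∈ ideal Q)
  contraction Q = D.contraction (T₁₂.maximalIdeal Q)

  root-vanishes : ∀ Q r → PolynomialProperties.X-_ k[x] r ∈ ideal Q → φ (PolynomialProperties.eval k[x] r (Quadratic.F k[x] h g)) ∈ ideal Q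
  root-vanishes Q = D.root-vanishes (T₁₂.maximalIdeal Q)

  module Root (𝔭 : Prime) (r : A.Carrier) (root : IdealProperties.multiples k[x] (poly 𝔭) (PolynomialProperties.eval k[x] r (Quadratic.F k[x] h g))) where

    private module R = D.Root 𝔭 r root

    point : MaximalIdeal
    point = T₂₁.maximalIdeal R.point

    over : φ (poly 𝔭) ∈ ideal point
    over = R.over

    X-r∈ : PolynomialProperties.X-_ k[x] r ∈ ideal point
    X-r∈ = R.X-r∈

    degree : HasDegree point (suc (deg-1 𝔭))
    degree = T₂₁.residueDegree (FiniteField.commutativeRing k) (φ ∘ Polynomial.const (FiniteField.commutativeRing k)) {R.point} R.root-degree

    only : ∀ Q → φ (poly 𝔭) ∈ ideal Q → PolynomialProperties.X-_ k[x] r ∈ ideal Q → ideal point ≐ ideal Q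
    only Q = R.root-only (T₁₂.maximalIdeal Q)

module QuotientHomomorphism {a ℓ} (R : CommutativeRing a ℓ) (w : CommutativeRing.Carrier R) where

  private module Q = PrincipalQuotient R w

  compose-hom : ∀ {b ℓ′} {k : CommutativeRing b ℓ′} {f : CommutativeRing.Carrier k → CommutativeRing.Carrier R} →
    RingMorphisms.IsRingHomomorphism (CommutativeRing.rawRing k) (CommutativeRing.rawRing R) f →
    RingMorphisms.IsRingHomomorphism (CommutativeRing.rawRing k) (CommutativeRing.rawRing Q.commutativeRing) f
  compose-hom f-hom = record
    { isSemiringHomomorphism = record
      { isNearSemiringHomomorphism = record
        { +-isMonoidHomomorphism = record
          { isMagmaHomomorphism = record
            { isRelHomomorphism = record { cong = λ e → Q.≈⇒≈ᵐ (f.⟦⟧-cong e) }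
            ; homo = λ x y → Q.≈⇒≈ᵐ (f.+-homo x y) }
          ; ε-homo = Q.≈⇒≈ᵐ f.0#-homo }
        ; *-homo = λ x y → Q.≈⇒≈ᵐ (f.*-homo x y) }
      ; 1#-homo = Q.≈⇒≈ᵐ f.1#-homo }
    ; -‿homo = λ x → Q.≈⇒≈ᵐ (f.-‿homo x) }
    where module f = RingMorphisms.IsRingHomomorphism f-hom

-- The two Weierstrass charts and the discriminant.

module WeierstrassCharts {c ℓ} (k : FiniteField c ℓ) (E : EllipticCurve k) where

  private
    module k = FiniteField k
  open EllipticCurve E
  open Curves k using (k[x]; ellipticCurve; module Curve)
  open Polynomial k.commutativeRing using (X; const; at; ∷-cong; 0∷-*; *ₚ-identityˡ; reflₚ; 0∷[]≈[]; const-isRingHomomorphism; +ₚ-cong)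
  open PolynomialProperties k.commutativeRing using (D; D-cong; D-+; D-neg; D-*)
  open FieldPolynomials k
  open Prime
  private
    module A = CommutativeRing k[x]
    module AI = IdealProperties k[x]
    module SA = IntegerCoefficients k[x]
    module R = SetoidReasoning A.setoid
  open A using (Carrier; _≈_; _+_; _*_; _-_; -_; 0#; 1#)

  h g h∞ g∞ : Carrier
  h  = a₃ ∷ a₁ ∷ []
  g  = a₆ ∷ a₄ ∷ a₂ ∷ k.1# ∷ []
  h∞ = k.0# ∷ a₁ ∷ a₃ ∷ []
  g∞ = k.0# ∷ k.1# ∷ a₂ ∷ a₄ ∷ a₆ ∷ []

  X*-≈ : ∀ q → X * q ≈ k.0# ∷ q
  X*-≈ q = A.trans (0∷-* (const k.1#) q) (∷-cong k.refl (*ₚ-identityˡ q))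

  ∷-≈ : ∀ b q → b ∷ q ≈ const b + X * q
  ∷-≈ b q = A.sym (A.trans (+ₚ-cong (reflₚ {const b}) (X*-≈ q)) (∷-cong (k.+-identityʳ b) reflₚ))

  private
    -- Differentiating r² + h r - g, which is divisible by p², where r is a double root modulo p.
    derivative : ∀ {p} r c b h g → r * r + h * r - g ≈ c * p * p → r + r + h ≈ b * p → D h * r - D g ∈ AI.multiples p
    derivative {p} r c b h g root double = I.resp (R.begin
        (D c * p + c * D p + c * D p) * p - D r * b * p
          R.≈⟨ SA.solve 6 (λ dc p c dp dr b → (dc SA.:* p SA.:+ c SA.:* dp SA.:+ c SA.:* dp) SA.:* p SA.:- dr SA.:* b SA.:* p SA.:=
                 ((dc SA.:* p SA.:+ c SA.:* dp) SA.:* p SA.:+ c SA.:* p SA.:* dp) SA.:- dr SA.:* (b SA.:* p)) A.refl (D c) p c (D p) (D r) b ⟩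
        ((D c * p + c * D p) * p + c * p * D p) - D r * (b * p)
          R.≈⟨ A.+-cong (A.sym (A.trans (D-* (c * p) p) (A.+-congʳ {c * p * D p} (A.*-congʳ {p} (D-* c p))))) (A.-‿cong (A.*-congˡ {D r} (A.sym double))) ⟩
        D (c * p * p) - D r * (r + r + h)
          R.≈⟨ A.+-congʳ { - (D r * (r + r + h))} (D-cong (A.sym root)) ⟩
        D (r * r + h * r - g) - D r * (r + r + h)
          R.≈⟨ A.+-congʳ { - (D r * (r + r + h))} expand ⟩
        ((D r * r + r * D r) + (D h * r + h * D r) - D g) - D r * (r + r + h)
          R.≈⟨ SA.solve 5 (λ dr r dh h dg → ((dr SA.:* r SA.:+ r SA.:* dr) SA.:+ (dh SA.:* r SA.:+ h SA.:* dr) SA.:- dg) SA.:- dr SA.:* (r SA.:+ r SA.:+ h) SA.:= dh SA.:* r SA.:- dg) A.refl (D r) r (D h) h (D g) ⟩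
        D h * r - D g R.∎)
        (I.+∈ (D c * p + c * D p + c * D p , A.refl) (I.-∈ (D r * b , A.refl)))
      where
      module I = AI.IsIdealProperties (AI.multiples-isIdeal p)
      expand : D (r * r + h * r - g) ≈ (D r * r + r * D r) + (D h * r + h * D r) - D g
      expand = A.trans (D-+ (r * r + h * r) (- g)) (A.+-cong (A.trans (D-+ (r * r) (h * r)) (A.+-cong (D-* r r) (D-* h r))) (D-neg g))

    module Singular (p : Carrier) where

      module Q = PrincipalQuotient k[x] p
      Q : CommutativeRing _ _
      Q = Q.commutativeRing
      module ΔQ = Discriminant Q
      const-hom = QuotientHomomorphism.compose-hom k[x] p {k = k.commutativeRing} {const} const-isRingHomomorphism

      Dh : D h ≈ const a₁
      Dh = ∷-cong (k.+-identityʳ a₁) 0∷[]≈[]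

      α₁ α₂ α₃ α₄ α₆ : Carrier
      α₁ = const a₁
      α₂ = const a₂
      α₃ = const a₃
      α₄ = const a₄
      α₆ = const a₆

      g₂ g₄ : Carrier
      g₂ = a₂ ∷ k.1# ∷ []
      g₄ = a₄ ∷ g₂

      g₂-≈ : g₂ ≈ α₂ + X
      g₂-≈ = A.trans (∷-≈ a₂ (const k.1#)) (A.+-congˡ {α₂} (A.*-identityʳ X))

      g₄-≈ : g₄ ≈ α₄ + X * (α₂ + X)
      g₄-≈ = A.trans (∷-≈ a₄ g₂) (A.+-congˡ {α₄} (A.*-congˡ {X} g₂-≈))

      g-≈ : g ≈ α₆ + X * (α₄ + X * (α₂ + X))
      g-≈ = A.trans (∷-≈ a₆ g₄) (A.+-congˡ {α₆} (A.*-congˡ {X} g₄-≈))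

      h-≈ : h ≈ α₃ + X * α₁
      h-≈ = ∷-≈ a₃ (const a₁)

      Dg₂ : D g₂ ≈ 1#
      Dg₂ = A.trans (A.+-congˡ {1#} (A.trans (∷-cong k.refl 0∷[]≈[]) 0∷[]≈[])) (A.+-identityʳ 1#)

      Dg₄ : D g₄ ≈ (α₂ + X) + X
      Dg₄ = A.+-cong g₂-≈ (A.trans (A.sym (X*-≈ (D g₂))) (A.trans (A.*-congˡ {X} Dg₂) (A.*-identityʳ X)))

      Dg : D g ≈ α₄ + (α₂ + α₂) * X + (X * X + X * X + X * X)
      Dg = A.trans (A.+-cong g₄-≈ (A.trans (A.sym (X*-≈ (D g₄))) (A.*-congˡ {X} Dg₄))) (collect α₂ α₄ X)
        where
        collect : ∀ a₂ a₄ x → (a₄ + x * (a₂ + x)) + x * ((a₂ + x) + x) ≈ a₄ + (a₂ + a₂) * x + (x * x + x * x + x * x)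
        collect = SA.solve 3 (λ a₂ a₄ x → (a₄ SA.:+ x SA.:* (a₂ SA.:+ x)) SA.:+ x SA.:* ((a₂ SA.:+ x) SA.:+ x) SA.:=
          a₄ SA.:+ (a₂ SA.:+ a₂) SA.:* x SA.:+ (x SA.:* x SA.:+ x SA.:* x SA.:+ x SA.:* x)) A.refl

      module _ (r c b : Carrier) (root : r * r + h * r - g ≈ c * p * p) (double : r + r + h ≈ b * p) where

        ∂y : r + r + α₁ * X + α₃ Q.≈ᵐ 0#
        ∂y = b , A.trans (A.trans (shuffle r α₁ X α₃) (A.+-congˡ {r + r} (A.sym h-≈))) double
          where
          shuffle : ∀ r a₁ x a₃ → r + r + a₁ * x + a₃ ≈ r + r + (a₃ + x * a₁)
          shuffle = SA.solve 4 (λ r a₁ x a₃ → r SA.:+ r SA.:+ a₁ SA.:* x SA.:+ a₃ SA.:= r SA.:+ r SA.:+ (a₃ SA.:+ x SA.:* a₁)) A.refl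

        ∂x : α₁ * r Q.≈ᵐ α₄ + (α₂ + α₂) * X + (X * X + X * X + X * X)
        ∂x = let m , e = derivative r c b h g root double in m ,
          A.trans (A.*-congʳ {r} (A.sym Dh)) (A.trans (shuffle (D h * r) (D g)) (A.+-cong Dg e))
          where
          shuffle : ∀ u v → u ≈ v + (u - v)
          shuffle = SA.solve 2 (λ u v → u SA.:= v SA.:+ (u SA.:- v)) A.refl

        equation : r * r + (α₃ + X * α₁) * r Q.≈ᵐ α₆ + X * (α₄ + X * (α₂ + X))
        equation = c * p , A.trans (A.+-congˡ {r * r} (A.*-congʳ {r} (A.sym h-≈))) (A.trans (shuffle (r * r + h * r) g) (A.+-cong g-≈ root))
          where
          shuffle : ∀ u v → u ≈ v + (u - v)
          shuffle = SA.solve 2 (λ u v → u SA.:= v SA.:+ (u SA.:- v)) A.refl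

        -- (X , r) is a point of the Weierstrass equation over k[x]/(p) at which both partial
        -- derivatives vanish. For the derivative in x, divisibility of F(r) by p² is essential: the
        -- equation is differentiated once and must remain divisible by p.
        constΔ∈ : const Δ ∈ AI.multiples p
        constΔ∈ = Q.transᵐ (DiscriminantHomomorphism.Δ-homo k.commutativeRing Q const-hom a₁ a₂ a₃ a₄ a₆)
          (ΔQ.singular⇒Δ≈0 α₁ α₂ α₃ α₄ α₆ X r ∂y ∂x equation)

  -- If p divided `c`, the cover would be singular at (p , y - r) and Δ would lie in (p). But Δ is a
  -- nonzero constant, hence a unit.
  nonsingular : ∀ 𝔭 r c b → r * r + h * r - g ≈ c * poly 𝔭 → r + r + h ≈ b * poly 𝔭 → ¬ AI.multiples (poly 𝔭) c
  nonsingular 𝔭 r c b root double (c′ , c≈) = case (k.inverse Δ Δ≉0)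
    where
    module p = AI.MaximalIdealProperties ⟨ 𝔭 ⟩
    Δ∈ : const Δ ∈ AI.multiples (poly 𝔭)
    Δ∈ = Singular.constΔ∈ (poly 𝔭) r c′ b (A.trans root (A.*-congʳ {poly 𝔭} c≈)) double
    case : ∃[ u ] Δ k.* u k.≈ k.1# → ⊥
    case (u , Δu≈1) = p.proper (p.resp {const Δ * const u} {1#} (∷-cong (k.trans (k.+-identityʳ _) Δu≈1) reflₚ) (p.*∈ʳ (const u) Δ∈))

  private module C = Curve (ellipticCurve E)
  module Affine = Charts k h g (CommutativeRing.isCommutativeRing C.Aff.ring)
  module Infinity = Charts k h∞ g∞ (CommutativeRing.isCommutativeRing C.Inf.ring)

  fibre : ∀ 𝔭 → Affine.RamifiedFibre 𝔭 ⊎ Affine.SplitFibre 𝔭 ⊎ Affine.InertFibre 𝔭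
  fibre 𝔭 = Affine.fibre 𝔭 λ r c b root double → nonsingular 𝔭 r c b (A.trans (A.sym (Quadratic.eval-F k[x] h g r)) root) double

  -- Over t = 0 the root is 0: F(0) = - t (1 + a₂ t + a₄ t² + a₆ t³), and 2 · 0 + `h∞` = t (a₁ + a₃
  -- t). The cofactor `- q` has constant term - 1 and is therefore not divisible by t.
  fibre∞ : Infinity.RamifiedFibre X-prime
  fibre∞ = Infinity.ramifiedFibre X-prime 0# (- q) (a₁ ∷ a₃ ∷ []) root double λ { (s , c≈) → c∉ s c≈ }
    where
    q : Carrier
    q = k.1# ∷ a₂ ∷ a₄ ∷ a₆ ∷ []
    root : PolynomialProperties.eval k[x] 0# (Quadratic.F k[x] h∞ g∞) ≈ - q * X
    root = A.trans (A.+-identityʳ (- g∞)) (A.trans (A.-‿cong (A.sym (X*-≈ q))) (shuffle X q))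
      where
      shuffle : ∀ x q → - (x * q) ≈ - q * x
      shuffle = SA.solve 2 (λ x q → SA.:- (x SA.:* q) SA.:= (SA.:- q) SA.:* x) A.refl
    double : 0# + 0# + h∞ ≈ (a₁ ∷ a₃ ∷ []) * X
    double = A.trans (A.sym (X*-≈ (a₁ ∷ a₃ ∷ []))) (A.*-comm X (a₁ ∷ a₃ ∷ []))
    c∉ : ∀ s → ¬ - q ≈ s * X
    c∉ s c≈ = k.1≉0 (k.trans (k.sym (-‿involutive k.1#)) (k.trans (k.-‿cong (at (A.trans c≈ (A.trans (A.*-comm s X) (X*-≈ s))) 0)) -0#≈0#))
      where open import Algebra.Properties.Ring k.ring using (-‿involutive; -0#≈0#)

-- Degrees, fibres and degree-one cycles on a curve over the projective line.

module CurveProperties {c ℓ} (k : FiniteField c ℓ) {ℓ₁} (C : Curves.Curve k ℓ₁) where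

  open ⊎ using (inj₁; inj₂)
  private module k = FiniteField k
  open Curves k
  open Curve C hiding (Sym)
  open Setoid points using (_≈_)
  open Polynomial k.commutativeRing using (const; const-isRingHomomorphism)

  private

    module Chart {ℓ₂} (A : AffineCover ℓ₂) where
      open AffineCover A
      private module B = CommutativeRing ring
      scalar-hom : RingMorphisms.IsRingHomomorphism k.rawRing B.rawRing (φ ∘ const)
      scalar-hom = Composition.isRingHomomorphism B.trans const-isRingHomomorphism isRingHomomorphism
      module D = FiniteResidueDegree k ring (φ ∘ const) scalar-hom
      module R = ResidueDegreeProperties k.commutativeRing ring (φ ∘ const)
      module Rx = ResidueDegreeProperties k[x] ring φ

    module Aff′ = Chart affine
    module Inf′ = Chart infinity

  degree-unique : ∀ {x y d e} → x ≈ y → HasDegree x d → HasDegree y e → d ≡ e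
  degree-unique {inj₁ P} {inj₁ Q} (inj₁ e) = Aff′.D.ResidueDegree-unique {P} {Q} e
  degree-unique {inj₂ (P , _)} {inj₂ (Q , _)} (inj₂ e) = Inf′.D.ResidueDegree-unique {P} {Q} e

  degree-positive : ∀ {x} → ¬ HasDegree x 0
  degree-positive {inj₁ P}       = Aff′.R.ResidueDegree-positive {P}
  degree-positive {inj₂ (P , _)} = Inf′.R.ResidueDegree-positive {P}

  index-resp : ∀ {x y e} → x ≈ y → HasRamificationIndex x e → HasRamificationIndex y e
  index-resp {inj₁ P} {inj₁ Q} {i} (inj₁ e) = Aff′.Rx.RamificationExponent-resp {P} {Q} {i} e
  index-resp {inj₂ (P , _)} {inj₂ (Q , _)} {i} (inj₂ e) = Inf′.Rx.RamificationExponent-resp {P} {Q} {i} e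

  residue-resp : ∀ {x y f} → x ≈ y → HasResidueDegree x f → HasResidueDegree y f
  residue-resp {inj₁ P} {inj₁ Q} (inj₁ e) = Aff′.Rx.ResidueDegree-resp {P} {Q} e
  residue-resp {inj₂ (P , _)} {inj₂ (Q , _)} (inj₂ e) = Inf′.Rx.ResidueDegree-resp {P} {Q} e

  open Cycles points HasDegree (λ {x} {y} → degree-unique {x} {y}) public

  private module ↭ᵖ = Permutation points

  -- Every point has positive degree, so there is no room for a second one.
  degree-one-cycle : ∀ {α} → Degrees 1 α → ∃[ y ] HasDegree y 1 × α ≡ y ∷ []
  degree-one-cycle ([] , [] , ())
  degree-one-cycle (d ∷ [] , _∷_ {x = y} deg [] , eq) = y , ≡.subst (HasDegree y) (≡.trans (≡.sym (ℕ.+-identityʳ d)) eq) deg , ≡.refl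
  degree-one-cycle (zero ∷ _ , _∷_ {x = y} deg _ , _) = contradiction deg (degree-positive {y})
  degree-one-cycle (suc d ∷ zero ∷ _ , _ ∷ _∷_ {x = z} deg _ , _) = contradiction deg (degree-positive {z})
  degree-one-cycle (suc d ∷ suc e ∷ _ , _ ∷ _ ∷ _ , eq) with () ← ≡.trans (≡.sym (ℕ.+-suc d _)) (ℕ.suc-injective eq)

  module _ {a ℓ₂} (T : Setoid a ℓ₂) (f : Setoid.Carrier T → Point) where

    private module T = Setoid T

    -- Cycles of degree one are single points, so matching `T` with the points of degree one gives
    -- it the cardinality of Sym¹.
    points-of-degree-one : (∀ t → HasDegree (f t) 1) → (∀ {s t} → s T.≈ t → f s ≈ f t) →
      (∀ {s t} → f s ≈ f t → s T.≈ t) → (∀ y → HasDegree y 1 → ∃[ t ] f t ≈ y) →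
      Finite (Sym 1) → Finite T
    points-of-degree-one degree f-cong f-injective f-surjective = finite-reflect {S = T} {T = Sym 1}
      (λ t → f t ∷ [] , 1 ∷ [] , degree t ∷ [] , ≡.refl)
      (λ e → ↭ᵖ.prep (f-cong e) ↭ᵖ.↭-refl) (λ e → f-injective (singleton e)) surjective
      where
      singleton : ∀ {y z} → y ∷ [] ↭ᵖ.↭ z ∷ [] → y ≈ z
      singleton {y} e with ↭.∈-resp-↭ points {y} e (here (Setoid.refl points {y}))
      ... | here y≈z = y≈z
      surjective : ∀ (α : Setoid.Carrier (Sym 1)) → ∃[ t ] (f t ∷ []) ↭ᵖ.↭ proj₁ α
      surjective (α , h) = go (degree-one-cycle h)
        where
        go : ∃[ y ] HasDegree y 1 × α ≡ y ∷ [] → ∃[ t ] (f t ∷ []) ↭ᵖ.↭ α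
        go (y , deg , ≡.refl) = let t , e = f-surjective y deg in t , ↭ᵖ.prep e ↭ᵖ.↭-refl

  open Splitting C

  over-respˡ : ∀ {y y′} x → y ≈ y′ → y LiesOver x → y′ LiesOver x
  over-respˡ (inj₁ p) (inj₁ (y⊆y′ , y′⊆y)) (p⊆ , ⊆p) = (λ {f} f∈ → y⊆y′ (p⊆ f∈)) , λ {f} f∈ → ⊆p (y′⊆y f∈)
  over-respˡ (inj₂ p) (inj₂ (y⊆y′ , y′⊆y)) (p⊆ , ⊆p) = (λ {f} f∈ → y⊆y′ (p⊆ f∈)) , λ {f} f∈ → ⊆p (y′⊆y f∈)
  over-respˡ (inj₂ p) (inj₁ e) o = Polymorphic.⊥-elim o
  over-respˡ (inj₁ p) (inj₂ e) o = Polymorphic.⊥-elim o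

  over-respʳ : ∀ y {x x′} → Setoid._≈_ P¹.points x x′ → y LiesOver x → y LiesOver x′
  over-respʳ (inj₁ P) (inj₁ e) o = ≐-trans (≐-sym e) o
  over-respʳ (inj₂ P) (inj₂ e) o = ≐-trans (≐-sym e) o
  over-respʳ (inj₁ P) (inj₂ e) o = Polymorphic.⊥-elim o
  over-respʳ (inj₂ P) (inj₁ e) o = Polymorphic.⊥-elim o

  over-unique : ∀ y x x′ → y LiesOver x → y LiesOver x′ → Setoid._≈_ P¹.points x x′
  over-unique (inj₁ P) (inj₁ p) (inj₁ q) o o′ = inj₁ (≐-trans o (≐-sym o′))
  over-unique (inj₂ P) (inj₂ p) (inj₂ q) o o′ = inj₂ (≐-trans o (≐-sym o′))
  over-unique (inj₁ P) (inj₁ p) (inj₂ q) o o′ = Polymorphic.⊥-elim o′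
  over-unique (inj₁ P) (inj₂ p) q        o o′ = Polymorphic.⊥-elim o
  over-unique (inj₂ P) (inj₂ p) (inj₁ q) o o′ = Polymorphic.⊥-elim o′
  over-unique (inj₂ P) (inj₁ p) q        o o′ = Polymorphic.⊥-elim o

  Split-resp : ∀ {x x′} → Setoid._≈_ P¹.points x x′ → Split x → Split x′
  Split-resp {x} {x′} e s y o = s y (over-respʳ y {x′} {x} (Setoid.sym P¹.points e) o)

  Inert-resp : ∀ {x x′} → Setoid._≈_ P¹.points x x′ → Inert x → Inert x′
  Inert-resp {x} {x′} e (y , o , only , r) = y , over-respʳ y {x} {x′} e o ,
    (λ z o′ → only z (over-respʳ z {x′} {x} (Setoid.sym P¹.points e) o′)) , r

-- Closed points and cycles of the projective line.

module ProjectiveLine {c ℓ} (k : FiniteField c ℓ) where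

  open ⊎ using (inj₁; inj₂)
  open MonoidSum ℤ.+-0-monoid using (sum⁺-syntax; sum-cong-≗; sum-init-last)
  private module k = FiniteField k
  open Curves k
  open FieldPolynomials k
  open Prime
  open UniqueFactorisation k using (primesUpTo; primesUpTo-unique; primesUpTo-complete; divides⇒≈; count-monics) renaming (primes to primesSetoid; weighted to weightedPrimes)
  open PrimeResidueField k using (residueDegree)
  open Polynomial k.commutativeRing using (X; _≈ₚ_; symₚ; transₚ; at; *ₚ-identityˡ)
  open IdealProperties k[x]
  open Ideals k[x] using (MaximalIdeal; ideal)
  open CurveProperties k P¹ public
  open Setoid P¹.points using (_≈_)
  open SetoidMembership P¹.points using () renaming (_∈_ to _∈ᴾ_)
  private
    module k[x] = CommutativeRing k[x]

  affinePoint : Prime → P¹.Point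
  affinePoint 𝔭 = inj₁ ⟨ 𝔭 ⟩

  ∞ : P¹.Point
  ∞ = inj₂ (⟨ X-prime ⟩ , generator∈ X)

  generated : ∀ 𝔭 (P : MaximalIdeal) → poly 𝔭 ∈ ideal P → ideal ⟨ 𝔭 ⟩ ≐ ideal P
  generated 𝔭 P p∈ = maximal-⊆⇒≐ ⟨ 𝔭 ⟩ P (multiples-⊆ (MaximalIdeal.isIdeal P) p∈)

  -- A nonzero element of `P` is X or, if `b` inverts X modulo `P`, the element 1 - b X. It
  -- guarantees an irreducible polynomial in `P`, which then generates `P`.
  prime-of : ∀ (P : MaximalIdeal) → ∃[ 𝔭 ] ideal ⟨ 𝔭 ⟩ ≐ ideal P
  prime-of P = case (maximal X)
    where
    open MaximalIdealProperties P
    find : ∀ {f} → f ∈ ideal P → ¬ f ≈ₚ [] → ∃[ 𝔭 ] ideal ⟨ 𝔭 ⟩ ≐ ideal P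
    find {f} f∈ f≉0 = let 𝔭 , p∈ = generator isIdeal′ proper (λ {a} {b} → prime {a} {b}) ∈? f∈ f≉0 in 𝔭 , generated 𝔭 P p∈
    case : X ∈ ideal P ⊎ (∃[ b ] k[x].1# k[x].- b k[x].* X ∈ ideal P) → ∃[ 𝔭 ] ideal ⟨ 𝔭 ⟩ ≐ ideal P
    case (inj₁ X∈)        = find X∈ λ e → k.1≉0 (at e 1)
    case (inj₂ (b , inv)) = find inv λ e → MaximalIdeal.proper ⟨ X-prime ⟩ (b , x∙y⁻¹≈ε⇒x≈y k[x].1# (b k[x].* X) e)
      where open import Algebra.Properties.Ring k[x].ring using (x∙y⁻¹≈ε⇒x≈y)

  ⟨⟩-cong : ∀ 𝔭 𝔮 → poly 𝔭 ≈ₚ poly 𝔮 → ideal ⟨ 𝔭 ⟩ ≐ ideal ⟨ 𝔮 ⟩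
  ⟨⟩-cong 𝔭 𝔮 e = generated 𝔭 ⟨ 𝔮 ⟩ (k[x].1# , transₚ e (symₚ (*ₚ-identityˡ (poly 𝔮))))

  ⟨⟩-injective : ∀ 𝔭 𝔮 → ideal ⟨ 𝔭 ⟩ ≐ ideal ⟨ 𝔮 ⟩ → poly 𝔭 ≈ₚ poly 𝔮
  ⟨⟩-injective 𝔭 𝔮 (_ , ⊇) = divides⇒≈ 𝔭 𝔮 (⊇ (generator∈ (poly 𝔮)))

  pointsUpTo : ℕ → List P¹.Point
  pointsUpTo N = ∞ ∷ map affinePoint (primesUpTo N)

  pointsUpTo-unique : ∀ N → Unique P¹.points (pointsUpTo N)
  pointsUpTo-unique N = All.map⁺ (All.universal (λ _ ()) (primesUpTo N)) ∷
    Unique.map⁺ primesSetoid P¹.points (λ { {𝔭} {𝔮} (inj₁ e) → ⟨⟩-injective 𝔭 𝔮 e }) (primesUpTo-unique N)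

  affinePoint-degree : ∀ 𝔭 → P¹.HasDegree (affinePoint 𝔭) (suc (deg-1 𝔭))
  affinePoint-degree = residueDegree

  ∞-degree : P¹.HasDegree ∞ 1
  ∞-degree = residueDegree X-prime

  pointsUpTo-complete : ∀ N x {d} → P¹.HasDegree x d → d ℕ.≤ N → x ∈ᴾ pointsUpTo N
  pointsUpTo-complete N (inj₂ (P , X∈)) deg d≤N = here (inj₂ (≐-sym (generated X-prime P X∈)))
  pointsUpTo-complete N (inj₁ P) deg d≤N = let 𝔭 , e = prime-of P in
    there (Any.map⁺ (Any.map (λ {𝔮} p≈q → inj₁ (≐-trans (≐-sym e) (⟨⟩-cong 𝔭 𝔮 p≈q)))
      (primesUpTo-complete N 𝔭 (ℕ.≤-trans (ℕ.≤-reflexive (degree-unique {affinePoint 𝔭} {inj₁ P} (inj₁ e) (affinePoint-degree 𝔭) deg)) d≤N))))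

  -- Σ_n #Symⁿ P¹ tⁿ = 1 / (1 - t)(1 - qt)
  module _ (d : P¹.Point → ℕ) (degree : ∀ x → P¹.HasDegree x (suc (d x))) where

    withDegrees : List P¹.Point → Points
    withDegrees = map λ x → x , d x

    enumeration : ∀ N → Enumeration N
    enumeration N = record
      { list     = withDegrees (pointsUpTo N)
      ; graded   = All.map⁺ (All.universal degree (pointsUpTo N))
      ; unique   = ≡.subst (Unique P¹.points) (≡.sym (forget (pointsUpTo N))) (pointsUpTo-unique N)
      ; complete = λ {x} deg d≤N → ≡.subst (x ∈ᴾ_) (≡.sym (forget (pointsUpTo N))) (pointsUpTo-complete N x deg d≤N) }
      where
      forget : ∀ xs → map proj₁ (withDegrees xs) ≡ xs
      forget []       = ≡.refl
      forget (x ∷ xs) = cong (x ∷_) (forget xs)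

    count-cycles : ∀ {N} n → n ℕ.≤ N →
      eulerProduct (λ _ → 1ℤ) (withDegrees (pointsUpTo N)) n ≡ ∑[ m ≤ n ] (+ (k.order ℕ.^ toℕ m))
    -- The point at infinity heads the list. Its factor 1 / (1 - t) turns the coefficients qⁿ of the
    -- affine line into their partial sums.
    count-cycles {N} n n≤N = ≡.trans (recurrence (eulerProduct-∷ (λ _ → 1ℤ) ∞ (d ∞) (withDegrees (map affinePoint (primesUpTo N)))) n)
      (≡.trans (cong₂ (λ u v → u ℤ.+ 1ℤ ℤ.* v) affine (cong (λ d → shift (suc d) ζ n) d∞≡0)) (step n n≤N))
      where
      ζ = eulerProduct (λ _ → 1ℤ) (withDegrees (pointsUpTo N))
      d∞≡0 : d ∞ ≡ 0
      d∞≡0 = ℕ.suc-injective (degree-unique {∞} {∞} (Setoid.refl P¹.points {∞}) (degree ∞) ∞-degree)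
      weights : ∀ 𝔭s → map proj₂ (withDegrees (map affinePoint 𝔭s)) ≡ map proj₂ (weightedPrimes 𝔭s)
      weights []       = ≡.refl
      weights (𝔭 ∷ 𝔭s) = cong₂ _∷_ (ℕ.suc-injective (degree-unique {affinePoint 𝔭} {affinePoint 𝔭}
        (Setoid.refl P¹.points {affinePoint 𝔭}) (degree (affinePoint 𝔭)) (affinePoint-degree 𝔭))) (weights 𝔭s)
      affine : eulerProduct (λ _ → 1ℤ) (withDegrees (map affinePoint (primesUpTo N))) n ≡ + (k.order ℕ.^ n)
      affine = ≡.trans (eulerProduct-weights (λ {x} {y} → degree-unique {x} {y}) (λ {𝔭} {𝔮} → UniqueFactorisation.degree-unique k {𝔭} {𝔮}) _ _ (weights (primesUpTo N)) n) (count-monics n≤N)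
      step : ∀ n → n ℕ.≤ N → + (k.order ℕ.^ n) ℤ.+ 1ℤ ℤ.* shift 1 ζ n ≡ ∑[ m ≤ n ] (+ (k.order ℕ.^ toℕ m))
      step zero    _   = ≡.refl
      step (suc n) n<N = begin
        + (k.order ℕ.^ suc n) ℤ.+ 1ℤ ℤ.* ζ n
          ≡⟨ cong (λ u → + (k.order ℕ.^ suc n) ℤ.+ u) (≡.trans (ℤ.*-identityˡ (ζ n)) (count-cycles n (ℕ.<⇒≤ n<N))) ⟩
        + (k.order ℕ.^ suc n) ℤ.+ ∑[ m ≤ n ] (+ (k.order ℕ.^ toℕ m))
          ≡⟨ ℤ.+-comm (+ (k.order ℕ.^ suc n)) (∑[ m ≤ n ] (+ (k.order ℕ.^ toℕ m))) ⟩
        ∑[ m ≤ n ] (+ (k.order ℕ.^ toℕ m)) ℤ.+ + (k.order ℕ.^ suc n)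
          ≡⟨ cong₂ ℤ._+_ (sum-cong-≗ {suc n} λ i → cong (λ j → + (k.order ℕ.^ j)) (≡.sym (Fin.toℕ-inject₁ i))) (cong (λ j → + (k.order ℕ.^ j)) (≡.sym (Fin.toℕ-fromℕ (suc n)))) ⟩
        ∑[ m ≤ n ] (+ (k.order ℕ.^ toℕ (inject₁ m))) ℤ.+ + (k.order ℕ.^ toℕ (fromℕ (suc n)))
          ≡⟨ sum-init-last {suc n} (λ m → + (k.order ℕ.^ toℕ m)) ⟨
        ∑[ m ≤ suc n ] (+ (k.order ℕ.^ toℕ m)) ∎
        where open ≡-Reasoning

-- Counting cycles from a classification of the fibres.

module Classified {c ℓ} (k : FiniteField c ℓ) {ℓ₁} (C : Curves.Curve k ℓ₁) where

  open MonoidSum ℤ.+-0-monoid using (sum⁺-syntax; sum-cong-≗)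
  private module k = FiniteField k
  open Curves k
  open Curve C
  open Splitting C
  open CurveProperties k C
  private module Line = ProjectiveLine k
  open Setoid points using (_≈_)
  open SetoidMembership points using () renaming (_∈_ to _∈ᶜ_)

  -- All that the count uses about the fibre over `x`. The fields `split⇒` and `inert⇒` state that
  -- the chosen type excludes the others.
  record Classification (x : P¹.Point) : Set (lsuc (c ⊔ ℓ ⊔ ℓ₁)) where
    field
      d         : ℕ
      degree    : P¹.HasDegree x (suc d)
      fibre     : Points
      graded    : Graded fibre
      unique    : Unique points (map proj₁ fibre)
      over      : ∀ {y} → y ∈ₚ fibre → y LiesOver x
      complete  : ∀ {y} → y LiesOver x → y ∈ₚ fibre
      χ         : ℤ
      splitting : SplittingType d χ (map proj₂ fibre)
      character : (Ramified x × χ ≡ 0ℤ) ⊎ (Split x × χ ≡ 1ℤ) ⊎ (Inert x × χ ≡ -1ℤ)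
      split⇒    : Split x → χ ≡ 1ℤ
      inert⇒    : Inert x → χ ≡ -1ℤ

    split⇐ : χ ≡ 1ℤ → Split x
    split⇐ χ≡1 with character
    ... | inj₁ (_ , χ≡0)         = contradiction (≡.trans (≡.sym χ≡0) χ≡1) λ ()
    ... | inj₂ (inj₁ (s , _))    = s
    ... | inj₂ (inj₂ (_ , χ≡-1)) = contradiction (≡.trans (≡.sym χ≡-1) χ≡1) λ ()

    inert⇐ : χ ≡ -1ℤ → Inert x
    inert⇐ χ≡-1 with character
    ... | inj₁ (_ , χ≡0)        = contradiction (≡.trans (≡.sym χ≡0) χ≡-1) λ ()
    ... | inj₂ (inj₁ (_ , χ≡1)) = contradiction (≡.trans (≡.sym χ≡1) χ≡-1) λ ()
    ... | inj₂ (inj₂ (i , _))   = i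

    -- No degree in a `SplittingType` is smaller than that of the base point. Hence points of degree
    -- at most N lie over enumerated points of the line.
    degree-≤ : ∀ {y e} → y LiesOver x → HasDegree y e → suc d ℕ.≤ e
    degree-≤ {y} {e} o deg = go fibre graded (large splitting) (complete o)
      where
      large : ∀ {χ ws} → SplittingType d χ ws → All (d ℕ.≤_) ws
      large ramified = ℕ.≤-refl ∷ []
      large split    = ℕ.≤-refl ∷ ℕ.≤-refl ∷ []
      large inert    = ℕ.m≤m+n d (suc d) ∷ []
      go : ∀ ws → Graded ws → All (d ℕ.≤_) (map proj₂ ws) → y ∈ₚ ws → suc d ℕ.≤ e
      go ((z , _) ∷ ws) (h ∷ hs) (d≤ ∷ _) (here e) = ℕ.≤-trans (s≤s d≤) (ℕ.≤-reflexive (degree-unique {z} {y} (Setoid.sym points e) h deg))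
      go ((z , _) ∷ ws) (h ∷ hs) (_ ∷ d≤s) (there i) = go ws hs d≤s i

  module _ (classify : ∀ x → Classification x) (below : ∀ y → ∃[ x ] y LiesOver x) where

    private module K x = Classification (classify x)

    χ : P¹.Point → ℤ
    χ = K.χ

    χ-isCharacter : IsCharacter χ
    χ-isCharacter = K.character

    private
      line : ℕ → List P¹.Point
      line = Line.pointsUpTo

      lift : List P¹.Point → Points
      lift = concatMap K.fibre

      lift-graded : ∀ xs → Graded (lift xs)
      lift-graded []       = []
      lift-graded (x ∷ xs) = All.++⁺ (K.graded x) (lift-graded xs)

      ∈-lift⁺ : ∀ {y xs} → Any (λ x → y ∈ₚ K.fibre x) xs → y ∈ₚ lift xs
      ∈-lift⁺ {y} {x ∷ xs} i = ≡.subst (y ∈ᶜ_) (≡.sym (ListProperties.map-++ proj₁ (K.fibre x) (lift xs))) (go i)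
        where
        go : Any (λ x → y ∈ₚ K.fibre x) (x ∷ xs) → y ∈ᶜ map proj₁ (K.fibre x) ++ map proj₁ (lift xs)
        go (here y∈)  = Any.++⁺ˡ y∈
        go (there i)  = Any.++⁺ʳ (map proj₁ (K.fibre x)) (∈-lift⁺ i)

      ∈-lift⁻ : ∀ {y} xs → y ∈ₚ lift xs → Any (λ x → y LiesOver x) xs
      ∈-lift⁻ {y} (x ∷ xs) i = go (Any.++⁻ (map proj₁ (K.fibre x)) (≡.subst (y ∈ᶜ_) (ListProperties.map-++ proj₁ (K.fibre x) (lift xs)) i))
        where
        go : y ∈ₚ K.fibre x ⊎ y ∈ₚ lift xs → Any (λ x → y LiesOver x) (x ∷ xs)
        go (inj₁ y∈) = here (K.over x y∈)
        go (inj₂ y∈) = there (∈-lift⁻ xs y∈)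

      -- Fibres over distinct points are disjoint, since a point lies over only one point of the
      -- line.
      lift-unique : ∀ {xs} → Unique P¹.points xs → Unique points (map proj₁ (lift xs))
      lift-unique []                   = []
      lift-unique {x ∷ xs} (x∉ ∷ xs!) = ≡.subst (Unique points) (≡.sym (ListProperties.map-++ proj₁ (K.fibre x) (lift xs)))
        (Unique.++⁺ points (K.unique x) (lift-unique xs!) λ { {y} (y∈ , y∈′) →
          All.All¬⇒¬Any x∉ (Any.map (λ {x′} o → over-unique y x x′ (K.over x y∈) o) (∈-lift⁻ xs y∈′)) })

      enumeration : ∀ N → Enumeration N
      enumeration N = record
        { list     = lift (line N)
        ; graded   = lift-graded (line N)
        ; unique   = lift-unique (Line.pointsUpTo-unique N)
        ; complete = λ {y} {e} deg e≤N → let x , o = below y in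
            ∈-lift⁺ (Any.map (λ {x′} x≈x′ → K.complete x′ (over-respʳ y {x} {x′} x≈x′ o))
              (Line.pointsUpTo-complete N x (K.degree x) (ℕ.≤-trans (K.degree-≤ x o deg) e≤N))) }

      L : ℕ → ℕ → ℤ
      L N = Line.eulerProduct χ (Line.withDegrees K.d K.degree (line N))

      -- A finiteness proof is owed for every `j`, but the identity compares Euler products
      -- truncated at the same degree `n`. The bound `n ℕ.⊔ j` is valid for all `j` and equals `n`
      -- where `j ≤ n`.
      LineSym : ∀ n j → Finite (P¹.Sym j)
      LineSym n j = Line.finiteSym (Line.enumeration K.d K.degree (n ℕ.⊔ j)) (ℕ.m≤n⊔m n j)

      sumOver-LineSym : ∀ n j → j ℕ.≤ n → sumOver {S = P¹.Sym j} (LineSym n j) (onCycles {n = j} χ) ≡ L n j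
      sumOver-LineSym n j j≤n = ≡.trans (Line.sumOver-finiteSym (Line.enumeration K.d K.degree (n ℕ.⊔ j)) (ℕ.m≤n⊔m n j) χ)
        (cong (λ N → L N j) (ℕ.m≥n⇒m⊔n≡m j≤n))

    symmetricPower : ∀ n → Finite (Curve.Sym C n)
    symmetricPower n = finiteSym (enumeration n) ℕ.≤-refl

    symmetricPower-size : ∀ n → + ∣ symmetricPower n ∣ ≡
      ∑[ i ≤ n ] ((∑[ m ≤ toℕ i ] (+ (k.order ℕ.^ toℕ m))) ℤ.* L n (n ∸ toℕ i))
    symmetricPower-size n = begin
      + ∣ symmetricPower n ∣
        ≡⟨ size-finiteSym (enumeration n) ℕ.≤-refl ⟩
      eulerProduct (λ _ → 1ℤ) (lift (line n)) n
        ≡⟨ EulerFactorisation.eulerProduct-factor (λ {x} {y} → Line.degree-unique {x} {y}) (λ {x} {y} → degree-unique {x} {y}) χ K.d K.fibre K.splitting (line n) n ⟩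
      (Line.eulerProduct (λ _ → 1ℤ) (Line.withDegrees K.d K.degree (line n)) ⊛ L n) n
        ≡⟨ sum-cong-≗ {suc n} (λ i → cong (λ u → u ℤ.* L n (n ∸ toℕ i)) (Line.count-cycles K.d K.degree (toℕ i) (ℕ.≤-pred (Fin.toℕ<n i)))) ⟩
      ∑[ i ≤ n ] ((∑[ m ≤ toℕ i ] (+ (k.order ℕ.^ toℕ m))) ℤ.* L n (n ∸ toℕ i)) ∎
      where open ≡-Reasoning

    symmetricPowers : ∀ n → Σ[ SymC ∈ Finite (Curve.Sym C n) ] Σ[ SymP¹ ∈ (∀ j → Finite (P¹.Sym j)) ]
      + ∣ SymC ∣ ≡ ∑[ i ≤ n ] ((∑[ m ≤ toℕ i ] (+ (k.order ℕ.^ toℕ m))) ℤ.* sumOver {S = P¹.Sym (n ∸ toℕ i)} (SymP¹ (n ∸ toℕ i)) (onCycles {n = n ∸ toℕ i} χ))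
    symmetricPowers n = symmetricPower n , LineSym n , ≡.trans (symmetricPower-size n)
      (sum-cong-≗ {suc n} λ i → cong (λ u → (∑[ m ≤ toℕ i ] (+ (k.order ℕ.^ toℕ m))) ℤ.* u) (≡.sym (sumOver-LineSym n (n ∸ toℕ i) (ℕ.m∸n≤m n (toℕ i)))))

    private
      values : ∀ x → K.χ x ≡ 0ℤ ⊎ K.χ x ≡ 1ℤ ⊎ K.χ x ≡ -1ℤ
      values x with K.character x
      ... | inj₁ (_ , e)        = inj₁ e
      ... | inj₂ (inj₁ (_ , e)) = inj₂ (inj₁ e)
      ... | inj₂ (inj₂ (_ , e)) = inj₂ (inj₂ e)

      sum-values : ∀ xs → foldr ℤ._+_ 0ℤ (map χ xs) ≡
        + length (filter (λ x → χ x ℤ.≟ 1ℤ) xs) ℤ.- + length (filter (λ x → χ x ℤ.≟ -1ℤ) xs)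
      sum-values [] = ≡.refl
      sum-values (x ∷ xs) with values x
      ... | inj₁ e rewrite e = ≡.trans (ℤ.+-identityˡ _) (sum-values xs)
      ... | inj₂ (inj₁ e) rewrite e = ≡.trans (cong (λ u → 1ℤ ℤ.+ u) (sum-values xs)) (≡.sym (ℤ.+-assoc 1ℤ (+ length (filter (λ x → χ x ℤ.≟ 1ℤ) xs)) (ℤ.- + length (filter (λ x → χ x ℤ.≟ -1ℤ) xs))))
      ... | inj₂ (inj₂ e) rewrite e = ≡.trans (cong (λ u → -1ℤ ℤ.+ u) (sum-values xs))
        (rearrange (+ length (filter (λ x → χ x ℤ.≟ 1ℤ) xs)) (+ length (filter (λ x → χ x ℤ.≟ -1ℤ) xs)))
        where
        rearrange : ∀ s i → -1ℤ ℤ.+ (s ℤ.- i) ≡ s ℤ.- (1ℤ ℤ.+ i)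
        rearrange = solve-∀

      rational : All (λ x → P¹.HasDegree x 1) (line 1)
      rational = Line.∞-degree ∷ All.map⁺ (All.map (λ {𝔭} d<1 → ≡.subst (λ d → P¹.HasDegree (Line.affinePoint 𝔭) (suc d)) (ℕ.n<1⇒n≡0 d<1) (Line.affinePoint-degree 𝔭))
        (UniqueFactorisation.primesUpTo-degree k 1))

      -- The listed points all have degree exactly one, so the coefficient of t is the plain sum of
      -- the values of χ.
      L-1 : L 1 1 ≡ foldr ℤ._+_ 0ℤ (map χ (line 1))
      L-1 = ≡.trans (cong (λ ws → Line.eulerProduct χ ws 1) (ListProperties.map-cong-local (All.map (λ {x} deg → cong (x ,_)
          (ℕ.suc-injective (Line.degree-unique {x} {x} (Setoid.refl P¹.points {x}) (K.degree x) deg))) rational)))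
        (eulerProduct-1 (λ {x} {y} → Line.degree-unique {x} {y}) χ (line 1))

      module Level-set (v : ℤ) where

        open SetoidMembership P¹.points using () renaming (_∈_ to _∈ᴾ_)

        xs : List P¹.Point
        xs = filter (λ x → χ x ℤ.≟ v) (line 1)

        xs-unique : Unique P¹.points xs
        xs-unique = Unique.filter⁺ P¹.points (λ x → χ x ℤ.≟ v) (Line.pointsUpTo-unique 1)

        xs-All : All (λ x → P¹.HasDegree x 1 × χ x ≡ v) xs
        xs-All = All.zip (All.filter⁺ (λ x → χ x ℤ.≟ v) rational , All.all-filter (λ x → χ x ℤ.≟ v) (line 1))

        xs-complete : (∀ {x y} → Setoid._≈_ P¹.points x y → χ x ≡ v → χ y ≡ v) → ∀ {x} → P¹.HasDegree x 1 → χ x ≡ v → x ∈ᴾ xs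
        xs-complete resp {x} deg e = Membership.∈-filter⁺ P¹.points (λ x → χ x ℤ.≟ v) resp (Line.pointsUpTo-complete 1 x deg ℕ.≤-refl) e

      module S = Level-set 1ℤ
      module I = Level-set -1ℤ

      rationalSplit-All : All (λ x → P¹.HasDegree x 1 × Split x) S.xs
      rationalSplit-All = All.map (λ { {x} (deg , e) → deg , K.split⇐ x e }) S.xs-All

      rationalInert-All : All (λ x → P¹.HasDegree x 1 × Inert x) I.xs
      rationalInert-All = All.map (λ { {x} (deg , e) → deg , K.inert⇐ x e }) I.xs-All

      -- `χ` is computed from a representative, and equal ideals might a priori be classified
      -- differently. But χ(x) = 1 is equivalent to `Split x`, which respects equality, so filtering
      -- by the value of `χ` loses nothing.
      rationalSplit-complete : ∀ {x} → P¹.HasDegree x 1 × Split x → SetoidMembership._∈_ P¹.points x S.xs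
      rationalSplit-complete {x} (deg , s) = S.xs-complete (λ {x} {y} x≈y e → K.split⇒ y (Split-resp {x} {y} x≈y (K.split⇐ x e))) {x} deg (K.split⇒ x s)

      rationalInert-complete : ∀ {x} → P¹.HasDegree x 1 × Inert x → SetoidMembership._∈_ P¹.points x I.xs
      rationalInert-complete {x} (deg , i) = I.xs-complete (λ {x} {y} x≈y e → K.inert⇒ y (Inert-resp {x} {y} x≈y (K.inert⇐ x e))) {x} deg (K.inert⇒ x i)

    rationalSplit-finite : Finite rationalSplit
    rationalSplit-finite = fromAll P¹.points rationalSplit-All S.xs-unique (λ {x} → rationalSplit-complete {x})

    rationalInert-finite : Finite rationalInert
    rationalInert-finite = fromAll P¹.points rationalInert-All I.xs-unique (λ {x} → rationalInert-complete {x})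

    -- The case n = 1 of the formula for symmetric powers
    trace-formula : (+ k.order ℤ.+ + 1) ℤ.- + ∣ symmetricPower 1 ∣ ≡ + ∣ rationalInert-finite ∣ ℤ.- + ∣ rationalSplit-finite ∣
    trace-formula = begin
      (+ k.order ℤ.+ + 1) ℤ.- + ∣ symmetricPower 1 ∣
        ≡⟨ cong₂ (λ q s → (+ q ℤ.+ + 1) ℤ.- s) (≡.sym (ℕ.*-identityʳ k.order)) (symmetricPower-size 1) ⟩
      (+ (k.order ℕ.^ 1) ℤ.+ + 1) ℤ.- ((1ℤ ℤ.+ 0ℤ) ℤ.* L 1 1 ℤ.+ ((1ℤ ℤ.+ (+ (k.order ℕ.^ 1) ℤ.+ 0ℤ)) ℤ.* L 1 0 ℤ.+ 0ℤ))
        ≡⟨ cong₂ (λ l₁ l₀ → (+ (k.order ℕ.^ 1) ℤ.+ + 1) ℤ.- ((1ℤ ℤ.+ 0ℤ) ℤ.* l₁ ℤ.+ ((1ℤ ℤ.+ (+ (k.order ℕ.^ 1) ℤ.+ 0ℤ)) ℤ.* l₀ ℤ.+ 0ℤ)))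
             (≡.trans L-1 (sum-values (line 1))) (eulerProduct-0 (λ {x} {y} → Line.degree-unique {x} {y}) χ (Line.withDegrees K.d K.degree (line 1))) ⟩
      (+ (k.order ℕ.^ 1) ℤ.+ + 1) ℤ.- ((1ℤ ℤ.+ 0ℤ) ℤ.* (+ length S.xs ℤ.- + length I.xs) ℤ.+ ((1ℤ ℤ.+ (+ (k.order ℕ.^ 1) ℤ.+ 0ℤ)) ℤ.* 1ℤ ℤ.+ 0ℤ))
        ≡⟨ rearrange (+ (k.order ℕ.^ 1)) (+ length S.xs) (+ length I.xs) ⟩
      + length I.xs ℤ.- + length S.xs
        ≡⟨ cong₂ (λ i s → + i ℤ.- + s) (size-fromAll P¹.points rationalInert-All I.xs-unique (λ {x} → rationalInert-complete {x})) (size-fromAll P¹.points rationalSplit-All S.xs-unique (λ {x} → rationalSplit-complete {x})) ⟨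
      + ∣ rationalInert-finite ∣ ℤ.- + ∣ rationalSplit-finite ∣ ∎
      where
      open ≡-Reasoning
      rearrange : ∀ q s i → (q ℤ.+ 1ℤ) ℤ.- ((1ℤ ℤ.+ 0ℤ) ℤ.* (s ℤ.- i) ℤ.+ ((1ℤ ℤ.+ (q ℤ.+ 0ℤ)) ℤ.* 1ℤ ℤ.+ 0ℤ)) ≡ i ℤ.- s
      rearrange = solve-∀

-- Classification of the fibres of an elliptic curve.

module EllipticCurvePoints {c ℓ} (k : FiniteField c ℓ) (E : EllipticCurve k) where

  open ⊎ using (inj₁; inj₂)
  private module k = FiniteField k
  open Curves k
  C : Curve _
  C = ellipticCurve E
  open Curve C
  open Splitting C
  open CurveProperties k C
  open Classified k C
  open WeierstrassCharts k E
  open FieldPolynomials k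
  open Prime
  open PrimeResidueField k using (residueDegree)
  private
    module Line = ProjectiveLine k
    module AI = IdealProperties k[x]
    module Dx = ResidueDegreeProperties k.commutativeRing k[x] (Polynomial.const k.commutativeRing)
  open Setoid points using (_≈_) renaming (sym to ≈-sym; trans to ≈-trans)
  open Ideals k[x] using () renaming (MaximalIdeal to MaximalIdealₓ; ideal to idealₓ)

  private
    exponent-1≠2 : ∀ y → HasRamificationIndex y 2 → ¬ HasRamificationIndex y 1
    exponent-1≠2 (inj₁ P)       (p⊆P² , _) (_ , p⊈P²) = p⊈P² p⊆P²
    exponent-1≠2 (inj₂ (P , _)) (p⊆P² , _) (_ , p⊈P²) = p⊈P² p⊆P²

    -- Exponents 1 and 2 at the same point contradict each other; this excludes both `Split` and
    -- `Inert`.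
    ramifiedClassification : ∀ x d y → P¹.HasDegree x (suc d) → HasDegree y (suc d) → y LiesOver x →
      HasRamificationIndex y 2 → (∀ {z} → z LiesOver x → z ≈ y) → Classification x
    ramifiedClassification x d y deg-x deg-y y-over e only = record
      { d         = d
      ; degree    = deg-x
      ; fibre     = (y , d) ∷ []
      ; graded    = deg-y ∷ []
      ; unique    = [] ∷ []
      ; over      = λ { {z} (here z≈y) → over-respˡ {y} {z} x (≈-sym z≈y) y-over }
      ; complete  = λ o → here (only o)
      ; χ         = 0ℤ
      ; splitting = ramified
      ; character = inj₁ ((y , y-over , 2 , e , s≤s (s≤s z≤n)) , ≡.refl)
      ; split⇒    = λ s → contradiction (proj₁ (s y y-over)) (exponent-1≠2 y e)
      ; inert⇒    = λ { (z , z-over , _ , e′) → contradiction (index-resp {z} {y} {1} (only {z} z-over) e′) (exponent-1≠2 y e) } }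

    -- Two distinct points above `x` exclude `Inert`.
    splitClassification : ∀ x d y y′ → P¹.HasDegree x (suc d) → HasDegree y (suc d) → HasDegree y′ (suc d) →
      y LiesOver x → y′ LiesOver x → ¬ y ≈ y′ → Split x → (∀ {z} → z LiesOver x → z ≈ y ⊎ z ≈ y′) → Classification x
    splitClassification x d y y′ deg-x deg-y deg-y′ y-over y′-over y≉y′ s only = record
      { d         = d
      ; degree    = deg-x
      ; fibre     = (y , d) ∷ (y′ , d) ∷ []
      ; graded    = deg-y ∷ deg-y′ ∷ []
      ; unique    = (y≉y′ ∷ []) ∷ [] ∷ []
      ; over      = λ { {z} (here z≈y) → over-respˡ {y} {z} x (≈-sym z≈y) y-over
                      ; {z} (there (here z≈y′)) → over-respˡ {y′} {z} x (≈-sym z≈y′) y′-over }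
      ; complete  = λ {z} o → [ here , there ∘ here ]′ (only {z} o)
      ; χ         = 1ℤ
      ; splitting = split
      ; character = inj₂ (inj₁ (s , ≡.refl))
      ; split⇒    = λ _ → ≡.refl
      ; inert⇒    = λ { (z , _ , unique , _) → contradiction (≈-trans (unique y y-over) (≈-sym (unique y′ y′-over))) y≉y′ } }

    -- `Split` would require residue degree one over `x`, which is excluded by hypothesis.
    inertClassification : ∀ x d y → P¹.HasDegree x (suc d) → HasDegree y (suc d ℕ.+ suc d) → y LiesOver x →
      HasRamificationIndex y 1 → ¬ HasResidueDegree y 1 → (∀ {z} → z LiesOver x → z ≈ y) → Classification x
    inertClassification x d y deg-x deg-y y-over e f only = record
      { d         = d
      ; degree    = deg-x
      ; fibre     = (y , d ℕ.+ suc d) ∷ []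
      ; graded    = deg-y ∷ []
      ; unique    = [] ∷ []
      ; over      = λ { {z} (here z≈y) → over-respˡ {y} {z} x (≈-sym z≈y) y-over }
      ; complete  = λ o → here (only o)
      ; χ         = -1ℤ
      ; splitting = inert
      ; character = inj₂ (inj₂ ((y , y-over , (λ z o → only {z} o) , e) , ≡.refl))
      ; split⇒    = λ s → contradiction (proj₂ (s y y-over)) f
      ; inert⇒    = λ _ → ≡.refl }

  module AffineFibre (P₀ : MaximalIdealₓ) (𝔭 : Prime) (e : idealₓ ⟨ 𝔭 ⟩ ≐ idealₓ P₀) where

    private
      x : P¹.Point
      x = inj₁ P₀

      lies : ∀ Q → Aff.φ (poly 𝔭) ∈ Aff.ideal Q → inj₁ Q LiesOver x
      lies Q p∈ = ≐-trans (≐-sym e) (Affine.contraction Q 𝔭 p∈)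

      contains : ∀ Q → inj₁ Q LiesOver x → Aff.φ (poly 𝔭) ∈ Aff.ideal Q
      contains Q o = proj₁ o (proj₁ e (AI.generator∈ (poly 𝔭)))

      degree : P¹.HasDegree x (suc (deg-1 𝔭))
      degree = Dx.ResidueDegree-resp {⟨ 𝔭 ⟩} {P₀} e (residueDegree 𝔭)

    classify : Affine.RamifiedFibre 𝔭 ⊎ Affine.SplitFibre 𝔭 ⊎ Affine.InertFibre 𝔭 → Classification x
    classify (inj₁ R) = ramifiedClassification x (deg-1 𝔭) (inj₁ R.point) degree R.degree (lies R.point R.over) R.exponent
      λ { {inj₁ Q} o → inj₁ (R.only Q (contains Q o)) ; {inj₂ Q} o → Polymorphic.⊥-elim o }
      where module R = Affine.RamifiedFibre R
    classify (inj₂ (inj₁ S)) = splitClassification x (deg-1 𝔭) (inj₁ S.point₁) (inj₁ S.point₂) degree S.degree₁ S.degree₂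
      (lies S.point₁ S.over₁) (lies S.point₂ S.over₂) (λ { (inj₁ e) → S.distinct e }) unramified
      λ { {inj₁ Q} o → only Q o ; {inj₂ Q} o → Polymorphic.⊥-elim o }
      where
      module S = Affine.SplitFibre S
      only : ∀ Q → inj₁ Q LiesOver x → inj₁ Q ≈ inj₁ S.point₁ ⊎ inj₁ Q ≈ inj₁ S.point₂
      only Q o = Sum.map inj₁ inj₁ (S.only Q (contains Q o))
      unramified : Split x
      unramified (inj₂ Q) o = Polymorphic.⊥-elim o
      unramified (inj₁ Q) o = [ near S.point₁ S.exponent₁ S.relative₁ , near S.point₂ S.exponent₂ S.relative₂ ]′ (only Q o)
        where
        near : ∀ P → HasRamificationIndex (inj₁ P) 1 → HasResidueDegree (inj₁ P) 1 → inj₁ Q ≈ inj₁ P →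
          HasRamificationIndex (inj₁ Q) 1 × HasResidueDegree (inj₁ Q) 1
        near P e f Q≈P = index-resp {inj₁ P} {inj₁ Q} {1} (≈-sym Q≈P) e , residue-resp {inj₁ P} {inj₁ Q} (≈-sym Q≈P) f
    classify (inj₂ (inj₂ I)) = inertClassification x (deg-1 𝔭) (inj₁ I.point) degree I.degree (lies I.point I.over) I.exponent I.¬relative
      λ { {inj₁ Q} o → inj₁ (I.only Q (contains Q o)) ; {inj₂ Q} o → Polymorphic.⊥-elim o }
      where module I = Affine.InertFibre I

  private module R∞ = Infinity.RamifiedFibre fibre∞

  ∞ᴱ : Point
  ∞ᴱ = inj₂ (R∞.point , R∞.over)

  ∞ᴱ-only : ∀ Q (X∈ : Inf.φ (Polynomial.X k.commutativeRing) ∈ Inf.ideal Q) → inj₂ (Q , X∈) ≈ ∞ᴱ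
  ∞ᴱ-only Q X∈ = inj₂ (R∞.only Q X∈)

  classify : ∀ x → Classification x
  classify (inj₁ P₀) = let 𝔭 , e = Line.prime-of P₀ in AffineFibre.classify P₀ 𝔭 e (fibre 𝔭)
  classify (inj₂ (P₀ , X∈)) = ramifiedClassification (inj₂ (P₀ , X∈)) 0 ∞ᴱ
    (Dx.ResidueDegree-resp {⟨ X-prime ⟩} {P₀} e (residueDegree X-prime)) R∞.degree
    (≐-trans (≐-sym e) (Infinity.contraction R∞.point X-prime R∞.over)) R∞.exponent
    λ { {inj₁ Q} o → Polymorphic.⊥-elim o ; {inj₂ (Q , X∈)} o → ∞ᴱ-only Q X∈ }
    where e = Line.generated X-prime P₀ X∈

  belowPoint : ∀ y → ∃[ x ] y LiesOver x
  belowPoint (inj₁ Q)        = let 𝔭 , p∈ = Affine.below Q in Line.affinePoint 𝔭 , Affine.contraction Q 𝔭 p∈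
  belowPoint (inj₂ (Q , X∈)) = Line.∞ , Infinity.contraction Q X-prime X∈

-- Rational points as closed points of degree one.

module RationalPoints {c ℓ} (k : FiniteField c ℓ) (E : EllipticCurve k) where

  open ⊎ using (inj₁; inj₂)
  private module k = FiniteField k
  open Curves k
  open EllipticCurve E
  open EllipticCurvePoints k E using (C; ∞ᴱ; ∞ᴱ-only)
  open Curve C
  open CurveProperties k C
  open WeierstrassCharts k E
  open FieldPolynomials k
  open Prime
  private
    module x = Polynomial k.commutativeRing
    module PP = PolynomialProperties k.commutativeRing
    module A = CommutativeRing k[x]
    module AI = IdealProperties k[x]
    module BI = IdealProperties Aff.ring
    module B = CommutativeRing Aff.ring
    module Sk = IntegerCoefficients k.commutativeRing
    module R = SetoidReasoning k.setoid
    F = Quadratic.F k[x] h g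
    module R∞ = Infinity.RamifiedFibre fibre∞
    module FD = FiniteResidueDegree k Aff.ring (Aff.φ ∘ x.const)
      (Composition.isRingHomomorphism B.trans x.const-isRingHomomorphism Aff.isRingHomomorphism)
  open PolynomialProperties k[x] using (eval; X-_)
  open RingProperties k.ring using (x∙y⁻¹≈ε⇒x≈y; x≈y⇒x∙y⁻¹≈ε)
  open Setoid points using (_≈_)

  valueAt : k.Carrier → k.Carrier → k.Carrier
  valueAt a b = PP.eval a (eval (x.const b) F)

  weierstrass : ∀ a b → valueAt a b k.≈
    (b k.* b k.+ a₁ k.* a k.* b k.+ a₃ k.* b) k.- (a k.* a k.* a k.+ a₂ k.* a k.* a k.+ a₄ k.* a k.+ a₆)
  weierstrass a b = R.begin
    PP.eval a (eval (x.const b) F)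
      R.≈⟨ PP.eval-cong a (Quadratic.eval-F k[x] h g (x.const b)) ⟩
    PP.eval a (x.const b A.* x.const b A.+ h A.* x.const b A.- g)
      R.≈⟨ k.trans (PP.eval-+ a (x.const b A.* x.const b A.+ h A.* x.const b) (A.- g)) (k.+-cong (k.trans (PP.eval-+ a (x.const b A.* x.const b) (h A.* x.const b))
             (k.+-cong (PP.eval-* a (x.const b) (x.const b)) (PP.eval-* a h (x.const b)))) (PP.eval-neg a g)) ⟩
    (PP.eval a (x.const b) k.* PP.eval a (x.const b) k.+ PP.eval a h k.* PP.eval a (x.const b)) k.- PP.eval a g
      R.≈⟨ Sk.solve 7 (λ a₁ a₂ a₃ a₄ a₆ a b →
            let β = b Sk.:+ a Sk.:* Sk.con (+ 0) in
            (β Sk.:* β Sk.:+ (a₃ Sk.:+ a Sk.:* (a₁ Sk.:+ a Sk.:* Sk.con (+ 0))) Sk.:* β) Sk.:-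
              (a₆ Sk.:+ a Sk.:* (a₄ Sk.:+ a Sk.:* (a₂ Sk.:+ a Sk.:* (Sk.con (+ 1) Sk.:+ a Sk.:* Sk.con (+ 0))))) Sk.:=
            (b Sk.:* b Sk.:+ a₁ Sk.:* a Sk.:* b Sk.:+ a₃ Sk.:* b) Sk.:- (a Sk.:* a Sk.:* a Sk.:+ a₂ Sk.:* a Sk.:* a Sk.:+ a₄ Sk.:* a Sk.:+ a₆))
           k.refl a₁ a₂ a₃ a₄ a₆ a b ⟩
    (b k.* b k.+ a₁ k.* a k.* b k.+ a₃ k.* b) k.- (a k.* a k.* a k.+ a₂ k.* a k.* a k.+ a₄ k.* a k.+ a₆) R.∎

  -- F(b), a polynomial in x, has the value zero at a by the Weierstrass equation, so x - a divides
  -- it.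
  root : ∀ a b → Solution (a , b) → AI.multiples (PP.X-_ a) (eval (x.const b) F)
  root a b sol = let s , e = PP.factor a (eval (x.const b) F) in
    s , A.trans e (A.trans (A.+-congˡ {s A.* (PP.X-_ a)} (A.trans (x.∷-cong (k.trans (weierstrass a b) (x≈y⇒x∙y⁻¹≈ε sol)) (x.reflₚ {[]})) x.0∷[]≈[])) (A.+-identityʳ (s A.* (PP.X-_ a))))

  module At (a b : k.Carrier) (sol : Solution (a , b)) where
    open Affine.Root (linear a) (x.const b) (root a b sol) public

  private
    scalar-difference : ∀ a a′ → PP.X-_ a A.- PP.X-_ a′ A.≈ x.const (a′ k.- a)
    scalar-difference a a′ = x.∷-cong (Sk.solve 2 (λ a a′ → Sk.:- a Sk.:- Sk.:- a′ Sk.:= a′ Sk.:- a) k.refl a a′)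
      (A.trans (x.∷-cong (k.-‿inverseʳ k.1#) (x.reflₚ {[]})) x.0∷[]≈[])

  -- The differences a - a′ and b - b′ are scalars in `Q`, and a nonzero scalar is a unit.
  coordinates-unique : ∀ Q a b a′ b′ → Aff.φ (PP.X-_ a) ∈ Aff.ideal Q → X- (x.const b) ∈ Aff.ideal Q →
    Aff.φ (PP.X-_ a′) ∈ Aff.ideal Q → X- (x.const b′) ∈ Aff.ideal Q → a k.≈ a′ × b k.≈ b′
  coordinates-unique Q a b a′ b′ a∈ b∈ a′∈ b′∈ =
    x∙y⁻¹≈ε⇒x≈y a a′ (FD.φ∈⇒≈0 Q {a k.- a′} (Q.resp {Aff.φ (PP.X-_ a′) B.- Aff.φ (PP.X-_ a)} {Aff.φ (x.const (a k.- a′))}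
      (Affine-φ-cong (scalar-difference a′ a)) (Q.+∈ {Aff.φ (PP.X-_ a′)} a′∈ (Q.-∈ {Aff.φ (PP.X-_ a)} a∈)))) ,
    x∙y⁻¹≈ε⇒x≈y b b′ (FD.φ∈⇒≈0 Q {b k.- b′} (Q.resp {X- (x.const b′) B.- X- (x.const b)} {Aff.φ (x.const (b k.- b′))}
      (Quadratic.≈⇒≈ᵐ k[x] h g (Y.∷-cong (x.∷-cong (Sk.solve 2 (λ b b′ → Sk.:- b′ Sk.:- Sk.:- b Sk.:= b Sk.:- b′) k.refl b b′) (x.reflₚ {[]}))
        (Y.transₚ (Y.∷-cong (A.-‿inverseʳ A.1#) (Y.reflₚ {[]})) Y.0∷[]≈[])))
      (Q.+∈ {X- (x.const b′)} b′∈ (Q.-∈ {X- (x.const b)} b∈))))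
    where
    module Q = BI.MaximalIdealProperties Q
    module Y = Polynomial k[x]
    Affine-φ-cong : ∀ {f f′} → f A.≈ f′ → Aff.φ f B.≈ Aff.φ f′
    Affine-φ-cong e = Quadratic.≈⇒≈ᵐ k[x] h g (Y.∷-cong e (Y.reflₚ {[]}))

  -- The residue field is k, so x and y have values a and b there. Then F(b) lies in the contraction
  -- (x - a) of `Q`, and its remainder F(a , b) is a scalar in `Q`, hence zero.
  coordinates-exist : ∀ Q → HasDegree (inj₁ Q) 1 →
    ∃[ a ] ∃[ b ] Aff.φ (PP.X-_ a) ∈ Aff.ideal Q × X- (x.const b) ∈ Aff.ideal Q × Solution (a , b)
  coordinates-exist Q deg = a , b , a∈ , b∈ , x∙y⁻¹≈ε⇒x≈y _ _ (k.trans (k.sym (weierstrass a b)) vanishes)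
    where
    module Q = BI.MaximalIdealProperties Q
    module Y = Polynomial k[x]
    a b : k.Carrier
    a = proj₁ (FD.value Q deg (Aff.φ x.X))
    b = proj₁ (FD.value Q deg Y.X)
    a∈ : Aff.φ (PP.X-_ a) ∈ Aff.ideal Q
    a∈ = Q.resp {Aff.φ x.X B.- Aff.φ (x.const a)} {Aff.φ (PP.X-_ a)}
      (Quadratic.≈⇒≈ᵐ k[x] h g (Y.∷-cong (x.∷-cong (k.+-identityˡ (k.- a)) (x.reflₚ {k.1# ∷ []})) (Y.reflₚ {[]})))
      (proj₂ (FD.value Q deg (Aff.φ x.X)))
    b∈ : X- (x.const b) ∈ Aff.ideal Q
    b∈ = proj₂ (FD.value Q deg Y.X)
    w∈ : AI.multiples (PP.X-_ a) (eval (x.const b) F)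
    w∈ = proj₂ (Affine.contraction Q (linear a) a∈) (Affine.root-vanishes Q (x.const b) b∈)
    vanishes : valueAt a b k.≈ k.0#
    vanishes = FD.φ∈⇒≈0 Q {valueAt a b} (proj₁ (Affine.contraction Q (linear a) a∈) (value∈ (PP.factor a (eval (x.const b) F))))
      where
      module I = AI.IsIdealProperties (AI.multiples-isIdeal (PP.X-_ a))
      value∈ : ∃[ s ] eval (x.const b) F A.≈ s A.* (PP.X-_ a) A.+ x.const (valueAt a b) → AI.multiples (PP.X-_ a) (x.const (valueAt a b))
      value∈ (s , e) = I.difference∈ {eval (x.const b) F} {x.const (valueAt a b)} {s A.* (PP.X-_ a)}
        (A.trans (A.+-congʳ e) (cancel (s A.* (PP.X-_ a)) (x.const (valueAt a b)))) w∈ (s , A.refl)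
        where
        cancel : ∀ u v → (u A.+ v) A.- v A.≈ u
        cancel = IntegerCoefficients.solve k[x] 2 (λ u v → (u SA.:+ v) SA.:- v SA.:= u) A.refl
          where module SA = IntegerCoefficients k[x]

  private
    module E[k] = Setoid rationalPoints

    point : E[k].Carrier → Point
    point (inj₁ ((a , b) , sol)) = inj₁ (At.point a b sol)
    point (inj₂ _)               = ∞ᴱ

    point-degree : ∀ P → HasDegree (point P) 1
    point-degree (inj₁ ((a , b) , sol)) = At.degree a b sol
    point-degree (inj₂ _)               = R∞.degree

    x-resp : ∀ Q {a a′} → a k.≈ a′ → Aff.φ (PP.X-_ a) ∈ Aff.ideal Q → Aff.φ (PP.X-_ a′) ∈ Aff.ideal Q
    x-resp Q {a} {a′} e = BI.MaximalIdealProperties.resp Q {Aff.φ (PP.X-_ a)} {Aff.φ (PP.X-_ a′)}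
      (Quadratic.≈⇒≈ᵐ k[x] h g (Y.∷-cong (x.∷-cong (k.-‿cong e) (x.reflₚ {k.1# ∷ []})) (Y.reflₚ {[]})))
      where module Y = Polynomial k[x]

    y-resp : ∀ Q {b b′} → b k.≈ b′ → X- (x.const b) ∈ Aff.ideal Q → X- (x.const b′) ∈ Aff.ideal Q
    y-resp Q {b} {b′} e = BI.MaximalIdealProperties.resp Q {X- (x.const b)} {X- (x.const b′)}
      (Quadratic.≈⇒≈ᵐ k[x] h g (Y.∷-cong (x.∷-cong (k.-‿cong e) (x.reflₚ {[]})) (Y.reflₚ {A.1# ∷ []})))
      where module Y = Polynomial k[x]

    point-cong : ∀ {P Q} → P E[k].≈ Q → point P ≈ point Q
    point-cong {inj₂ _} {inj₂ _} (inj₂ _) = Setoid.refl points {∞ᴱ}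
    point-cong {inj₁ ((a , b) , sol)} {inj₁ ((a′ , b′) , sol′)} (inj₁ (a≈a′ , b≈b′)) = inj₁ (At.only a b sol (At.point a′ b′ sol′)
      (x-resp (At.point a′ b′ sol′) (k.sym a≈a′) (At.over a′ b′ sol′))
      (y-resp (At.point a′ b′ sol′) (k.sym b≈b′) (At.X-r∈ a′ b′ sol′)))

    separate : ∀ P Q a b a′ b′ → Aff.φ (PP.X-_ a) ∈ Aff.ideal P → X- (x.const b) ∈ Aff.ideal P →
      Aff.φ (PP.X-_ a′) ∈ Aff.ideal Q → X- (x.const b′) ∈ Aff.ideal Q → Aff.ideal P ≐ Aff.ideal Q → a k.≈ a′ × b k.≈ b′
    separate P Q a b a′ b′ a∈ b∈ a′∈ b′∈ (P⊆Q , _) = coordinates-unique Q a b a′ b′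
      (P⊆Q {Aff.φ (PP.X-_ a)} a∈) (P⊆Q {X- (x.const b)} b∈) a′∈ b′∈

    point-injective : ∀ {P Q} → point P ≈ point Q → P E[k].≈ Q
    point-injective {inj₂ tt} {inj₂ tt} _ = inj₂ ≡.refl
    point-injective {inj₁ ((a , b) , sol)} {inj₁ ((a′ , b′) , sol′)} (inj₁ P≐Q) = inj₁ (separate (At.point a b sol) (At.point a′ b′ sol′) a b a′ b′
      (At.over a b sol) (At.X-r∈ a b sol) (At.over a′ b′ sol′) (At.X-r∈ a′ b′ sol′) P≐Q)

    point-surjective : ∀ y → HasDegree y 1 → ∃[ P ] point P ≈ y
    point-surjective (inj₂ (Q , X∈)) _ = inj₂ tt , Setoid.sym points (∞ᴱ-only Q X∈)
    point-surjective (inj₁ Q) deg = let a , b , a∈ , b∈ , sol = coordinates-exist Q deg in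
      inj₁ ((a , b) , sol) , inj₁ (At.only a b sol Q a∈ b∈)

  rationalPoints-finite : Finite (Curve.Sym C 1) → Finite rationalPoints
  rationalPoints-finite = points-of-degree-one rationalPoints point point-degree
    (λ {P} {Q} → point-cong {P} {Q}) (λ {P} {Q} → point-injective {P} {Q}) point-surjective

open import Data.Integer.Base using (_+_; _-_; _*_)
open import Data.Integer.Properties using (+-0-monoid)
open import Data.Nat.Base using (_^_; _∸_)
open import Algebra.Properties.Monoid.Sum +-0-monoid using (sum⁺-syntax)

mainTheorem3 : ∀ {c ℓ} (k : FiniteField c ℓ) (E : EllipticCurve k) →
    let open Curves k
        C = ellipticCurve E
        q = FiniteField.order k
        open Curve C using (Sym)
        open Splitting C
    in
    (Σ[ E[k] ∈ Finite (EllipticCurve.rationalPoints E) ]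
     Σ[ split ∈ Finite rationalSplit ]
     Σ[ inert ∈ Finite rationalInert ]
       (+ q + + 1) - + ∣ E[k] ∣ ≡ + ∣ inert ∣ - + ∣ split ∣)
    ×
    (Σ[ χ ∈ (P¹.Point → ℤ) ] IsCharacter χ ×
      (∀ (n : ℕ) →
        Σ[ SymE ∈ Finite (Sym n) ]
        Σ[ SymP¹ ∈ (∀ j → Finite (P¹.Sym j)) ]
          + ∣ SymE ∣ ≡
            (∑[ i ≤ n ] ((∑[ m ≤ toℕ i ] (+ (q ^ toℕ m)))
                         * sumOver (SymP¹ (n ∸ toℕ i)) (onCycles χ)))))
mainTheorem3 k E =
  ( rationalPoints-finite (symmetricPower classify belowPoint 1)
  , rationalSplit-finite classify belowPoint
  , rationalInert-finite classify belowPoint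
  , trace-formula classify belowPoint )
  , χ classify belowPoint , χ-isCharacter classify belowPoint , symmetricPowers classify belowPoint
  where
  open EllipticCurvePoints k E
  open RationalPoints k E
  open Classified k C
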